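{- There exists a fixed tree automatic structure $\mathcal{A}$ of bounded degree and linear growth (i.e., $g'_{\mathcal{A}}(n)\in O(n)$) such that $\mathrm{FOTh}(\mathcal{A})$ is $\mathsf{2EXPTIME}$-hard.
   Context: Finite binary trees over $\Gamma$ are maps $t:\mathrm{dom}(t)\to\Gamma$ with $\mathrm{dom}(t)\subseteq\{0,1\}^*$ finite, nonempty, and for all $w$, if $\{w0,w1\}\cap\mathrm{dom}(t)\neq\emptyset$ then $w,w0\in\mathrm{dom}(t)$. The convolution $t_1\otimes\cdots\otimes t_m$ is the tree over $(\Gamma\cup\{\$\})^m$ with domain $\bigcup_i\mathrm{dom}(t_i)$ labelled $(a_1,\dots,a_m)$ at $w$, $a_i=t_i(w)$ if defined and $\$$ otherwise. A relation on trees is tree-automatic if the set of convolutions of its tuples is accepted by a finite tree automaton. A structure over a finite relational signature is tree automatic if it is isomorphic to $(L,(R_r)_r)/{\equiv}$ with $L$ a regular set of finite binary trees and $R_r$, $\equiv$ tree-automatic ($\equiv$ a congruence). The Gaifman graph has an edge between $a,b$ iff they occur together in a tuple of some relation; $S(n,a)$ is the set of elements at distance $\le n$ from $a$. Bounded degree: some constant bounds the number of neighbours of every node; $g_{\mathcal{A}}(n)=\max_a|S(n,a)|$, $g'_{\mathcal{A}}(n)=\max\{n,g_{\mathcal{A}}(n)\}$. $\mathrm{FOTh}(\mathcal{A})$ is the set of closed first-order formulas true in $\mathcal{A}$. $\mathsf{2EXPTIME}$: problems decidable in deterministic time $2^{2^{n^{O(1)}}}$. -}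

module Defs where

open import Data.Nat using (ℕ; zero; suc; _+_; _*_; _^_; _≤_)
open import Data.Fin using (Fin; zero; suc; toℕ)
open import Data.Vec as Vec using (Vec; []; _∷_; replicate; lookup)
open import Data.Vec.Relation.Unary.All as VAll using ()
open import Data.Vec.Relation.Binary.Pointwise.Inductive using (Pointwise)
open import Data.List as List using (List; []; _∷_; _++_; length; concatMap)
open import Data.List.Relation.Unary.All using (All)
open import Data.List.Relation.Unary.AllPairs using (AllPairs)
open import Data.Maybe as Maybe using (Maybe; just; nothing; fromMaybe)
open import Data.Bool using (Bool; true; false; if_then_else_)
open import Data.Product using (Σ; _×_; _,_; proj₁; proj₂)
open import Relation.Nullary using (¬_)
open import Relation.Binary.PropositionalEquality using (_≡_)
open import Function.Bundles using (_⇔_)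

-- Finite binary trees.  A node has no child, only a left child (w0),
-- or both children (w0, w1): this is exactly the domain condition
-- (finite, nonempty, prefix closed, w1 ∈ dom ⇒ w0 ∈ dom).

data BTree (A : Set) : Set where
  leaf  : A → BTree A
  node1 : A → BTree A → BTree A
  node2 : A → BTree A → BTree A → BTree A

mapT : {A B : Set} → (A → B) → BTree A → BTree B
mapT f (leaf a) = leaf (f a)
mapT f (node1 a s) = node1 (f a) (mapT f s)
mapT f (node2 a s t) = node2 (f a) (mapT f s) (mapT f t)

-- convolution of two trees (domain = union, missing labels = nothing = $)
conv2 : {A B : Set} → BTree A → BTree B → BTree (Maybe A × Maybe B)
conv2 {A} {B} = go
  where
  L : BTree A → BTree (Maybe A × Maybe B)
  L = mapT (λ a → just a , nothing)
  R : BTree B → BTree (Maybe A × Maybe B)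
  R = mapT (λ b → nothing , just b)
  go : BTree A → BTree B → BTree (Maybe A × Maybe B)
  go (leaf a) (leaf b) = leaf (just a , just b)
  go (leaf a) (node1 b t) = node1 (just a , just b) (R t)
  go (leaf a) (node2 b t u) = node2 (just a , just b) (R t) (R u)
  go (node1 a s) (leaf b) = node1 (just a , just b) (L s)
  go (node1 a s) (node1 b t) = node1 (just a , just b) (go s t)
  go (node1 a s) (node2 b t u) = node2 (just a , just b) (go s t) (R u)
  go (node2 a s v) (leaf b) = node2 (just a , just b) (L s) (L v)
  go (node2 a s v) (node1 b t) = node2 (just a , just b) (go s t) (L v)
  go (node2 a s v) (node2 b t u) = node2 (just a , just b) (go s t) (go v u)

combine1 : {A : Set} {m : ℕ} → BTree A → Maybe (BTree (Vec (Maybe A) m))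
         → BTree (Vec (Maybe A) (suc m))
combine1 {m = m} s nothing = mapT (λ a → just a ∷ replicate m nothing) s
combine1 {m = m} s (just u) =
  mapT (λ p → proj₁ p ∷ fromMaybe (replicate m nothing) (proj₂ p)) (conv2 s u)

convM : {A : Set} {m : ℕ} → Vec (Maybe (BTree A)) m → Maybe (BTree (Vec (Maybe A) m))
convM [] = nothing
convM (nothing ∷ ts) = Maybe.map (mapT (nothing ∷_)) (convM ts)
convM (just s ∷ ts) = just (combine1 s (convM ts))

conv : {A : Set} {m : ℕ} → Vec (BTree A) (suc m) → BTree (Vec (Maybe A) (suc m))
conv (t ∷ ts) = combine1 t (convM (Vec.map just ts))

record TreeAut (Σ' : Set) : Set where
  field
    nQ    : ℕ
    final : Fin nQ → Bool
    δ0    : Σ' → Fin nQ → Bool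
    δ1    : Σ' → Fin nQ → Fin nQ → Bool         -- δ1 a p q : child state p ↦ q
    δ2    : Σ' → Fin nQ → Fin nQ → Fin nQ → Bool

module _ {Σ' : Set} (𝔄 : TreeAut Σ') where
  open TreeAut 𝔄
  data Run : BTree Σ' → Fin nQ → Set where
    run0 : ∀ {a q} → δ0 a q ≡ true → Run (leaf a) q
    run1 : ∀ {a s p q} → Run s p → δ1 a p q ≡ true → Run (node1 a s) q
    run2 : ∀ {a s t p₀ p₁ q} → Run s p₀ → Run t p₁ → δ2 a p₀ p₁ q ≡ true
         → Run (node2 a s t) q

  Accepts : BTree Σ' → Set
  Accepts t = Σ (Fin nQ) λ q → final q ≡ true × Run t q

-- Tree automatic presentations over a finite relational signature with
-- s relation symbols; symbol r has arity suc (ar r).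

record TAData (s : ℕ) (ar : Fin s → ℕ) : Set where
  field
    k     : ℕ
    autL  : TreeAut (Fin k)
    autEq : TreeAut (Vec (Maybe (Fin k)) 2)
    autR  : (r : Fin s) → TreeAut (Vec (Maybe (Fin k)) (suc (ar r)))

module Pres {s : ℕ} {ar : Fin s → ℕ} (D : TAData s ar) where
  open TAData D

  Tr : Set
  Tr = BTree (Fin k)

  InL : Tr → Set
  InL = Accepts autL

  Eqv : Tr → Tr → Set
  Eqv t u = Accepts autEq (conv (t ∷ u ∷ []))

  Rel : (r : Fin s) → Vec Tr (suc (ar r)) → Set
  Rel r ts = Accepts (autR r) (conv ts)

  record IsCongruence : Set where
    field
      eq-refl  : ∀ t → InL t → Eqv t t
      eq-sym   : ∀ t u → InL t → InL u → Eqv t u → Eqv u t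
      eq-trans : ∀ t u v → InL t → InL u → InL v → Eqv t u → Eqv u v → Eqv t v
      eq-cong  : ∀ r (ts us : Vec Tr (suc (ar r))) → VAll.All InL ts → VAll.All InL us
               → Pointwise Eqv ts us → Rel r ts → Rel r us

  -- the quotient structure (L, (R_r)_r)/≡, as a setoid
  Elem : Set
  Elem = Σ Tr InL

  _≈_ : Elem → Elem → Set
  a ≈ b = Eqv (proj₁ a) (proj₁ b)

  RelE : (r : Fin s) → Vec Elem (suc (ar r)) → Set
  RelE r as = Rel r (Vec.map proj₁ as)

  Adj : Elem → Elem → Set
  Adj a b = ¬ (a ≈ b) × Σ (Fin s) λ r → Σ (Vec Elem (suc (ar r))) λ as →
            RelE r as × Σ (Fin (suc (ar r))) λ i → Σ (Fin (suc (ar r))) λ j →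
            (lookup as i ≈ a) × (lookup as j ≈ b)

  data Within : ℕ → Elem → Elem → Set where
    here : ∀ {n a b} → a ≈ b → Within n a b
    step : ∀ {n a c b} → Adj a c → Within n c b → Within (suc n) a b

  CardLE : (Elem → Set) → ℕ → Set
  CardLE P m = ∀ (xs : List Elem) → AllPairs (λ x y → ¬ (x ≈ y)) xs → All P xs
             → length xs ≤ m

  BoundedDegree : Set
  BoundedDegree = Σ ℕ λ d → ∀ a → CardLE (Adj a) d

  -- g'(n) = max{n, g(n)} ∈ O(n), with g(n) = max_a |S(n,a)|
  LinearGrowth : Set
  LinearGrowth = Σ ℕ λ C → Σ ℕ λ N → ∀ n → N ≤ n →
                 (n ≤ C * n) × (∀ a → CardLE (Within n a) (C * n))

  data Formula (n : ℕ) : Set where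
    rel  : (r : Fin s) → Vec (Fin n) (suc (ar r)) → Formula n
    equ  : Fin n → Fin n → Formula n
    neg  : Formula n → Formula n
    conj : Formula n → Formula n → Formula n
    ex   : Formula (suc n) → Formula n

  extend : {n : ℕ} → Elem → (Fin n → Elem) → Fin (suc n) → Elem
  extend a ρ zero = a
  extend a ρ (suc i) = ρ i

  Sat : {n : ℕ} → Formula n → (Fin n → Elem) → Set
  Sat (rel r xs) ρ = RelE r (Vec.map ρ xs)
  Sat (equ x y) ρ = ρ x ≈ ρ y
  Sat (neg φ) ρ = ¬ Sat φ ρ
  Sat (conj φ ψ) ρ = Sat φ ρ × Sat ψ ρ
  Sat (ex φ) ρ = Σ Elem λ a → Sat φ (extend a ρ)

  -- binary encoding of formulas (prefix-free)
  unary : ℕ → List Bool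
  unary n = List.replicate n true ++ (false ∷ [])

  enc : {n : ℕ} → Formula n → List Bool
  enc (rel r xs) = false ∷ false ∷ false ∷ unary (toℕ r) ++ concatMap (λ x → unary (toℕ x)) (Vec.toList xs)
  enc (equ x y) = false ∷ false ∷ true ∷ unary (toℕ x) ++ unary (toℕ y)
  enc (neg φ) = false ∷ true ∷ false ∷ enc φ
  enc (conj φ ψ) = false ∷ true ∷ true ∷ enc φ ++ enc ψ
  enc (ex φ) = true ∷ false ∷ false ∷ enc φ

  noVar : Fin 0 → Elem
  noVar ()

  FOTh : List Bool → Set
  FOTh w = Σ (Formula 0) λ φ → (enc φ ≡ w) × Sat φ noVar

TAPres : (s : ℕ) → (ar : Fin s → ℕ) → Set
TAPres s ar = Σ (TAData s ar) λ D → Pres.IsCongruence D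

-- Deterministic single-tape Turing machines (two-way infinite tape).
-- Tape symbols Fin (3 + g): 0 = blank, 1 = bit false, 2 = bit true.

data Move : Set where
  left right stay : Move

record TM : Set where
  field
    nQ        : ℕ
    g         : ℕ
    start     : Fin nQ
    halting   : Fin nQ → Bool
    accepting : Fin nQ → Bool
    δ         : Fin nQ → Fin (3 + g) → Fin nQ × Fin (3 + g) × Move

module _ (M : TM) where
  open TM M
  Sym : Set
  Sym = Fin (3 + g)

  record Config : Set where
    constructor cfg
    field
      state : Fin nQ
      lft   : List Sym   -- cells left of the head, nearest first
      hd    : Sym
      rgt   : List Sym   -- cells right of the head, nearest first

  blank : Sym
  blank = zero

  bit : Bool → Sym
  bit false = suc zero
  bit true = suc (suc zero)

  initC : List Bool → Config
  initC [] = cfg start [] blank []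
  initC (b ∷ bs) = cfg start [] (bit b) (List.map bit bs)

  moveC : Fin nQ → List Sym → Sym → List Sym → Move → Config
  moveC q l a r stay = cfg q l a r
  moveC q [] a r left = cfg q [] blank (a ∷ r)
  moveC q (x ∷ l) a r left = cfg q l x (a ∷ r)
  moveC q l a [] right = cfg q (a ∷ l) blank []
  moveC q l a (x ∷ r) right = cfg q (a ∷ l) x r

  stepC : Config → Config
  stepC (cfg q l a r) with halting q
  ... | true = cfg q l a r
  ... | false = let (q' , a' , m) = δ q a in moveC q' l a' r m

  runC : ℕ → Config → Config
  runC zero c = c
  runC (suc t) c = runC t (stepC c)

  HaltsWithin : ℕ → List Bool → Set
  HaltsWithin t x = halting (Config.state (runC t (initC x))) ≡ true

  AcceptsIn : ℕ → List Bool → Set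
  AcceptsIn t x = accepting (Config.state (runC t (initC x))) ≡ true

  readBits : List Sym → List Bool
  readBits [] = []
  readBits (suc zero ∷ xs) = false ∷ readBits xs
  readBits (suc (suc zero) ∷ xs) = true ∷ readBits xs
  readBits (_ ∷ xs) = []

  output : Config → List Bool
  output (cfg q l a r) = readBits (a ∷ r)

In2EXPTIME : (List Bool → Set) → Set
In2EXPTIME L = Σ TM λ M → Σ ℕ λ c → ∀ x →
  let t = 2 ^ (2 ^ ((length x + 2) ^ c)) in
  HaltsWithin M t x × (L x ⇔ AcceptsIn M t x)

PolyTimeComputable : (List Bool → List Bool) → Set
PolyTimeComputable f = Σ TM λ M → Σ ℕ λ c → ∀ x →
  let t = (length x + 2) ^ c in
  HaltsWithin M t x × (output M (runC M t (initC M x)) ≡ f x)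

TwoEXPTIMEHard : (List Bool → Set) → Set₁
TwoEXPTIMEHard K = ∀ (L : List Bool → Set) → In2EXPTIME L →
  Σ (List Bool → List Bool) λ f → PolyTimeComputable f × (∀ x → L x ⇔ K (f x))

{-# OPTIONS --safe #-}
module Submission where

-- A tree is read as a tree of strings, its maximal unary paths, and the only
-- binary relation of the structure relates a tree to the one in which all strings
-- are rotated by one letter, provided that the first letters of neighbouring
-- strings fit together.  Rotation is injective, so there are at most two
-- neighbours, and the balls grow linearly.
--
-- In the space-time diagram of a Turing machine, sheared so that column j of row t
-- is tape cell j - t, the triple of cells ending in (t , j) is determined by the
-- triples at (t , j - 1) and (t - 1 , j).  A claim about one triple thus has a
-- finite binary proof tree, however large, and this tree is an element of the
-- structure.  Its nodes carry t and j as strings of 2 ^ p binary digits, which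
-- agree with those of the children if 2 ^ p rotations are possible; the usual
-- halving trick says so by a formula of length O(p).  They also carry their triple
-- as a string with one marked position, of length K + 1 or K + 2 depending on the
-- parity of the depth.  As these lengths are coprime, any position of a node and
-- any position of its child come to the top at the same time, when the formula can
-- forbid that both are marked.  So the machine enters through the formula only,
-- and the structure is the same for all machines.

open import Defs
open import Data.Nat using (pred; ℕ; zero; suc; _+_; _*_; _^_; _∸_; _≤_; _<_; z≤n; s≤s; s≤s⁻¹; _≤?_; _<?_; NonZero; _≡ᵇ_; ⌊_/2⌋)
open import Data.Nat.Properties
open import Data.Nat.DivMod using (_%_; m%n<n; m<n⇒m%n≡m; [m+kn]%n≡m%n; n%n≡0; %-distribˡ-+; m%n%n≡m%n)
open import Data.Nat.Tactic.RingSolver using (solve-∀)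
open import Data.Fin as Fin using (Fin; zero; suc; toℕ; fromℕ<; combine; remQuot; splitAt; join)
import Data.Fin.Properties as Finₚ
open import Data.Vec as Vec using (Vec; []; _∷_; lookup)
import Data.Vec.Properties as Vecₚ
open import Data.Vec.Relation.Binary.Pointwise.Inductive using (Pointwise; []; _∷_)
open import Data.List as List using (List; []; _∷_; _++_; _ʳ++_; length; concatMap; map)
open import Data.List.Properties using (++-assoc; ++-identityʳ; ++-monoid; ++-ʳ++; ʳ++-defn; ʳ++-ʳ++; length-++; length-map; length-replicate; length-reverse; map-++; map-cong; map-id; map-ʳ++; map-∘)
open import Data.List.Relation.Unary.All as All using (All; []; _∷_)
open import Data.List.Relation.Unary.Any using (here; there)
open import Data.List.Relation.Unary.AllPairs using (AllPairs; []; _∷_)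
open import Data.List.Membership.Propositional using (_∈_)
open import Data.List.Membership.Propositional.Properties using (∈-lookup; ∈-map⁺; ∈-allFin)
open import Data.Maybe as Maybe using (Maybe; just; nothing; fromMaybe)
open import Data.Maybe.Properties using (just-injective)
open import Data.Bool using (T; Bool; true; false; if_then_else_; not; _∧_; _∨_)
open import Data.Bool.Properties using (not-involutive; ∨-identityʳ)
open import Data.Unit using (⊤; tt)
open import Data.Empty using (⊥; ⊥-elim)
open import Data.Product using (Σ; _×_; _,_; proj₁; proj₂; map₁)
open import Data.Sum using (_⊎_; inj₁; inj₂)
open import Relation.Nullary using (¬_; yes; no)
open import Relation.Nullary.Decidable using (⌊_⌋)
open import Relation.Binary.Definitions using (tri<; tri≈; tri>)
open import Relation.Binary.PropositionalEquality using (_≡_; refl; sym; trans; cong; cong₂; subst; subst₂; module ≡-Reasoning)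
open import Function using (_∘_; id; case_of_)
open import Function.Bundles using (mk⇔; Equivalence)

-- Finite types

-- Bounded degree is the obstacle: the relations connect a tree only with rotations of itself, so
-- none can lead from a tree to a subtree or from one node to another. All nodes are therefore
-- compared with their children at once, by automata that see the letters now on top; unary
-- relations cost no degree, so these automata may ask anything. Double exponential time comes out
-- because it equals alternating exponential space: a node holds numbers of exponentially many
-- digits, and both its children have to be justified, as after a universal choice. Unsheared, a
-- cell would depend on three cells of the previous row, among them its right neighbour. The shear
-- turns these into the triple of the cell directly below, and two children suffice. Common
-- subproofs are repeated in the tree, not shared. Its size is no concern, as elements are arbitrary
-- finite trees; only the coordinates have to fit into their digits. The diagram is deterministic,
-- so whatever has a proof tree is true, and one existential quantifier over trees decides
-- acceptance in both directions.

record Finite (A : Set) : Set where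
  field
    size    : ℕ
    enc     : A → Fin size
    dec     : Fin size → A
    dec-enc : ∀ a → dec (enc a) ≡ a

open Finite {{...}}

-- The numbering is only asked to have a left inverse, so codes may be wasted. This is enough to
-- decide equality by comparing codes.
enc-injective : ∀ {A : Set} {{_ : Finite A}} {a b : A} → enc a ≡ enc b → a ≡ b
enc-injective {a = a} {b} e = trans (sym (dec-enc a)) (trans (cong dec e) (dec-enc b))

infix 4 _==_

_==_ : ∀ {A : Set} {{_ : Finite A}} → A → A → Bool
a == b = ⌊ enc a Fin.≟ enc b ⌋

==-sound : ∀ {A : Set} {{_ : Finite A}} (a b : A) → (a == b) ≡ true → a ≡ b
==-sound a b e with enc a Fin.≟ enc b
... | yes p = enc-injective p

==-refl : ∀ {A : Set} {{_ : Finite A}} (a : A) → (a == a) ≡ true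
==-refl a with enc a Fin.≟ enc a
... | yes _ = refl
... | no ¬p = ⊥-elim (¬p refl)

==-complete : ∀ {A : Set} {{_ : Finite A}} {a b : A} → a ≡ b → (a == b) ≡ true
==-complete {a = a} refl = ==-refl a

retract : ∀ {A B : Set} {{_ : Finite B}} (f : A → B) (g : B → A) → (∀ a → g (f a) ≡ a) → Finite A
retract f g gf = record
  { size = size ; enc = enc ∘ f ; dec = g ∘ dec
  ; dec-enc = λ a → trans (cong g (dec-enc (f a))) (gf a) }

abstract
  instance
    finite-Fin : ∀ {n} → Finite (Fin n)
    finite-Fin {n} = record { size = n ; enc = id ; dec = id ; dec-enc = λ _ → refl }

    finite-⊤ : Finite ⊤
    finite-⊤ = record { size = 1 ; enc = λ _ → zero ; dec = λ _ → tt ; dec-enc = λ _ → refl }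

    finite-⊎ : ∀ {A B : Set} {{_ : Finite A}} {{_ : Finite B}} → Finite (A ⊎ B)
    finite-⊎ {A} {B} {{FA}} {{FB}} = record
      { size = Finite.size FA + Finite.size FB
      ; enc = λ { (inj₁ a) → join _ _ (inj₁ (enc a)) ; (inj₂ b) → join _ _ (inj₂ (enc b)) }
      ; dec = λ i → decode (splitAt _ i)
      ; dec-enc = λ
          { (inj₁ a) → trans (cong decode (Finₚ.splitAt-join (Finite.size FA) (Finite.size FB) (inj₁ (enc a)))) (cong inj₁ (dec-enc a))
          ; (inj₂ b) → trans (cong decode (Finₚ.splitAt-join (Finite.size FA) (Finite.size FB) (inj₂ (enc b)))) (cong inj₂ (dec-enc b)) } }
      where
      decode : Fin (Finite.size FA) ⊎ Fin (Finite.size FB) → A ⊎ B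
      decode (inj₁ i) = inj₁ (dec i)
      decode (inj₂ i) = inj₂ (dec i)

    finite-× : ∀ {A B : Set} {{_ : Finite A}} {{_ : Finite B}} → Finite (A × B)
    finite-× {A} {B} {{FA}} {{FB}} = record
      { size = Finite.size FA * Finite.size FB
      ; enc = λ { (a , b) → combine (enc a) (enc b) }
      ; dec = λ i → decode (remQuot (Finite.size FB) i)
      ; dec-enc = λ { (a , b) → trans (cong decode (Finₚ.remQuot-combine (enc a) (enc b)))
                                      (cong₂ _,_ (dec-enc a) (dec-enc b)) } }
      where
      decode : Fin (Finite.size FA) × Fin (Finite.size FB) → A × B
      decode (i , j) = dec i , dec j

    finite-Bool : Finite Bool
    finite-Bool = retract {B = ⊤ ⊎ ⊤} (λ { true → inj₁ tt ; false → inj₂ tt })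
      (λ { (inj₁ _) → true ; (inj₂ _) → false }) (λ { true → refl ; false → refl })

    finite-Maybe : ∀ {A : Set} {{_ : Finite A}} → Finite (Maybe A)
    finite-Maybe {A} = retract {B = ⊤ ⊎ A} (λ { nothing → inj₁ tt ; (just a) → inj₂ a })
      (λ { (inj₁ _) → nothing ; (inj₂ a) → just a }) (λ { nothing → refl ; (just a) → refl })

    finite-Vec : ∀ {A : Set} {{F : Finite A}} {n : ℕ} → Finite (Vec A n)
    finite-Vec {n = zero} = retract {B = ⊤} (λ _ → tt) (λ _ → []) (λ { [] → refl })
    finite-Vec {A} {{F}} {n = suc n} = retract {B = A × Vec A n} {{finite-× {{F}} {{finite-Vec}}}}
      (λ { (a ∷ v) → a , v }) (λ { (a , v) → a ∷ v }) (λ { (a ∷ v) → refl })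

∧-true : ∀ {a b} → (a ∧ b) ≡ true → a ≡ true × b ≡ true
∧-true {true} {true} _ = refl , refl

∧-intro : ∀ {a b} → a ≡ true → b ≡ true → (a ∧ b) ≡ true
∧-intro refl refl = refl

-- Deterministic bottom-up automata

record Alg (X Q : Set) : Set where
  field
    a0 : X → Q
    a1 : X → Q → Q
    a2 : X → Q → Q → Q

open Alg

fold : ∀ {X Q : Set} → Alg X Q → BTree X → Q
fold α (leaf x) = a0 α x
fold α (node1 x s) = a1 α x (fold α s)
fold α (node2 x s t) = a2 α x (fold α s) (fold α t)

comap : ∀ {X Y Q : Set} → (Y → X) → Alg X Q → Alg Y Q
comap f α = record { a0 = a0 α ∘ f ; a1 = a1 α ∘ f ; a2 = a2 α ∘ f }

fold-comap : ∀ {X Y Q : Set} (f : Y → X) (α : Alg X Q) t → fold (comap f α) t ≡ fold α (mapT f t)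
fold-comap f α (leaf x) = refl
fold-comap f α (node1 x s) = cong (a1 α (f x)) (fold-comap f α s)
fold-comap f α (node2 x s t) = cong₂ (a2 α (f x)) (fold-comap f α s) (fold-comap f α t)

mapT-∘ : ∀ {X Y Z : Set} (g : Y → Z) (f : X → Y) t → mapT g (mapT f t) ≡ mapT (g ∘ f) t
mapT-∘ g f (leaf x) = refl
mapT-∘ g f (node1 x s) = cong (node1 (g (f x))) (mapT-∘ g f s)
mapT-∘ g f (node2 x s t) = cong₂ (node2 (g (f x))) (mapT-∘ g f s) (mapT-∘ g f t)

mapT-id : ∀ {X : Set} (f : X → X) → (∀ x → f x ≡ x) → ∀ t → mapT f t ≡ t
mapT-id f h (leaf x) = cong leaf (h x)
mapT-id f h (node1 x s) = cong₂ node1 (h x) (mapT-id f h s)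
mapT-id f h (node2 x s t) rewrite h x = cong₂ (node2 x) (mapT-id f h s) (mapT-id f h t)

module _ {X Q : Set} {{F : Finite Q}} (α : Alg X Q) (fin : Q → Bool) where

  private
    eqS : Fin (Finite.size F) → Fin (Finite.size F) → Bool
    eqS p q = p == q

    eqS-complete : ∀ {p q} → p ≡ q → eqS p q ≡ true
    eqS-complete {p} refl = ==-refl p

  toAut : TreeAut X
  toAut = record
    { nQ = Finite.size F
    ; final = fin ∘ dec
    ; δ0 = λ x q → eqS (enc (a0 α x)) q
    ; δ1 = λ x p q → eqS (enc (a1 α x (dec p))) q
    ; δ2 = λ x p p' q → eqS (enc (a2 α x (dec p) (dec p'))) q }

  -- Every transition compares its target with the code of the value that the algebra prescribes, so
  -- a run has no choice, and codes outside the image of `enc` never occur in one.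
  run-state : ∀ {t q} → Run toAut t q → Finite.dec F q ≡ fold α t
  run-state {q = q} (run0 e) = trans (cong dec (sym (==-sound _ q e))) (dec-enc _)
  run-state {q = q} (run1 {a = a} r e) =
    trans (cong dec (sym (==-sound _ q e))) (trans (dec-enc _) (cong (a1 α a) (run-state r)))
  run-state {q = q} (run2 {a = a} r r' e) =
    trans (cong dec (sym (==-sound _ q e))) (trans (dec-enc _) (cong₂ (a2 α a) (run-state r) (run-state r')))

  fold-run : ∀ t → Run toAut t (Finite.enc F (fold α t))
  fold-run (leaf x) = run0 (eqS-complete refl)
  fold-run (node1 x s) = run1 (fold-run s) (eqS-complete (cong (enc ∘ a1 α x) (dec-enc _)))
  fold-run (node2 x s t) = run2 (fold-run s) (fold-run t)
    (eqS-complete (cong enc (cong₂ (a2 α x) (dec-enc _) (dec-enc _))))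

  accepts⇒ : ∀ {t} → Accepts toAut t → fin (fold α t) ≡ true
  accepts⇒ (q , f , r) = trans (cong fin (sym (run-state r))) f

  accepts⇐ : ∀ {t} → fin (fold α t) ≡ true → Accepts toAut t
  accepts⇐ {t} f = enc (fold α t) , trans (cong fin (dec-enc _)) f , fold-run t

-- Equality and rotation both preserve the shape of a tree, so a padding symbol always means
-- rejection. Such an algebra sees only labels present on both sides, and `nothing` is its dead
-- state.
record PairAlg (A Q : Set) : Set where
  field
    p0 : A → A → Maybe Q
    p1 : A → A → Q → Maybe Q
    p2 : A → A → Q → Q → Maybe Q

open PairAlg

module _ {A Q : Set} (π : PairAlg A Q) where

  pfold : BTree A → BTree A → Maybe Q
  pfold (leaf a) (leaf b) = p0 π a b
  pfold (node1 a s) (node1 b s') = pfold s s' Maybe.>>= p1 π a b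
  pfold (node2 a s t) (node2 b s' t') =
    pfold s s' Maybe.>>= λ q → pfold t t' Maybe.>>= p2 π a b q
  pfold _ _ = nothing

  pairAlg : Alg (Vec (Maybe A) 2) (Maybe Q)
  pairAlg = record { a0 = f0 ; a1 = f1 ; a2 = f2 }
    where
    f0 : Vec (Maybe A) 2 → Maybe Q
    f0 (just a ∷ just b ∷ []) = p0 π a b
    f0 _ = nothing
    f1 : Vec (Maybe A) 2 → Maybe Q → Maybe Q
    f1 (just a ∷ just b ∷ []) (just q) = p1 π a b q
    f1 _ _ = nothing
    f2 : Vec (Maybe A) 2 → Maybe Q → Maybe Q → Maybe Q
    f2 (just a ∷ just b ∷ []) (just q) (just q') = p2 π a b q q'
    f2 _ _ _ = nothing

  private
    pairLabel : Maybe A × Maybe (Vec (Maybe A) 1) → Vec (Maybe A) 2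
    pairLabel p = proj₁ p ∷ fromMaybe (nothing ∷ []) (proj₂ p)

    onlyL : ∀ t → fold pairAlg (mapT pairLabel (mapT (λ a → just a , nothing) t)) ≡ nothing
    onlyL (leaf _) = refl
    onlyL (node1 _ _) = refl
    onlyL (node2 _ _ _) = refl

    onlyR : ∀ t → fold pairAlg (mapT pairLabel (mapT (λ b → nothing , just b) t)) ≡ nothing
    onlyR (leaf _) = refl
    onlyR (node1 _ _) = refl
    onlyR (node2 _ _ _) = refl

    bothDead : ∀ a b (q q' : Maybe Q) → q' ≡ nothing →
      a2 pairAlg (just a ∷ just b ∷ []) q q' ≡ nothing
    bothDead a b (just _) nothing _ = refl
    bothDead a b nothing nothing _ = refl

    sing : A → Vec (Maybe A) 1
    sing a = just a ∷ []

    -- The left side is what `conv` computes to on two trees. Where their shapes differ, some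
    -- subtree of the convolution is padded throughout, and its dead state spreads up to the root.
    fold-conv2 : ∀ t u → fold pairAlg (mapT pairLabel (conv2 t (mapT sing u))) ≡ pfold t u
    fold-conv2 (leaf a) (leaf b) = refl
    fold-conv2 (leaf a) (node1 b t) rewrite onlyR (mapT sing t) = refl
    fold-conv2 (leaf a) (node2 b t u) rewrite onlyR (mapT sing t) = refl
    fold-conv2 (node1 a s) (leaf b) rewrite onlyL s = refl
    fold-conv2 (node1 a s) (node1 b t) rewrite fold-conv2 s t with pfold s t
    ... | just _ = refl
    ... | nothing = refl
    fold-conv2 (node1 a s) (node2 b t u) = bothDead a b (fold pairAlg (mapT pairLabel (conv2 s (mapT sing t)))) _ (onlyR (mapT sing u))
    fold-conv2 (node2 a s v) (leaf b) rewrite onlyL s = refl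
    fold-conv2 (node2 a s v) (node1 b t) = bothDead a b (fold pairAlg (mapT pairLabel (conv2 s (mapT sing t)))) _ (onlyL v)
    fold-conv2 (node2 a s v) (node2 b t u) rewrite fold-conv2 s t | fold-conv2 v u with pfold s t | pfold v u
    ... | just _ | just _ = refl
    ... | just _ | nothing = refl
    ... | nothing | just _ = refl
    ... | nothing | nothing = refl

  fold-conv : ∀ t u → fold pairAlg (conv (t ∷ u ∷ [])) ≡ pfold t u
  fold-conv = fold-conv2

>>=-just : ∀ {X Y : Set} (m : Maybe X) {f : X → Maybe Y} {y} → (m Maybe.>>= f) ≡ just y →
  Σ X λ x → m ≡ just x × f x ≡ just y
>>=-just (just x) e = x , refl , e

if-just : ∀ {X : Set} (b : Bool) {x y : X} → (if b then just x else nothing) ≡ just y → b ≡ true × x ≡ y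
if-just true refl = refl , refl

eqAlg : ∀ {A : Set} {{_ : Finite A}} → PairAlg A ⊤
eqAlg = record
  { p0 = λ a b → if a == b then just tt else nothing
  ; p1 = λ a b _ → if a == b then just tt else nothing
  ; p2 = λ a b _ _ → if a == b then just tt else nothing }

eqAlg-sound : ∀ {A : Set} {{_ : Finite A}} (t u : BTree A) {q} → pfold eqAlg t u ≡ just q → t ≡ u
eqAlg-sound (leaf a) (leaf b) e = cong leaf (==-sound a b (proj₁ (if-just (a == b) e)))
eqAlg-sound (node1 a s) (node1 b t) e with >>=-just (pfold eqAlg s t) e
... | _ , e' , e'' = cong₂ node1 (==-sound a b (proj₁ (if-just (a == b) e''))) (eqAlg-sound s t e')
eqAlg-sound (node2 a s v) (node2 b t u) e with >>=-just (pfold eqAlg s t) e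
... | _ , e₁ , e₂ with >>=-just (pfold eqAlg v u) e₂
... | _ , e₃ , e₄ with ==-sound a b (proj₁ (if-just (a == b) e₄))
... | refl = cong₂ (node2 a) (eqAlg-sound s t e₁) (eqAlg-sound v u e₃)

eqAlg-refl : ∀ {A : Set} {{_ : Finite A}} (t : BTree A) → pfold eqAlg t t ≡ just tt
eqAlg-refl (leaf a) rewrite ==-refl a = refl
eqAlg-refl (node1 a s) rewrite eqAlg-refl s | ==-refl a = refl
eqAlg-refl (node2 a s t) rewrite eqAlg-refl s | eqAlg-refl t | ==-refl a = refl

-- Rotation of a tree of strings: each maximal path of unary nodes, closed off
-- by a leaf or a binary node, is read as a string.

top : ∀ {A : Set} → BTree A → A
top (leaf a) = a
top (node1 a _) = a
top (node2 a _ _) = a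

-- Drops the first letter of the root string, appends f to it, and rotates the
-- strings below.
shift : ∀ {A : Set} → A → BTree A → BTree A
shift f (leaf a) = leaf f
shift f (node1 a s) = node1 (top s) (shift f s)
shift f (node2 a s t) = node2 f (shift (top s) s) (shift (top t) t)

rot : ∀ {A : Set} → BTree A → BTree A
rot t = shift (top t) t

top-mapT : ∀ {A B : Set} (g : A → B) t → top (mapT g t) ≡ g (top t)
top-mapT g (leaf a) = refl
top-mapT g (node1 a _) = refl
top-mapT g (node2 a _ _) = refl

shift-mapT : ∀ {A B : Set} (g : A → B) f t → shift (g f) (mapT g t) ≡ mapT g (shift f t)
shift-mapT g f (leaf a) = refl
shift-mapT g f (node1 a s) = cong₂ node1 (top-mapT g s) (shift-mapT g f s)
shift-mapT g f (node2 a s t) rewrite top-mapT g s | top-mapT g t =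
  cong₂ (node2 (g f)) (shift-mapT g (top s) s) (shift-mapT g (top t) t)

rot-mapT : ∀ {A B : Set} (g : A → B) t → rot (mapT g t) ≡ mapT g (rot t)
rot-mapT g t rewrite top-mapT g t = shift-mapT g (top t) t

node1-inj : ∀ {A : Set} {a b : A} {s t} → node1 a s ≡ node1 b t → a ≡ b × s ≡ t
node1-inj refl = refl , refl

node2-inj : ∀ {A : Set} {a b : A} {s t s' t'} → node2 a s s' ≡ node2 b t t' → a ≡ b × s ≡ t × s' ≡ t'
node2-inj refl = refl , refl , refl

-- Only the top letter of the argument is lost. The strings further down are rotated with their own
-- top letter, which the recursion recovers as the letter appended to them.
shift-injective : ∀ {A : Set} {f f' : A} t t' → shift f t ≡ shift f' t' →
  f ≡ f' × (top t ≡ top t' → t ≡ t')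
shift-injective (leaf a) (leaf a') refl = refl , cong leaf
shift-injective (node1 a s) (node1 a' s') e with node1-inj e
... | e₁ , e₂ with shift-injective s s' e₂
... | e₃ , h = e₃ , λ e₄ → cong₂ node1 e₄ (h e₁)
shift-injective (node2 a s t) (node2 a' s' t') e with node2-inj e
... | e₁ , e₂ , e₃ with shift-injective s s' e₂ | shift-injective t t' e₃
... | e₄ , h | e₅ , h' with h e₄ | h' e₅
... | refl | refl = e₁ , λ { refl → refl }

rot-injective : ∀ {A : Set} (t t' : BTree A) → rot t ≡ rot t' → t ≡ t'
rot-injective t t' e with shift-injective t t' e
... | e₁ , h = h e₁

-- The state of a pair (t , u) is (top t , f) when u ≡ shift f t; it is paired
-- with the run of a further automaton on the first component.
module _ {A Q : Set} {{_ : Finite A}} (γ : Alg A Q) where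

  rotAlg : PairAlg A (A × A × Q)
  rotAlg = record
    { p0 = λ a b → just (a , b , a0 γ a)
    ; p1 = λ { a b (a' , f , q) → if b == a' then just (a , f , a1 γ a q) else nothing }
    ; p2 = λ { a b (a₁ , f₁ , q₁) (a₂ , f₂ , q₂) →
        if (f₁ == a₁) ∧ (f₂ == a₂) then just (a , b , a2 γ a q₁ q₂) else nothing } }

  rotAlg-sound : ∀ t u {a f q} → pfold rotAlg t u ≡ just (a , f , q) →
    a ≡ top t × u ≡ shift f t × q ≡ fold γ t
  rotAlg-sound (leaf a) (leaf b) refl = refl , refl , refl
  rotAlg-sound (node1 a s) (node1 b u) e with >>=-just (pfold rotAlg s u) e
  ... | (a' , f , q) , e₁ , e₂ with if-just (b == a') e₂ | rotAlg-sound s u e₁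
  ... | b≡ , refl | refl , refl , refl = refl , cong (λ x → node1 x (shift f s)) (==-sound _ _ b≡) , refl
  rotAlg-sound (node2 a s t) (node2 b u v) e with >>=-just (pfold rotAlg s u) e
  ... | (a₁ , f₁ , q₁) , e₁ , e₂ with >>=-just (pfold rotAlg t v) e₂
  ... | (a₂ , f₂ , q₂) , e₃ , e₄ with if-just ((f₁ == a₁) ∧ (f₂ == a₂)) e₄ | rotAlg-sound s u e₁ | rotAlg-sound t v e₃
  ... | b≡ , refl | refl , refl , refl | refl , refl , refl with ∧-true b≡
  ... | x , y = refl , cong₂ (λ c d → node2 b (shift c s) (shift d t)) (==-sound _ _ x) (==-sound _ _ y) , refl

  rotAlg-complete : ∀ t f → pfold rotAlg t (shift f t) ≡ just (top t , f , fold γ t)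
  rotAlg-complete (leaf a) f = refl
  rotAlg-complete (node1 a s) f rewrite rotAlg-complete s f | ==-refl (top s) = refl
  rotAlg-complete (node2 a s t) f
    rewrite rotAlg-complete s (top s) | rotAlg-complete t (top t) | ==-refl (top s) | ==-refl (top t) = refl

-- Proof trees and their encoding

Sy : Set
Sy = Maybe Bool

record ALab : Set where
  constructor alab
  field
    afirst mark : Bool

-- A digit of the counters t and j and of their predecessors (least significant
-- digit first), a letter of the shifted input, and the letter following it.
record DLab : Set where
  constructor dlab
  field
    dfirst tb tp jb jp : Bool
    vs vn : Sy

open ALab
open DLab

data Lab : Set where
  hd : Bool → Sy → Lab
  al : ALab → Lab
  dl : DLab → Lab
  dm : Lab

abstract
  instance
    finite-ALab : Finite ALab
    finite-ALab = retract {B = Bool × Bool} (λ a → afirst a , mark a) (λ { (f , m) → alab f m }) (λ _ → refl)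

    finite-DLab : Finite DLab
    finite-DLab = retract {B = (Bool × Bool × Bool) × (Bool × Bool) × Sy × Sy}
      (λ d → (dfirst d , tb d , tp d) , (jb d , jp d) , vs d , vn d)
      (λ { ((f , t , t') , (j , j') , v , v') → dlab f t t' j j' v v' }) (λ _ → refl)

    finite-Lab : Finite Lab
    finite-Lab = retract {B = (Bool × Sy) ⊎ ALab ⊎ DLab ⊎ ⊤}
      (λ { (hd p a) → inj₁ (p , a) ; (al a) → inj₂ (inj₁ a) ; (dl d) → inj₂ (inj₂ (inj₁ d))
         ; dm → inj₂ (inj₂ (inj₂ tt)) })
      (λ { (inj₁ (p , a)) → hd p a ; (inj₂ (inj₁ a)) → al a ; (inj₂ (inj₂ (inj₁ d))) → dl d
         ; (inj₂ (inj₂ (inj₂ _))) → dm })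
      (λ { (hd p a) → refl ; (al a) → refl ; (dl d) → refl ; dm → refl })

infixr 5 _⟫_

data Str (A : Set) : Set where
  one : A → Str A
  _⟫_ : A → Str A → Str A

headS : ∀ {A : Set} → Str A → A
headS (one a) = a
headS (a ⟫ _) = a

-- node p a A D l b claims a tile, marked in A, for the cell whose coordinates t
-- and j are spelled out by D; p is the parity of its depth and a is the input
-- letter at j if t = 0.  The children l and b are the cells (t , j - 1) and
-- (t - 1 , j), with nil for those outside the quadrant.
data PT : Set where
  nil  : PT
  node : Bool → Sy → Str ALab → Str DLab → PT → PT → PT

chain : ∀ {A : Set} → (Lab → BTree Lab) → (A → Lab) → Str A → BTree Lab
chain e g (one a) = e (g a)
chain e g (a ⟫ s) = node1 (g a) (chain e g s)

-- The tile string is closed off by a leaf, the digit string by the binary node that carries the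
-- children, so `rot` turns each of them in itself. The letters `hd` and `dm` are strings of length
-- one and hence stay fixed.
embed : PT → BTree Lab
embed nil = leaf dm
embed (node p a A D l b) =
  node2 (hd p a) (chain leaf al A) (chain (λ x → node2 x (embed l) (embed b)) dl D)

shiftS : ∀ {A : Set} → A → Str A → Str A
shiftS f (one a) = one f
shiftS f (a ⟫ s) = headS s ⟫ shiftS f s

rotS : ∀ {A : Set} → Str A → Str A
rotS s = shiftS (headS s) s

rotP : PT → PT
rotP nil = nil
rotP (node p a A D l b) = node p a (rotS A) (rotS D) (rotP l) (rotP b)

module _ {A : Set} (g : A → Lab) (e e' : Lab → BTree Lab)
  (e-top : ∀ x → top (e x) ≡ x) (e-shift : ∀ f x → shift f (e x) ≡ e' f) where

  top-chain : ∀ s → top (chain e g s) ≡ g (headS s)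
  top-chain (one a) = e-top (g a)
  top-chain (a ⟫ s) = refl

  shift-chain : ∀ f s → shift (g f) (chain e g s) ≡ chain e' g (shiftS f s)
  shift-chain f (one a) = e-shift (g f) (g a)
  shift-chain f (a ⟫ s) = cong₂ node1 (top-chain s) (shift-chain f s)

  rot-chain : ∀ s → rot (chain e g s) ≡ chain e' g (rotS s)
  rot-chain s = trans (cong (λ x → shift x (chain e g s)) (top-chain s)) (shift-chain (headS s) s)

rot-embed : ∀ P → rot (embed P) ≡ embed (rotP P)
rot-embed nil = refl
rot-embed (node p a A D l b) = cong₂ (node2 (hd p a))
  (rot-chain al leaf leaf (λ _ → refl) (λ _ _ → refl) A)
  (rot-chain dl _ _ (λ _ → refl) (λ f x → cong₂ (node2 f) (rot-embed l) (rot-embed b)) D)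

-- The common form of all automata on proof trees: each string is summarised by a fold, and a node
-- is judged by its own summaries and those of its two children, with `nothing` for a missing child.
record Check (QA QD : Set) : Set where
  field
    bA  : ALab → QA
    sA  : ALab → QA → QA
    bD  : DLab → QD
    sD  : DLab → QD → QD
    ok  : Bool → Sy → QA → QD → Maybe (Bool × QA × QD) → Maybe (Bool × QA × QD) → Bool

open Check

strFold : ∀ {A Q : Set} → (A → Q) → (A → Q → Q) → Str A → Q
strFold b s (one a) = b a
strFold b s (a ⟫ as) = s a (strFold b s as)

module _ {QA QD : Set} (κ : Check QA QD) where

  View : Set
  View = Maybe (Bool × QA × QD)

  view : PT → View
  view nil = nothing
  view (node p a A D l b) = just (p , strFold (bA κ) (sA κ) A , strFold (bD κ) (sD κ) D)

  AllN : PT → Set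
  AllN nil = ⊤
  AllN (node p a A D l b) =
    ok κ p a (strFold (bA κ) (sA κ) A) (strFold (bD κ) (sD κ) D) (view l) (view b) ≡ true × AllN l × AllN b

  CState : Set
  CState = Maybe (QA ⊎ ((QD × View × View) ⊎ View))

  pattern stA q = just (inj₁ q)
  pattern stD q l b = just (inj₂ (inj₁ (q , l , b)))
  pattern stN v = just (inj₂ (inj₂ v))

  private
    f0 : Lab → CState
    f0 (al a) = stA (bA κ a)
    f0 dm = stN nothing
    f0 _ = nothing

    f1 : Lab → CState → CState
    f1 (al a) (stA q) = stA (sA κ a q)
    f1 (dl d) (stD q l b) = stD (sD κ d q) l b
    f1 _ _ = nothing

    f2 : Lab → CState → CState → CState
    f2 (hd p a) (stA q) (stD q' l b) = if ok κ p a q q' l b then stN (just (p , q , q')) else nothing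
    f2 (dl d) (stN l) (stN b) = stD (bD κ d) l b
    f2 _ _ _ = nothing

  checkAlg : Alg Lab CState
  checkAlg = record { a0 = f0 ; a1 = f1 ; a2 = f2 }

  private
    fold-A : ∀ A → fold checkAlg (chain leaf al A) ≡ stA (strFold (bA κ) (sA κ) A)
    fold-A (one a) = refl
    fold-A (a ⟫ s) rewrite fold-A s = refl

    fold-D : ∀ D t u {l b} → fold checkAlg t ≡ stN l → fold checkAlg u ≡ stN b →
      fold checkAlg (chain (λ x → node2 x t u) dl D) ≡ stD (strFold (bD κ) (sD κ) D) l b
    fold-D (one d) t u e e' rewrite e | e' = refl
    fold-D (d ⟫ s) t u e e' rewrite fold-D s t u e e' = refl

  fold-embed : ∀ P → AllN P → fold checkAlg (embed P) ≡ stN (view P)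
  fold-embed nil _ = refl
  fold-embed (node p a A D l b) (o , cl , cb)
    rewrite fold-A A | fold-D D (embed l) (embed b) (fold-embed l cl) (fold-embed b cb) | o = refl

  private
    Parsed : BTree Lab → CState → Set
    Parsed t nothing = ⊤
    Parsed t (stA q) = Σ (Str ALab) λ A → t ≡ chain leaf al A × strFold (bA κ) (sA κ) A ≡ q
    Parsed t (stD q l b) = Σ (Str DLab) λ D → Σ PT λ P → Σ PT λ P' →
      t ≡ chain (λ x → node2 x (embed P) (embed P')) dl D × strFold (bD κ) (sD κ) D ≡ q ×
      (AllN P × view P ≡ l) × (AllN P' × view P' ≡ b)
    Parsed t (stN v) = Σ PT λ P → t ≡ embed P × AllN P × view P ≡ v

    parse : ∀ t → Parsed t (fold checkAlg t)
    parse (leaf (hd _ _)) = tt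
    parse (leaf (al a)) = one a , refl , refl
    parse (leaf (dl _)) = tt
    parse (leaf dm) = nil , refl , tt , refl
    parse (node1 (hd _ _) s) = tt
    parse (node1 (al a) s) with fold checkAlg s | parse s
    ... | nothing | _ = tt
    ... | stA q | s' , refl , refl = a ⟫ s' , refl , refl
    ... | stD _ _ _ | _ = tt
    ... | stN _ | _ = tt
    parse (node1 (dl d) s) with fold checkAlg s | parse s
    ... | nothing | _ = tt
    ... | stA q | _ = tt
    ... | stD _ _ _ | s' , P , P' , refl , refl , h = d ⟫ s' , P , P' , refl , refl , h
    ... | stN _ | _ = tt
    parse (node1 dm s) = tt
    parse (node2 (hd p a) s t) with fold checkAlg s | parse s | fold checkAlg t | parse t
    ... | nothing | _ | _ | _ = tt
    ... | stD _ _ _ | _ | _ | _ = tt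
    ... | stN _ | _ | _ | _ = tt
    ... | stA q | _ | nothing | _ = tt
    ... | stA q | _ | stA _ | _ = tt
    ... | stA q | _ | stN _ | _ = tt
    ... | stA q | A , refl , refl | stD q' l b | D , P , P' , refl , refl , (c , refl) , (c' , refl)
      with ok κ p a q q' l b in e
    ... | true = node p a A D P P' , refl , (e , c , c') , refl
    ... | false = tt
    parse (node2 (al a) s t) = tt
    parse (node2 (dl d) s t) with fold checkAlg s | parse s | fold checkAlg t | parse t
    ... | nothing | _ | _ | _ = tt
    ... | stA _ | _ | _ | _ = tt
    ... | stD _ _ _ | _ | _ | _ = tt
    ... | stN l | _ | nothing | _ = tt
    ... | stN l | _ | stA _ | _ = tt
    ... | stN l | _ | stD _ _ _ | _ = tt
    ... | stN l | P , refl , h | stN b | P' , refl , h' = one d , P , P' , refl , refl , h , h'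
    parse (node2 dm s t) = tt

  -- The kinds of live state are the syntactic categories (tile string, digit string with children,
  -- proof tree), so the automaton parses while it checks, and ill-formed trees die.
  fold-parse : ∀ t {v} → fold checkAlg t ≡ stN v → Σ PT λ P → t ≡ embed P × AllN P × view P ≡ v
  fold-parse t e = subst (Parsed t) e (parse t)

  acc : (View → Bool) → CState → Bool
  acc fin (stN v) = fin v
  acc fin _ = false

  Accept : (View → Bool) → BTree Lab → Set
  Accept fin t = acc fin (fold checkAlg t) ≡ true

  accept-embed : ∀ fin P → AllN P → fin (view P) ≡ true → Accept fin (embed P)
  accept-embed fin P c f rewrite fold-embed P c = f

  accept-parse : ∀ fin t → Accept fin t → Σ PT λ P → t ≡ embed P × AllN P × fin (view P) ≡ true
  accept-parse fin t e with fold checkAlg t in eq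
  ... | stN v with fold-parse t eq
  ... | P , e₁ , c , refl = P , e₁ , c , e

private

  al-inj : ∀ {a b} → al a ≡ al b → a ≡ b
  al-inj refl = refl

  dl-inj : ∀ {a b} → dl a ≡ dl b → a ≡ b
  dl-inj refl = refl

chainA-injective : ∀ A A' → chain leaf al A ≡ chain leaf al A' → A ≡ A'
chainA-injective (one a) (one a') refl = refl
chainA-injective (a ⟫ s) (a' ⟫ s') e with node1-inj e
... | e₁ , e₂ with al-inj e₁ | chainA-injective s s' e₂
... | refl | refl = refl

chainD-injective : ∀ {s t s' t'} D D' →
  chain (λ x → node2 x s t) dl D ≡ chain (λ x → node2 x s' t') dl D' → D ≡ D' × s ≡ s' × t ≡ t'
chainD-injective (one d) (one d') e with node2-inj e
... | refl , e₂ , e₃ = refl , e₂ , e₃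
chainD-injective (d ⟫ D) (d' ⟫ D') e with node1-inj e
... | e₁ , e₂ with dl-inj e₁ | chainD-injective D D' e₂
... | refl | refl , e₃ , e₄ = refl , e₃ , e₄

-- Every test that is passed yields some parsed tree. Injectivity makes the tests at all rotations
-- statements about one and the same proof tree.
embed-injective : ∀ P P' → embed P ≡ embed P' → P ≡ P'
embed-injective nil nil _ = refl
embed-injective (node p a A D l b) (node p' a' A' D' l' b') e with node2-inj e
... | refl , e₂ , e₃ with chainA-injective A A' e₂ | chainD-injective D D' e₃
... | refl | refl , e₄ , e₅ with embed-injective l l' e₄ | embed-injective b b' e₅
... | refl | refl = refl

-- The structure

isNode : ∀ {A : Set} → Maybe A → Bool
isNode (just _) = true
isNode nothing = false

-- Conditions on the letters now on top, at all nodes at once. `endd`: the counters show their first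
-- digit; `lab`: a node without children shows this input letter; `fa`: whether the nodes of one
-- parity show the first letter of their tile string; `forb`: the tile on top is forbidden for one
-- kind of node; `fH`, `fV`: a node and its left or lower child are not both marked; `froot`: the
-- root is not marked.
data HTest : Set where
  endd froot : HTest
  lab  : Sy → HTest
  fa   : Bool → Bool → HTest
  forb : Bool → Bool → Sy → Bool → HTest
  fH fV : Bool → HTest

abstract
  instance
    finite-HTest : Finite HTest
    finite-HTest = retract {B = Code} f g gf
      where
      Code : Set
      Code = Bool ⊎ Sy ⊎ (Bool × Bool) ⊎ (Bool × Bool × Sy × Bool) ⊎ Bool ⊎ Bool
      f : HTest → Code
      f endd = inj₁ true
      f froot = inj₁ false
      f (lab a) = inj₂ (inj₁ a)
      f (fa p x) = inj₂ (inj₂ (inj₁ (p , x)))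
      f (forb l b a p) = inj₂ (inj₂ (inj₂ (inj₁ (l , b , a , p))))
      f (fH p) = inj₂ (inj₂ (inj₂ (inj₂ (inj₁ p))))
      f (fV p) = inj₂ (inj₂ (inj₂ (inj₂ (inj₂ p))))
      g : Code → HTest
      g (inj₁ true) = endd
      g (inj₁ false) = froot
      g (inj₂ (inj₁ a)) = lab a
      g (inj₂ (inj₂ (inj₁ (p , x)))) = fa p x
      g (inj₂ (inj₂ (inj₂ (inj₁ (l , b , a , p))))) = forb l b a p
      g (inj₂ (inj₂ (inj₂ (inj₂ (inj₁ p))))) = fH p
      g (inj₂ (inj₂ (inj₂ (inj₂ (inj₂ p))))) = fV p
      gf : ∀ q → g (f q) ≡ q
      gf endd = refl
      gf froot = refl
      gf (lab a) = refl
      gf (fa p x) = refl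
      gf (forb l b a p) = refl
      gf (fH p) = refl
      gf (fV p) = refl

Test : Set
Test = Maybe HTest

pattern start = nothing

HView : Set
HView = Maybe (Bool × ALab × DLab)

HeadOk : Set
HeadOk = Bool → Sy → ALab → DLab → HView → HView → Bool

headCheck : HeadOk → Check ALab DLab
headCheck c = record { bA = id ; sA = λ a _ → a ; bD = id ; sD = λ d _ → d ; ok = c }

-- A node spells out the predecessors of its coordinates itself, so parent and child only compare
-- digits in equal positions; that they are predecessors is left to the static check. The input is
-- shifted by one letter from a cell to its right neighbour: the letter after `vs` in the child is
-- `vs` in the node.
goodLeft goodBelow : Bool → DLab → HView → Bool
goodLeft p d nothing = true
goodLeft p d (just (p' , _ , d')) =
  (p' == not p) ∧ (dfirst d' == dfirst d) ∧ (tb d' == tb d) ∧ (jb d' == jp d) ∧ (vs d == vn d')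
goodBelow p d nothing = true
goodBelow p d (just (p' , _ , d')) =
  (p' == not p) ∧ (dfirst d' == dfirst d) ∧ (tb d' == tp d) ∧ (jb d' == jb d)

goodOk : HeadOk
goodOk p a x d l b = goodLeft p d l ∧ goodBelow p d b

marked : HView → Bool
marked nothing = false
marked (just (_ , x , _)) = mark x

testOk : HTest → HeadOk
testOk endd p a x d l b = dfirst d
testOk froot p a x d l b = true
testOk (lab s) p a x d l b = isNode l ∨ isNode b ∨ ((vs d == s) ∧ not (dfirst d))
testOk (fa p' f) p a x d l b = not (p == p') ∨ (afirst x == f)
testOk (forb l' b' a' p') p a x d l b =
  not ((p == p') ∧ (a == a') ∧ (isNode l == l') ∧ (isNode b == b') ∧ mark x)
testOk (fH p') p a x d l b = not ((p == p') ∧ mark x ∧ marked l)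
testOk (fV p') p a x d l b = not ((p == p') ∧ mark x ∧ marked b)

testFin : HTest → HView → Bool
testFin froot v = not (marked v)
testFin _ v = true

ASum : Set
ASum = Bool × Bool × Bool

-- Of a pair of binary numbers t and t': whether t is 0, whether t' ≡ t, and
-- whether suc t' ≡ t.
NSum : Set
NSum = Bool × Bool × Bool

eqB : Bool → Bool → Bool
eqB true b = b
eqB false b = not b

stepN : Bool → Bool → NSum → NSum
stepN t t' (z , e , s) = (not t ∧ z) , (eqB t t' ∧ e) , ((t ∧ not t' ∧ e) ∨ (not t ∧ t' ∧ s))

initN : NSum
initN = true , true , false

DSum : Set
DSum = (Bool × Bool) × (NSum × NSum) × Sy × Sy × Bool

stepA : ALab → ASum → ASum
stepA a (f , n , m) = afirst a , (not f ∧ n) , (mark a ∨ m)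

stepD : DLab → DSum → DSum
stepD d ((f , n) , (rt , rj) , v , v⁺ , k) =
  (dfirst d , (not f ∧ n)) , (stepN (tb d) (tp d) rt , stepN (jb d) (jp d) rj) , vs d , vn d ,
  ((vn d == v) ∧ (isNode (vs d) ∨ not (isNode (vn d))) ∧ k)

initD : DSum
initD = (false , true) , (initN , initN) , nothing , nothing , true

numOk : Bool → NSum → Bool
numOk true (z , e , s) = s
numOk false (z , e , s) = z

-- The static check, made once before any rotation. A coordinate is zero or a successor according to
-- whether the child in its direction exists. Several marks in a tile string do no harm, since the
-- later tests bear on every marked position.
startOk : Bool → Sy → ASum → DSum → Maybe (Bool × ASum × DSum) → Maybe (Bool × ASum × DSum) → Bool
startOk p a (f , n , m) ((f' , n') , (rt , rj) , v , v⁺ , k) l b =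
  (f ∧ n ∧ m) ∧ (f' ∧ n' ∧ k) ∧ (v⁺ == a) ∧ numOk (isNode b) rt ∧ numOk (isNode l) rj

startCheck : Check ASum DSum
startCheck = record
  { bA = λ a → stepA a (false , true , false) ; sA = stepA
  ; bD = λ d → stepD d initD ; sD = stepD ; ok = startOk }

startFin : Maybe (Bool × ASum × DSum) → Bool
startFin (just (p , _)) = not p
startFin nothing = false

Holds : Test → BTree Lab → Set
Holds start = Accept startCheck startFin
Holds (just q) = Accept (headCheck (testOk q)) (testFin q)

Good : BTree Lab → Set
Good = Accept (headCheck goodOk) (λ _ → true)

nLab : ℕ
nLab = Finite.size finite-Lab

Tree : Set
Tree = BTree (Fin nLab)

decT : Tree → BTree Lab
decT = mapT dec

encT : BTree Lab → Tree
encT = mapT enc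

decT-encT : ∀ t → decT (encT t) ≡ t
decT-encT t = trans (mapT-∘ dec enc t) (mapT-id _ dec-enc t)

private
  trivialAlg : Alg (Fin nLab) ⊤
  trivialAlg = record { a0 = λ _ → tt ; a1 = λ _ _ → tt ; a2 = λ _ _ _ → tt }

  label₁ : Vec (Maybe (Fin nLab)) 1 → Lab
  label₁ (just i ∷ []) = dec i
  label₁ (nothing ∷ []) = dm

  goodAlg : Alg (Fin nLab) (CState (headCheck goodOk))
  goodAlg = comap dec (checkAlg (headCheck goodOk))

  stepFin : Maybe (Fin nLab × Fin nLab × CState (headCheck goodOk)) → Bool
  stepFin nothing = false
  stepFin (just (a , f , q)) = (f == a) ∧ acc (headCheck goodOk) (λ _ → true) q

testAut : Test → TreeAut (Vec (Maybe (Fin nLab)) 1)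
testAut start = toAut (comap label₁ (checkAlg startCheck)) (acc startCheck startFin)
testAut (just q) = toAut (comap label₁ (checkAlg (headCheck (testOk q)))) (acc (headCheck (testOk q)) (testFin q))

nRel : ℕ
nRel = suc (Finite.size (finite-Maybe {HTest}))

-- Only the first symbol is binary. A tuple of length one joins no two distinct elements, so the
-- tests add nothing to the Gaifman graph.
arity : Fin nRel → ℕ
arity zero = 1
arity (suc _) = 0

D₀ : TAData nRel arity
D₀ = record
  { k = nLab
  ; autL = toAut trivialAlg (λ _ → true)
  ; autEq = toAut (pairAlg eqAlg) isNode
  ; autR = λ { zero → toAut (pairAlg (rotAlg goodAlg)) stepFin ; (suc i) → testAut (dec i) } }

open Pres D₀ renaming (enc to encF)

inL : ∀ t → InL t
inL t = accepts⇐ trivialAlg (λ _ → true) {t} refl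

⟨_⟩ : Tree → Elem
⟨ t ⟩ = t , inL t

Eqv⇒≡ : ∀ t u → Eqv t u → t ≡ u
Eqv⇒≡ t u h with pfold eqAlg t u in e | trans (sym (cong isNode (fold-conv eqAlg t u))) (accepts⇒ (pairAlg eqAlg) isNode h)
... | just _ | _ = eqAlg-sound t u e

Eqv-refl : ∀ t → Eqv t t
Eqv-refl t = accepts⇐ (pairAlg eqAlg) isNode (cong isNode (trans (fold-conv eqAlg t t) (eqAlg-refl t)))

Step⇒ : ∀ t u → Rel zero (t ∷ u ∷ []) → u ≡ rot t × Good (decT t)
Step⇒ t u h with pfold (rotAlg goodAlg) t u in e | trans (sym (cong stepFin (fold-conv (rotAlg goodAlg) t u))) (accepts⇒ (pairAlg (rotAlg goodAlg)) stepFin h)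
... | just (a , f , q) | h' with rotAlg-sound goodAlg t u e | ∧-true {f == a} {acc (headCheck goodOk) (λ _ → true) q} h'
... | refl , refl , refl | f≡a , g = cong (λ x → shift x t) (==-sound f a f≡a) ,
  subst (λ q → acc (headCheck goodOk) (λ _ → true) q ≡ true) (fold-comap dec (checkAlg (headCheck goodOk)) t) g

Step⇐ : ∀ t → Good (decT t) → Rel zero (t ∷ rot t ∷ [])
Step⇐ t g = accepts⇐ (pairAlg (rotAlg goodAlg)) stepFin (trans (cong stepFin (trans (fold-conv (rotAlg goodAlg) t (rot t)) (rotAlg-complete goodAlg t (top t))))
  (∧-intro (==-refl (top t))
    (subst (λ q → acc (headCheck goodOk) (λ _ → true) q ≡ true) (sym (fold-comap dec (checkAlg (headCheck goodOk)) t)) g)))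

private
  fold-label₁ : ∀ {Q : Set} (α : Alg Lab Q) t → fold (comap label₁ α) (conv (t ∷ [])) ≡ fold α (decT t)
  fold-label₁ α t = trans (fold-comap label₁ α (conv (t ∷ []))) (cong (fold α) (mapT-∘ label₁ (λ a → just a ∷ []) t))

  unary⇒ : ∀ {Q : Set} {{_ : Finite Q}} (α : Alg Lab Q) fin t →
    Accepts (toAut (comap label₁ α) fin) (conv (t ∷ [])) → fin (fold α (decT t)) ≡ true
  unary⇒ α fin t h = trans (cong fin (sym (fold-label₁ α t))) (accepts⇒ (comap label₁ α) fin h)

  unary⇐ : ∀ {Q : Set} {{_ : Finite Q}} (α : Alg Lab Q) fin t →
    fin (fold α (decT t)) ≡ true → Accepts (toAut (comap label₁ α) fin) (conv (t ∷ []))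
  unary⇐ α fin t h = accepts⇐ (comap label₁ α) fin (trans (cong fin (fold-label₁ α t)) h)

  Test⇒' : ∀ q t → Accepts (testAut q) (conv (t ∷ [])) → Holds q (decT t)
  Test⇒' start = unary⇒ (checkAlg startCheck) (acc startCheck startFin)
  Test⇒' (just q) = unary⇒ (checkAlg (headCheck (testOk q))) (acc (headCheck (testOk q)) (testFin q))

  Test⇐' : ∀ q t → Holds q (decT t) → Accepts (testAut q) (conv (t ∷ []))
  Test⇐' start = unary⇐ (checkAlg startCheck) (acc startCheck startFin)
  Test⇐' (just q) = unary⇐ (checkAlg (headCheck (testOk q))) (acc (headCheck (testOk q)) (testFin q))

testRel : Test → Fin nRel
testRel q = suc (enc q)

Test⇒ : ∀ q t → Rel (testRel q) (t ∷ []) → Holds q (decT t)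
Test⇒ q t h = Test⇒' q t (subst (λ q → Accepts (testAut q) (conv (t ∷ []))) (dec-enc q) h)

Test⇐ : ∀ q t → Holds q (decT t) → Rel (testRel q) (t ∷ [])
Test⇐ q t h = subst (λ q → Accepts (testAut q) (conv (t ∷ []))) (sym (dec-enc q)) (Test⇐' q t h)

congruence : IsCongruence
congruence = record
  { eq-refl = λ t _ → Eqv-refl t
  ; eq-sym = λ t u _ _ e → subst (λ x → Eqv x t) (Eqv⇒≡ t u e) (Eqv-refl t)
  ; eq-trans = λ t u v _ _ _ e e' → subst (Eqv t) (Eqv⇒≡ u v e') e
  ; eq-cong = λ r ts us _ _ e → subst (Rel r) (equal e) }
  where
  equal : ∀ {n} {ts us : Vec Tr n} → Pointwise Eqv ts us → ts ≡ us
  equal [] = refl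
  equal (e ∷ es) = cong₂ _∷_ (Eqv⇒≡ _ _ e) (equal es)

iter : ∀ {A : Set} → (A → A) → ℕ → A → A
iter f zero x = x
iter f (suc k) x = iter f k (f x)

iter-suc : ∀ {A : Set} (f : A → A) k x → iter f k (f x) ≡ f (iter f k x)
iter-suc f zero x = refl
iter-suc f (suc k) x = iter-suc f k (f x)

iter-+ : ∀ {A : Set} (f : A → A) m n x → iter f (m + n) x ≡ iter f n (iter f m x)
iter-+ f zero n x = refl
iter-+ f (suc m) n x = iter-+ f m n (f x)

iter-rot-injective : ∀ {A : Set} k (t u : BTree A) → iter rot k t ≡ iter rot k u → t ≡ u
iter-rot-injective zero t u e = e
iter-rot-injective (suc k) t u e = rot-injective t u (iter-rot-injective k (rot t) (rot u) e)

-- Degree and growth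

Near : ℕ → Tree → Tree → Set
Near n t u = Σ ℕ λ k → k ≤ n × (u ≡ iter rot k t ⊎ t ≡ iter rot k u)

adj⇒ : ∀ a b → Adj a b → proj₁ b ≡ rot (proj₁ a) ⊎ proj₁ a ≡ rot (proj₁ b)
adj⇒ (a , ia) (b , ib) (a≉b , zero , x ∷ y ∷ [] , h , i , j , e , e')
  with Step⇒ (proj₁ x) (proj₁ y) h
... | y≡ , _ = go i j e e'
  where
  go : ∀ i j → (lookup (x ∷ y ∷ []) i ≈ (a , ia)) → (lookup (x ∷ y ∷ []) j ≈ (b , ib)) → b ≡ rot a ⊎ a ≡ rot b
  go zero zero e e' = ⊥-elim (a≉b (subst₂ Eqv (Eqv⇒≡ _ _ e) (Eqv⇒≡ _ _ e') (Eqv-refl _)))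
  go zero (suc zero) e e' = inj₁ (trans (sym (Eqv⇒≡ _ _ e')) (trans y≡ (cong rot (Eqv⇒≡ _ _ e))))
  go (suc zero) zero e e' = inj₂ (trans (sym (Eqv⇒≡ _ _ e)) (trans y≡ (cong rot (Eqv⇒≡ _ _ e'))))
  go (suc zero) (suc zero) e e' = ⊥-elim (a≉b (subst₂ Eqv (Eqv⇒≡ _ _ e) (Eqv⇒≡ _ _ e') (Eqv-refl _)))
adj⇒ a b (a≉b , suc r , x ∷ [] , h , zero , zero , e , e') =
  ⊥-elim (a≉b (subst₂ Eqv (Eqv⇒≡ _ _ e) (Eqv⇒≡ _ _ e') (Eqv-refl _)))

-- A step against the direction of the remaining walk cancels one of its rotations; if that step
-- goes forwards, this takes the injectivity of `rot`.
within⇒near : ∀ n a b → Within n a b → Near n (proj₁ a) (proj₁ b)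
within⇒near n a b (here e) = 0 , z≤n , inj₁ (sym (Eqv⇒≡ _ _ e))
within⇒near (suc n) a b (step {c = c} adj w) with adj⇒ a c adj | within⇒near n c b w
... | inj₁ e | k , k≤n , inj₁ e' = suc k , s≤s k≤n , inj₁ (trans e' (cong (iter rot k) e))
... | inj₁ e | zero , k≤n , inj₂ e' = 1 , s≤s z≤n , inj₁ (trans (sym e') e)
... | inj₁ e | suc k , k≤n , inj₂ e' = k , ≤-trans (n≤1+n k) (m≤n⇒m≤1+n k≤n) ,
  inj₂ (rot-injective _ _ (trans (sym e) (trans e' (iter-suc rot k (proj₁ b)))))
... | inj₂ e | zero , k≤n , inj₁ e' = 1 , s≤s z≤n , inj₂ (trans e (cong rot (sym e')))
... | inj₂ e | suc k , k≤n , inj₁ e' = k , ≤-trans (n≤1+n k) (m≤n⇒m≤1+n k≤n) ,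
  inj₁ (trans e' (cong (iter rot k) (sym e)))
... | inj₂ e | k , k≤n , inj₂ e' = suc k , s≤s k≤n ,
  inj₂ (trans e (trans (cong rot e') (sym (iter-suc rot k (proj₁ b)))))

allPairs-lookup : ∀ {A : Set} {R : A → A → Set} {xs} → AllPairs R xs →
  ∀ i j → i Fin.< j → R (List.lookup xs i) (List.lookup xs j)
allPairs-lookup (r ∷ rs) zero (suc j) _ = All.lookup r (∈-lookup j)
allPairs-lookup (r ∷ rs) (suc i) (suc j) (s≤s i<j) = allPairs-lookup rs i j i<j

cardLE : ∀ {P : Elem → Set} m (Cl : Fin m → Elem → Set) → (∀ i x y → Cl i x → Cl i y → x ≈ y) →
  (∀ x → P x → Σ (Fin m) λ i → Cl i x) → CardLE P m
cardLE m Cl uniq classify xs ap all = ≮⇒≥ λ m< →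
  let i , j , i<j , e = Finₚ.pigeonhole m< (λ i → proj₁ (cls i)) in
  allPairs-lookup ap i j i<j
    (uniq _ _ _ (proj₂ (cls i)) (subst (λ c → Cl c (List.lookup xs j)) (sym e) (proj₂ (cls j))))
  where
  cls : ∀ i → Σ (Fin m) λ c → Cl c (List.lookup xs i)
  cls i = classify _ (All.lookup all (∈-lookup i))

near-card : ∀ {P : Elem → Set} n a → (∀ x → P x → Near n a (proj₁ x)) → CardLE P (suc n + suc n)
near-card n a near = cardLE (suc n + suc n) (λ i x → Cl (splitAt (suc n) i) (proj₁ x))
  (λ i x y c c' → subst (Eqv (proj₁ x)) (uniq (splitAt (suc n) i) c c') (Eqv-refl _))
  (λ x p → classify (near x p))
  where
  Cl : Fin (suc n) ⊎ Fin (suc n) → Tree → Set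
  Cl (inj₁ k) u = u ≡ iter rot (toℕ k) a
  Cl (inj₂ k) u = a ≡ iter rot (toℕ k) u
  uniq : ∀ i {u v} → Cl i u → Cl i v → u ≡ v
  uniq (inj₁ k) e e' = trans e (sym e')
  uniq (inj₂ k) e e' = iter-rot-injective (toℕ k) _ _ (trans (sym e) e')
  index : ∀ i {u} → Cl i u → Σ (Fin (suc n + suc n)) λ j → Cl (splitAt (suc n) j) u
  index i {u} c = join _ _ i , subst (λ i → Cl i u) (sym (Finₚ.splitAt-join (suc n) (suc n) i)) c
  classify : ∀ {u} → Near n a u → Σ (Fin (suc n + suc n)) λ i → Cl (splitAt (suc n) i) u
  classify {u} (k , k≤n , inj₁ e) = index (inj₁ (fromℕ< (s≤s k≤n)))
    (trans e (cong (λ k → iter rot k a) (sym (Finₚ.toℕ-fromℕ< (s≤s k≤n)))))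
  classify {u} (k , k≤n , inj₂ e) = index (inj₂ (fromℕ< (s≤s k≤n)))
    (trans e (cong (λ k → iter rot k u) (sym (Finₚ.toℕ-fromℕ< (s≤s k≤n)))))

boundedDegree : BoundedDegree
-- The count admits zero or one rotation in either direction, so 4 is a rough bound.
boundedDegree = 4 , λ a → near-card 1 (proj₁ a) λ b adj → case adj⇒ a b adj of λ
  { (inj₁ e) → 1 , ≤-refl , inj₁ e ; (inj₂ e) → 1 , ≤-refl , inj₂ e }

linearGrowth : LinearGrowth
linearGrowth = 4 , 1 , λ n 1≤n → m≤m+n n _ , λ a xs ap all →
  ≤-trans (near-card n (proj₁ a) (λ b → within⇒near n a b) xs ap all) (bound n 1≤n)
  where
  bound : ∀ n → 1 ≤ n → suc n + suc n ≤ 4 * n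
  bound (suc n) _ = ≤-trans (m≤m+n _ (n + n)) (≤-reflexive (arith n))
    where
    arith : ∀ n → suc (suc n) + suc (suc n) + (n + n) ≡ 4 * suc n
    arith = solve-∀

-- Formulas

data Instr : Set where
  tst : Test → Instr
  stp : Instr

chainF : ∀ {n} → List Instr → Formula (suc n)
chainF [] = equ zero zero
chainF (tst q ∷ is) = conj (rel (testRel q) (zero ∷ [])) (chainF is)
chainF (stp ∷ is) = ex (conj (rel zero (suc zero ∷ zero ∷ [])) (chainF is))

-- reachF k says of the variables 1 and 0 that 2 ^ k steps lead from the former
-- to the latter.  The subformula reachF k of reachF (suc k) speaks about its two
-- innermost variables only, so each level of the recursion contributes the same
-- text to the encoding.
reachF : ∀ {n} → ℕ → Formula (2 + n)
reachF zero = rel zero (suc zero ∷ zero ∷ [])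
reachF (suc k) = ex (neg (ex (ex (conj
  (neg (conj (neg (conj (equ u x) (equ v z))) (neg (conj (equ u z) (equ v y)))))
  (neg (reachF k))))))
  where
  v u z y x : ∀ {n} → Fin (5 + n)
  v = zero
  u = suc zero
  z = suc (suc zero)
  y = suc (suc (suc zero))
  x = suc (suc (suc (suc zero)))

-- The machine enters through `is`, the word through `js`, the running time through `k`. After 2 ^ k
-- steps every counter has to show its first digit again; so none is longer than 2 ^ k, and the walk
-- has compared all digits.
mainF : List Instr → List Instr → ℕ → Formula 0
mainF is js k = ex (conj (chainF is) (conj (chainF js)
  (ex (conj (rel (testRel (just endd)) (zero ∷ [])) (reachF k)))))

-- Meaning of the formulas

Runs : List Instr → BTree Lab → Set
Runs [] t = ⊤
Runs (tst q ∷ is) t = Holds q t × Runs is t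
Runs (stp ∷ is) t = Good t × Runs is (rot t)

decT-rot : ∀ t → decT (rot t) ≡ rot (decT t)
decT-rot t = sym (rot-mapT dec t)

chainF-sound : ∀ {n} is (ρ : Fin (suc n) → Elem) → Sat (chainF is) ρ → Runs is (decT (proj₁ (ρ zero)))
chainF-sound [] ρ _ = tt
chainF-sound (tst q ∷ is) ρ (h , hs) = Test⇒ q _ h , chainF-sound is ρ hs
chainF-sound (stp ∷ is) ρ (a , h , hs) with Step⇒ (proj₁ (ρ zero)) (proj₁ a) h
... | e , g = g , subst (Runs is) (trans (cong decT e) (decT-rot _)) (chainF-sound is (extend a ρ) hs)

chainF-complete : ∀ {n} is (ρ : Fin (suc n) → Elem) → Runs is (decT (proj₁ (ρ zero))) → Sat (chainF is) ρ
chainF-complete [] ρ _ = Eqv-refl _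
chainF-complete (tst q ∷ is) ρ (h , hs) = Test⇐ q _ h , chainF-complete is ρ hs
chainF-complete (stp ∷ is) ρ (g , hs) = ⟨ rot t ⟩ , Step⇐ t g ,
  chainF-complete is _ (subst (Runs is) (sym (decT-rot t)) hs)
  where
  t : Tree
  t = proj₁ (ρ zero)

Reach : ℕ → Tree → Tree → Set
Reach m t u = u ≡ iter rot m t × (∀ i → i < m → Good (decT (iter rot i t)))

reach-++ : ∀ {m n t u v} → Reach m t u → Reach n u v → Reach (m + n) t v
reach-++ {m} {n} {t} (refl , h) (refl , h') = sym (iter-+ rot m n t) , good
  where
  good : ∀ i → i < m + n → Good (decT (iter rot i t))
  good i i< with i <? m
  ... | yes i<m = h i i<m
  ... | no i≮m = subst (λ k → Good (decT (iter rot k t))) (m+[n∸m]≡n (≮⇒≥ i≮m))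
    (subst (Good ∘ decT) (sym (iter-+ rot m (i ∸ m) t))
      (h' (i ∸ m) (+-cancelˡ-< m _ _ (subst (_< m + n) (sym (m+[n∸m]≡n (≮⇒≥ i≮m))) i<))))

reach-split : ∀ m {n t v} → Reach (m + n) t v → Σ Tree λ u → Reach m t u × Reach n u v
reach-split m {n} {t} (e , h) = iter rot m t , (refl , λ i i<m → h i (≤-trans i<m (m≤m+n m n))) ,
  trans e (iter-+ rot m n t) ,
  λ i i<n → subst (Good ∘ decT) (iter-+ rot m i t) (h (m + i) (+-monoʳ-< m i<n))

double : ∀ k → 2 ^ suc k ≡ 2 ^ k + 2 ^ k
double k = cong (2 ^ k +_) (+-identityʳ (2 ^ k))

-- The universal quantifier over the two halves is coded by negations, which constructively give no
-- more than a double negation. It is removed at the very end, where acceptance is a Boolean.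
reachF-sound : ∀ {n} k (ρ : Fin (2 + n) → Elem) → Sat (reachF k) ρ →
  ¬ ¬ Reach (2 ^ k) (proj₁ (ρ (suc zero))) (proj₁ (ρ zero))
reachF-sound zero ρ h ¬r with Step⇒ (proj₁ (ρ (suc zero))) (proj₁ (ρ zero)) h
... | e , g = ¬r (e , λ { zero _ → g ; (suc i) (s≤s ()) })
reachF-sound (suc k) ρ (z , h) ¬r =
  h (x , z , (λ n → proj₁ n (Eqv-refl _ , Eqv-refl _)) , λ s →
    reachF-sound k _ s λ r₁ →
    h (z , y , (λ n → proj₂ n (Eqv-refl _ , Eqv-refl _)) , λ s' →
      reachF-sound k _ s' λ r₂ →
      ¬r (subst (λ m → Reach m (proj₁ x) (proj₁ y)) (sym (double k)) (reach-++ r₁ r₂))))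
  where
  x y : Elem
  x = ρ (suc zero)
  y = ρ zero

reachF-complete : ∀ {n} k (ρ : Fin (2 + n) → Elem) →
  Reach (2 ^ k) (proj₁ (ρ (suc zero))) (proj₁ (ρ zero)) → Sat (reachF k) ρ
reachF-complete zero ρ (e , g) =
  subst (λ u → Rel zero (proj₁ (ρ (suc zero)) ∷ u ∷ [])) (sym e) (Step⇐ _ (g 0 (s≤s z≤n)))
reachF-complete (suc k) ρ r with reach-split (2 ^ k) (subst (λ m → Reach m (proj₁ (ρ (suc zero))) (proj₁ (ρ zero))) (double k) r)
... | z , r₁ , r₂ = ⟨ z ⟩ , λ { (u , v , h , ¬s) → h
  ( (λ { (e , e') → ¬s (reachF-complete k _ (subst₂ (Reach (2 ^ k)) (sym (Eqv⇒≡ _ _ e)) (sym (Eqv⇒≡ _ _ e')) r₁)) })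
  , (λ { (e , e') → ¬s (reachF-complete k _ (subst₂ (Reach (2 ^ k)) (sym (Eqv⇒≡ _ _ e)) (sym (Eqv⇒≡ _ _ e')) r₂)) }) ) }

decT-iter : ∀ k t → decT (iter rot k t) ≡ iter rot k (decT t)
decT-iter zero t = refl
decT-iter (suc k) t = trans (decT-iter k (rot t)) (cong (iter rot k) (decT-rot t))

record Witness (is js : List Instr) (k : ℕ) (t : BTree Lab) : Set where
  field
    runs₁ : Runs is t
    runs₂ : Runs js t
    good  : ∀ i → i < 2 ^ k → Good (iter rot i t)
    ended : Holds (just endd) (iter rot (2 ^ k) t)

mainF-sound : ∀ is js k → Sat (mainF is js k) noVar → ¬ ¬ Σ (BTree Lab) (Witness is js k)
mainF-sound is js k (a , h₁ , h₂ , e , h₃ , h₄) ¬w = reachF-sound k _ h₄ λ { (eq , g) → ¬w (decT (proj₁ a) , record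
  { runs₁ = chainF-sound is _ h₁
  ; runs₂ = chainF-sound js _ h₂
  ; good = λ i i< → subst Good (decT-iter i _) (g i i<)
  ; ended = subst (Holds (just endd)) (trans (cong decT eq) (decT-iter (2 ^ k) _)) (Test⇒ (just endd) _ h₃) }) }

mainF-complete : ∀ is js k t → Witness is js k t → Sat (mainF is js k) noVar
mainF-complete is js k t w = ⟨ encT t ⟩ ,
  chainF-complete is _ (subst (Runs is) (sym (decT-encT t)) runs₁) ,
  chainF-complete js _ (subst (Runs js) (sym (decT-encT t)) runs₂) ,
  ⟨ iter rot (2 ^ k) (encT t) ⟩ ,
  Test⇐ (just endd) _ (subst (Holds (just endd)) (sym (rotated (2 ^ k))) ended) ,
  reachF-complete k _ (refl , λ i i< → subst Good (sym (rotated i)) (good i i<))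
  where
  open Witness w
  rotated : ∀ i → decT (iter rot i (encT t)) ≡ iter rot i t
  rotated i = trans (decT-iter i (encT t)) (cong (iter rot i) (decT-encT t))

-- The encoding of formulas is injective

∷-injʳ : ∀ {A : Set} {a b : A} {s t : List A} → a ∷ s ≡ b ∷ t → s ≡ t
∷-injʳ refl = refl

drop₃ : ∀ {A : Set} {a b c a' b' c' : A} {s t} → _≡_ {A = List A} (a ∷ b ∷ c ∷ s) (a' ∷ b' ∷ c' ∷ t) → s ≡ t
drop₃ refl = refl

reassoc : ∀ {A : Set} (u u' : List A) {v v' r r'} → (u ++ v) ++ r ≡ (u' ++ v') ++ r' → u ++ v ++ r ≡ u' ++ v' ++ r'
reassoc u u' {v} {v'} {r} {r'} e = trans (sym (++-assoc u v r)) (trans e (++-assoc u' v' r'))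

unary-inj : ∀ m n {r r'} → unary m ++ r ≡ unary n ++ r' → m ≡ n × r ≡ r'
unary-inj zero zero refl = refl , refl
unary-inj (suc m) (suc n) e = map₁ (cong suc) (unary-inj m n (∷-injʳ e))

args-inj : ∀ {n m} (xs ys : Vec (Fin n) m) {r r'} →
  concatMap (λ x → unary (toℕ x)) (Vec.toList xs) ++ r ≡ concatMap (λ x → unary (toℕ x)) (Vec.toList ys) ++ r' →
  xs ≡ ys × r ≡ r'
args-inj [] [] e = refl , e
args-inj (x ∷ xs) (y ∷ ys) {r} {r'} e
  with unary-inj (toℕ x) (toℕ y)
    (reassoc (unary (toℕ x)) (unary (toℕ y)) e)
... | e₁ , e₂ with Finₚ.toℕ-injective e₁ | args-inj xs ys e₂
... | refl | refl , e₃ = refl , e₃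

-- Unique readability in front of arbitrary continuations, as the induction needs it for the first
-- half of a conjunction.
encF-inj : ∀ {n} (φ ψ : Formula n) {r r'} → encF φ ++ r ≡ encF ψ ++ r' → φ ≡ ψ × r ≡ r'
encF-inj (rel q xs) (rel q' ys) {r} {r'} e
  with unary-inj (toℕ q) (toℕ q')
    (reassoc (unary (toℕ q)) (unary (toℕ q')) (drop₃ e))
... | e₁ , e₂ with Finₚ.toℕ-injective e₁
... | refl with args-inj xs ys e₂
... | refl , e₃ = refl , e₃
encF-inj (equ x y) (equ x' y') {r} {r'} e
  with unary-inj (toℕ x) (toℕ x')
    (reassoc (unary (toℕ x)) (unary (toℕ x')) (drop₃ e))
... | e₁ , e₂ with Finₚ.toℕ-injective e₁ | unary-inj (toℕ y) (toℕ y') e₂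
... | refl | e₃ , e₄ with Finₚ.toℕ-injective e₃
... | refl = refl , e₄
encF-inj (neg φ) (neg ψ) e with encF-inj φ ψ (drop₃ e)
... | refl , e' = refl , e'
encF-inj (conj φ φ') (conj ψ ψ') {r} {r'} e
  with encF-inj φ ψ (reassoc (encF φ) (encF ψ) (drop₃ e))
... | refl , e₁ with encF-inj φ' ψ' e₁
... | refl , e₂ = refl , e₂
encF-inj (ex φ) (ex ψ) e with encF-inj φ ψ (drop₃ e)
... | refl , e' = refl , e'
encF-inj (rel _ _) (equ _ _) ()
encF-inj (rel _ _) (neg _) ()
encF-inj (rel _ _) (conj _ _) ()
encF-inj (rel _ _) (ex _) ()
encF-inj (equ _ _) (rel _ _) ()
encF-inj (equ _ _) (neg _) ()
encF-inj (equ _ _) (conj _ _) ()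
encF-inj (equ _ _) (ex _) ()
encF-inj (neg _) (rel _ _) ()
encF-inj (neg _) (equ _ _) ()
encF-inj (neg _) (conj _ _) ()
encF-inj (neg _) (ex _) ()
encF-inj (conj _ _) (rel _ _) ()
encF-inj (conj _ _) (equ _ _) ()
encF-inj (conj _ _) (neg _) ()
encF-inj (conj _ _) (ex _) ()
encF-inj (ex _) (rel _ _) ()
encF-inj (ex _) (equ _ _) ()
encF-inj (ex _) (neg _) ()
encF-inj (ex _) (conj _ _) ()

encF-injective : ∀ {n} (φ ψ : Formula n) → encF φ ≡ encF ψ → φ ≡ ψ
encF-injective φ ψ e = proj₁ (encF-inj φ ψ (cong (_++ []) e))

-- The text of the formulas

power : List Bool → ℕ → List Bool
power w zero = []
power w (suc k) = w ++ power w k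

power-+ : ∀ w a b → power w (a + b) ≡ power w a ++ power w b
power-+ w zero b = refl
power-+ w (suc a) b = trans (cong (w ++_) (power-+ w a b)) (sym (++-assoc w _ _))

length-power : ∀ w a → length (power w a) ≡ a * length w
length-power w zero = refl
length-power w (suc a) = trans (length-++ w) (cong (length w +_) (length-power w a))

-- An encoded formula shows its de Bruijn indices but not the number of variables in scope, so the
-- text of an instruction is the same at every depth of the chain.
instrStr : Instr → List Bool
instrStr (tst q) = false ∷ true ∷ true ∷ encF {1} (rel (testRel q) (zero ∷ []))
instrStr stp = true ∷ false ∷ false ∷ false ∷ true ∷ true ∷ encF {2} (rel zero (suc zero ∷ zero ∷ []))

truthStr levelStr baseStr : List Bool
truthStr = encF {1} (equ zero zero)
baseStr = encF {2} (reachF 0)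
levelStr = true ∷ false ∷ false ∷ false ∷ true ∷ false ∷ true ∷ false ∷ false ∷ true ∷ false ∷ false ∷
  false ∷ true ∷ true ∷ encF {5} (neg (conj
    (neg (conj (equ (suc zero) (suc (suc (suc (suc zero))))) (equ zero (suc (suc zero)))))
    (neg (conj (equ (suc zero) (suc (suc zero))) (equ zero (suc (suc (suc zero)))))))) ++
  false ∷ true ∷ false ∷ []

encF-chainF : ∀ {n} is → encF (chainF {n} is) ≡ concatMap instrStr is ++ truthStr
encF-chainF [] = refl
encF-chainF (tst q ∷ is) = cong (λ s → false ∷ true ∷ true ∷ s)
  (trans (cong (encF {1} (rel (testRel q) (zero ∷ [])) ++_) (encF-chainF is))
    (sym (++-assoc (encF {1} (rel (testRel q) (zero ∷ []))) _ truthStr)))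
encF-chainF (stp ∷ is) = cong (λ s → instrStr stp ++ s) (encF-chainF is)

encF-reachF : ∀ {n} k → encF (reachF {n} k) ≡ power levelStr k ++ baseStr
encF-reachF zero = refl
encF-reachF (suc k) = cong (levelStr ++_) (encF-reachF k)

exConjStr conjStr endStr : List Bool
exConjStr = true ∷ false ∷ false ∷ false ∷ true ∷ true ∷ []
conjStr = false ∷ true ∷ true ∷ []
endStr = encF {2} (rel (testRel (just endd)) (zero ∷ []))

mainStr : List Instr → List Instr → ℕ → List Bool
mainStr is js k = exConjStr ++ (concatMap instrStr is ++ truthStr) ++
  conjStr ++ (concatMap instrStr js ++ truthStr) ++
  exConjStr ++ endStr ++
  power levelStr k ++ baseStr

encF-mainF : ∀ is js k → encF (mainF is js k) ≡ mainStr is js k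
encF-mainF is js k = cong₂ (λ u v → exConjStr ++ u ++ conjStr ++ v)
  (encF-chainF is) (cong₂ (λ u v → u ++ exConjStr ++ endStr ++ v)
    (encF-chainF js) (encF-reachF k))

-- Strings

lenP : ∀ {A : Set} → Str A → ℕ
lenP (one _) = 0
lenP (_ ⟫ s) = suc (lenP s)

nth : ∀ {A : Set} → Str A → ℕ → A
nth (one a) _ = a
nth (a ⟫ s) zero = a
nth (a ⟫ s) (suc i) = nth s i

at : ∀ {A : Set} → Str A → ℕ → A
at s k = headS (iter rotS k s)

nth-zero : ∀ {A : Set} (s : Str A) → nth s 0 ≡ headS s
nth-zero (one _) = refl
nth-zero (_ ⟫ _) = refl

lenP-shiftS : ∀ {A : Set} (f : A) s → lenP (shiftS f s) ≡ lenP s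
lenP-shiftS f (one _) = refl
lenP-shiftS f (_ ⟫ s) = cong suc (lenP-shiftS f s)

nth-shiftS-< : ∀ {A : Set} (f : A) s i → i < lenP s → nth (shiftS f s) i ≡ nth s (suc i)
nth-shiftS-< f (a ⟫ s) zero _ = sym (nth-zero s)
nth-shiftS-< f (a ⟫ s) (suc i) (s≤s i<) = nth-shiftS-< f s i i<

nth-shiftS-last : ∀ {A : Set} (f : A) s → nth (shiftS f s) (lenP s) ≡ f
nth-shiftS-last f (one _) = refl
nth-shiftS-last f (_ ⟫ s) = nth-shiftS-last f s

suc-% : ∀ k n .{{_ : NonZero n}} → suc (k % n) % n ≡ suc k % n
suc-% k n = trans (%-distribˡ-+ 1 (k % n) n)
  (trans (cong (λ b → (1 % n + b) % n) (m%n%n≡m%n k n)) (sym (%-distribˡ-+ 1 k n)))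

nth-rotS : ∀ {A : Set} (s : Str A) i → i ≤ lenP s → nth (rotS s) i ≡ nth s (suc i % suc (lenP s))
nth-rotS s i i≤ with m≤n⇒m<n∨m≡n i≤
... | inj₁ i< = trans (nth-shiftS-< _ s i i<) (cong (nth s) (sym (m<n⇒m%n≡m (s≤s i<))))
... | inj₂ refl = trans (nth-shiftS-last _ s)
  (trans (sym (nth-zero s)) (cong (nth s) (sym (n%n≡0 (suc (lenP s))))))

at-nth : ∀ {A : Set} (s : Str A) k → at s k ≡ nth s (k % suc (lenP s))
at-nth s zero = sym (nth-zero s)
at-nth s (suc k) = begin
  at (rotS s) k                               ≡⟨ at-nth (rotS s) k ⟩
  nth (rotS s) (k % suc (lenP (rotS s)))      ≡⟨ cong (λ m → nth (rotS s) (k % suc m)) (lenP-shiftS _ s) ⟩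
  nth (rotS s) (k % suc (lenP s))             ≡⟨ nth-rotS s _ (s≤s⁻¹ (m%n<n k (suc (lenP s)))) ⟩
  nth s (suc (k % suc (lenP s)) % suc (lenP s)) ≡⟨ cong (nth s) (suc-% k (suc (lenP s))) ⟩
  nth s (suc k % suc (lenP s))                ∎
  where open ≡-Reasoning

at-nth-< : ∀ {A : Set} (s : Str A) k → k ≤ lenP s → at s k ≡ nth s k
at-nth-< s k k≤ = trans (at-nth s k) (cong (nth s) (m<n⇒m%n≡m (s≤s k≤)))

at-lenP : ∀ {A : Set} (s : Str A) → at s (suc (lenP s)) ≡ nth s 0
at-lenP s = trans (at-nth s (suc (lenP s))) (cong (nth s) (n%n≡0 (suc (lenP s))))

mkS : ∀ {A : Set} → (ℕ → A) → ℕ → Str A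
mkS f zero = one (f 0)
mkS f (suc m) = f 0 ⟫ mkS (f ∘ suc) m

lenP-mkS : ∀ {A : Set} (f : ℕ → A) m → lenP (mkS f m) ≡ m
lenP-mkS f zero = refl
lenP-mkS f (suc m) = cong suc (lenP-mkS (f ∘ suc) m)

nth-mkS : ∀ {A : Set} (f : ℕ → A) m i → i ≤ m → nth (mkS f m) i ≡ f i
nth-mkS f zero zero _ = refl
nth-mkS f (suc m) zero _ = refl
nth-mkS f (suc m) (suc i) (s≤s i≤) = nth-mkS (f ∘ suc) m i i≤

at-mkS : ∀ {A : Set} (f : ℕ → A) m k → at (mkS f m) k ≡ f (k % suc m)
at-mkS f m k = trans (at-nth (mkS f m) k) (trans (cong (λ l → nth (mkS f m) (k % suc l)) (lenP-mkS f m))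
  (nth-mkS f m _ (s≤s⁻¹ (m%n<n k (suc m)))))

-- Summaries of strings: flags, marks, binary numbers, input letters

strFold-hom : ∀ {A Q Q' : Set} (h : Q → Q') {b : A → Q} {s : A → Q → Q} {b' : A → Q'} {s' : A → Q' → Q'} →
  (∀ a → h (b a) ≡ b' a) → (∀ a q → h (s a q) ≡ s' a (h q)) → ∀ x → h (strFold b s x) ≡ strFold b' s' x
strFold-hom h hb hs (one a) = hb a
strFold-hom h {s' = s'} hb hs (a ⟫ x) = trans (hs a _) (cong (s' a) (strFold-hom h hb hs x))

strFold-head : ∀ {A : Set} (s : Str A) → strFold id (λ a _ → a) s ≡ headS s
strFold-head (one _) = refl
strFold-head (_ ⟫ _) = refl

firstSum : ∀ {A : Set} → (A → Bool) → Str A → Bool × Bool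
firstSum g = strFold (λ a → g a , true) (λ { a (f , n) → g a , (not f ∧ n) })

firstSum-head : ∀ {A : Set} (g : A → Bool) s → proj₁ (firstSum g s) ≡ g (headS s)
firstSum-head g (one _) = refl
firstSum-head g (_ ⟫ _) = refl

not-true : ∀ {b} → not b ≡ true → b ≡ false
not-true {false} _ = refl

firstSum-tail : ∀ {A : Set} (g : A → Bool) s → proj₂ (firstSum g s) ≡ true →
  ∀ i → i < lenP s → g (nth s (suc i)) ≡ false
firstSum-tail g (a ⟫ s) e i i< with ∧-true {not (proj₁ (firstSum g s))} e
firstSum-tail g (a ⟫ s) e zero i< | e₁ , e₂ = trans (cong g (nth-zero s)) (trans (sym (firstSum-head g s)) (not-true e₁))
firstSum-tail g (a ⟫ s) e (suc i) (s≤s i<) | e₁ , e₂ = firstSum-tail g s e₂ i i<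

firstSum-intro : ∀ {A : Set} (g : A → Bool) s → (∀ i → i < lenP s → g (nth s (suc i)) ≡ false) →
  proj₂ (firstSum g s) ≡ true
firstSum-intro g (one a) h = refl
firstSum-intro g (a ⟫ s) h = ∧-intro
  (cong not (trans (firstSum-head g s) (trans (cong g (sym (nth-zero s))) (h 0 (s≤s z≤n)))))
  (firstSum-intro g s λ i i< → h (suc i) (s≤s i<))

anyMark : Str ALab → Bool
anyMark = strFold mark (λ a m → mark a ∨ m)

anyMark-sound : ∀ s → anyMark s ≡ true → Σ ℕ λ i → i ≤ lenP s × mark (nth s i) ≡ true
anyMark-sound (one a) e = 0 , z≤n , e
anyMark-sound (a ⟫ s) e with mark a in eq
... | true = 0 , z≤n , eq
... | false with anyMark-sound s e
... | i , i≤ , e' = suc i , s≤s i≤ , e'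

anyMark-complete : ∀ s i → i ≤ lenP s → mark (nth s i) ≡ true → anyMark s ≡ true
anyMark-complete (one a) i _ e = e
anyMark-complete (a ⟫ s) zero _ e rewrite e = refl
anyMark-complete (a ⟫ s) (suc i) (s≤s i≤) e with mark a
... | true = refl
... | false = anyMark-complete s i i≤ e

digit : Bool → ℕ
digit true = 1
digit false = 0

val : ∀ {A : Set} → (A → Bool) → Str A → ℕ
val g = strFold (λ a → digit (g a) + 2 * 0) (λ a v → digit (g a) + 2 * v)

val-cong : ∀ {A : Set} (g h : A → Bool) s s' → lenP s ≡ lenP s' →
  (∀ i → i ≤ lenP s → g (nth s i) ≡ h (nth s' i)) → val g s ≡ val h s'
val-cong g h (one a) (one b) _ e = cong (λ d → digit d + 2 * 0) (e 0 z≤n)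
val-cong g h (a ⟫ s) (b ⟫ s') l e = cong₂ (λ d v → digit d + 2 * v) (e 0 z≤n)
  (val-cong g h s s' (suc-injective l) λ i i≤ → e (suc i) (s≤s i≤))

record NSpec (t t' : ℕ) (r : NSum) : Set where
  field
    zero⇒ : proj₁ r ≡ true → t ≡ 0
    zero⇐ : t ≡ 0 → proj₁ r ≡ true
    equal⇒ : proj₁ (proj₂ r) ≡ true → t ≡ t'
    equal⇐ : t ≡ t' → proj₁ (proj₂ r) ≡ true
    succ⇒ : proj₂ (proj₂ r) ≡ true → t ≡ suc t'
    succ⇐ : t ≡ suc t' → proj₂ (proj₂ r) ≡ true

open NSpec

private
  half : ∀ a b → 2 * a ≡ 2 * b → a ≡ b
  half a b = *-cancelˡ-≡ a b 2

  ss : ∀ b → suc (suc (2 * b)) ≡ 2 * suc b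
  ss b = sym (*-suc 2 b)

-- A new lowest digit is put in front. For successors there are two ways: 1 over 0 with equal rests,
-- or a carry, 0 over 1 with successive rests. Parity excludes equal digits.
stepN-spec : ∀ b b' {t t' r} → NSpec t t' r → NSpec (digit b + 2 * t) (digit b' + 2 * t') (stepN b b' r)
stepN-spec true true {t} {t'} h = record
  { zero⇒ = λ () ; zero⇐ = λ ()
  ; equal⇒ = λ e → cong (λ n → suc (2 * n)) (equal⇒ h e)
  ; equal⇐ = λ e → equal⇐ h (half t t' (suc-injective e))
  ; succ⇒ = λ () ; succ⇐ = λ e → ⊥-elim (even≢odd t t' (suc-injective e)) }
stepN-spec true false {t} {t'} {r} h = record
  { zero⇒ = λ () ; zero⇐ = λ ()
  ; equal⇒ = λ () ; equal⇐ = λ e → ⊥-elim (even≢odd t' t (sym e))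
  ; succ⇒ = λ e → cong (λ n → suc (2 * n)) (equal⇒ h (trans (sym (∨-identityʳ _)) e))
  ; succ⇐ = λ e → trans (∨-identityʳ _) (equal⇐ h (half t t' (suc-injective e))) }
stepN-spec false true {t} {t'} h = record
  { zero⇒ = λ e → cong (2 *_) (zero⇒ h e)
  ; zero⇐ = λ e → zero⇐ h (half t 0 e)
  ; equal⇒ = λ () ; equal⇐ = λ e → ⊥-elim (even≢odd t t' e)
  ; succ⇒ = λ e → trans (cong (2 *_) (succ⇒ h e)) (sym (ss t'))
  ; succ⇐ = λ e → succ⇐ h (half t (suc t') (trans e (ss t'))) }
stepN-spec false false {t} {t'} h = record
  { zero⇒ = λ e → cong (2 *_) (zero⇒ h e)
  ; zero⇐ = λ e → zero⇐ h (half t 0 e)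
  ; equal⇒ = λ e → cong (2 *_) (equal⇒ h e)
  ; equal⇐ = λ e → equal⇐ h (half t t' e)
  ; succ⇒ = λ () ; succ⇐ = λ e → ⊥-elim (even≢odd t t' e) }

numSum : ∀ {A : Set} → (A → Bool) → (A → Bool) → Str A → NSum
numSum g g' = strFold (λ a → stepN (g a) (g' a) initN) (λ a → stepN (g a) (g' a))

initN-spec : NSpec 0 0 initN
initN-spec = record { zero⇒ = λ _ → refl ; zero⇐ = λ _ → refl ; equal⇒ = λ _ → refl ; equal⇐ = λ _ → refl
  ; succ⇒ = λ () ; succ⇐ = λ () }

numSum-spec : ∀ {A : Set} (g g' : A → Bool) s → NSpec (val g s) (val g' s) (numSum g g' s)
numSum-spec g g' (one a) = stepN-spec (g a) (g' a) initN-spec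
numSum-spec g g' (a ⟫ s) = stepN-spec (g a) (g' a) (numSum-spec g g' s)

NumVal : Bool → ℕ → ℕ → Set
NumVal true t t' = t ≡ suc t'
NumVal false t t' = t ≡ 0

numVal : ∀ h {t t' r} → NSpec t t' r → numOk h r ≡ true → NumVal h t t'
numVal true s e = succ⇒ s e
numVal false s e = zero⇒ s e

odd : ℕ → Bool
odd zero = false
odd (suc n) = not (odd n)

bitAt : ℕ → ℕ → Bool
bitAt zero t = odd t
bitAt (suc i) t = bitAt i ⌊ t /2⌋

odd-half : ∀ t → digit (odd t) + 2 * ⌊ t /2⌋ ≡ t
odd-half zero = refl
odd-half (suc zero) = refl
odd-half (suc (suc t)) rewrite not-involutive (odd t) =
  trans (arith (digit (odd t)) ⌊ t /2⌋) (cong (2 +_) (odd-half t))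
  where
  arith : ∀ d h → d + 2 * suc h ≡ suc (suc (d + 2 * h))
  arith = solve-∀

half-< : ∀ t m → t < 2 * m → ⌊ t /2⌋ < m
half-< t m t< = *-cancelˡ-< 2 ⌊ t /2⌋ m (≤-<-trans (≤-trans (m≤n+m _ (digit (odd t))) (≤-reflexive (odd-half t))) t<)

val-bits : ∀ {A : Set} (g : A → Bool) (f : ℕ → A) m t → (∀ i → g (f i) ≡ bitAt i t) → t < 2 ^ suc m →
  val g (mkS f m) ≡ t
val-bits g f zero t e t< rewrite e 0 with t | t<
... | zero | _ = refl
... | suc zero | _ = refl
... | suc (suc _) | s≤s (s≤s ())
val-bits g f (suc m) t e t< rewrite e 0 =
  trans (cong (λ v → digit (odd t) + 2 * v) (val-bits g (f ∘ suc) m ⌊ t /2⌋ (λ i → e (suc i)) (half-< t _ t<))) (odd-half t)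

-- After a blank only blanks follow, and the string ends with one. So once the letters have been
-- read up to the first blank, the rest of the string is known.
InputOk : Str DLab → Set
InputOk s = (∀ i → i < lenP s → vn (nth s i) ≡ vs (nth s (suc i))) × vn (nth s (lenP s)) ≡ nothing ×
  (∀ i → i ≤ lenP s → vs (nth s i) ≡ nothing → vn (nth s i) ≡ nothing)

inputSum : Str DLab → Sy × Bool
inputSum = strFold (λ d → next d (nothing , true)) next
  where
  next : DLab → Sy × Bool → Sy × Bool
  next d (v , k) = vs d , ((vn d == v) ∧ (isNode (vs d) ∨ not (isNode (vn d))) ∧ k)

inputSum-head : ∀ s → proj₁ (inputSum s) ≡ vs (headS s)
inputSum-head (one _) = refl
inputSum-head (_ ⟫ _) = refl

private
  blank⇒ : (v v' : Sy) → (isNode v ∨ not (isNode v')) ≡ true → v ≡ nothing → v' ≡ nothing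
  blank⇒ nothing nothing _ _ = refl
  blank⇐ : (v v' : Sy) → (v ≡ nothing → v' ≡ nothing) → (isNode v ∨ not (isNode v')) ≡ true
  blank⇐ (just _) v' h = refl
  blank⇐ nothing v' h rewrite h refl = refl

inputSum-sound : ∀ s → proj₂ (inputSum s) ≡ true → InputOk s
inputSum-sound (one d) e with ∧-true {vn d == nothing} e
... | e₁ , e₂ with ∧-true {isNode (vs d) ∨ not (isNode (vn d))} e₂
... | e₃ , _ = (λ _ ()) , ==-sound _ _ e₁ , λ _ _ → blank⇒ (vs d) (vn d) e₃
inputSum-sound (d ⟫ s) e with ∧-true {vn d == proj₁ (inputSum s)} e
... | e₁ , e₂ with ∧-true {isNode (vs d) ∨ not (isNode (vn d))} e₂
... | e₃ , e₄ with inputSum-sound s e₄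
... | h₁ , h₂ , h₃ =
  (λ { zero _ → trans (==-sound _ _ e₁) (trans (inputSum-head s) (cong vs (sym (nth-zero s)))) ; (suc i) (s≤s i<) → h₁ i i< }) ,
  h₂ , λ { zero _ → blank⇒ (vs d) (vn d) e₃ ; (suc i) (s≤s i≤) → h₃ i i≤ }

inputSum-complete : ∀ s → InputOk s → proj₂ (inputSum s) ≡ true
inputSum-complete (one d) (_ , h₂ , h₃) = ∧-intro (==-complete h₂) (∧-intro (blank⇐ (vs d) (vn d) (h₃ 0 z≤n)) refl)
inputSum-complete (d ⟫ s) (h₁ , h₂ , h₃) =
  ∧-intro (==-complete (trans (h₁ 0 (s≤s z≤n)) (trans (cong vs (nth-zero s)) (sym (inputSum-head s)))))
  (∧-intro (blank⇐ (vs d) (vn d) (h₃ 0 z≤n))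
    (inputSum-complete s ((λ i i< → h₁ (suc i) (s≤s i<)) , h₂ , λ i i≤ → h₃ (suc i) (s≤s i≤))))

-- Node checks along the rotation of a proof tree

vw : ℕ → PT → HView
vw k nil = nothing
vw k (node p a A D l b) = just (p , at A k , at D k)

HOk : HeadOk → ℕ → PT → Set
HOk c k nil = ⊤
HOk c k (node p a A D l b) = c p a (at A k) (at D k) (vw k l) (vw k b) ≡ true × HOk c k l × HOk c k b

iterP-nil : ∀ k → iter rotP k nil ≡ nil
iterP-nil zero = refl
iterP-nil (suc k) = iterP-nil k

iterP-node : ∀ k p a A D l b → iter rotP k (node p a A D l b) ≡
  node p a (iter rotS k A) (iter rotS k D) (iter rotP k l) (iter rotP k b)
iterP-node zero p a A D l b = refl
iterP-node (suc k) p a A D l b = iterP-node k p a (rotS A) (rotS D) (rotP l) (rotP b)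

iter-rot-embed : ∀ k P → iter rot k (embed P) ≡ embed (iter rotP k P)
iter-rot-embed zero P = refl
iter-rot-embed (suc k) P = trans (cong (iter rot k) (rot-embed P)) (iter-rot-embed k (rotP P))

view-iter : ∀ c k P → view (headCheck c) (iter rotP k P) ≡ vw k P
view-iter c k nil rewrite iterP-nil k = refl
view-iter c k (node p a A D l b) rewrite iterP-node k p a A D l b
  | strFold-head (iter rotS k A) | strFold-head (iter rotS k D) = refl

AllN⇒HOk : ∀ c k P → AllN (headCheck c) (iter rotP k P) → HOk c k P
AllN⇒HOk c k nil _ = tt
AllN⇒HOk c k (node p a A D l b) h rewrite iterP-node k p a A D l b
  | strFold-head (iter rotS k A) | strFold-head (iter rotS k D) | view-iter c k l | view-iter c k b =
  proj₁ h , AllN⇒HOk c k l (proj₁ (proj₂ h)) , AllN⇒HOk c k b (proj₂ (proj₂ h))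

HOk⇒AllN : ∀ c k P → HOk c k P → AllN (headCheck c) (iter rotP k P)
HOk⇒AllN c k nil _ rewrite iterP-nil k = tt
HOk⇒AllN c k (node p a A D l b) (h , hl , hb) rewrite iterP-node k p a A D l b
  | strFold-head (iter rotS k A) | strFold-head (iter rotS k D) | view-iter c k l | view-iter c k b =
  h , HOk⇒AllN c k l hl , HOk⇒AllN c k b hb

-- Rotating the encoding amounts to rotating all strings of P, and `embed-injective` identifies the
-- parsed tree with this rotated proof tree.
accept⇒ : ∀ c fin k P → Accept (headCheck c) fin (iter rot k (embed P)) → HOk c k P × fin (vw k P) ≡ true
accept⇒ c fin k P h with accept-parse (headCheck c) fin _ h
... | P' , e , all , f with embed-injective (iter rotP k P) P' (trans (sym (iter-rot-embed k P)) e)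
... | refl = AllN⇒HOk c k P all , trans (cong fin (sym (view-iter c k P))) f

accept⇐ : ∀ c fin k P → HOk c k P → fin (vw k P) ≡ true → Accept (headCheck c) fin (iter rot k (embed P))
accept⇐ c fin k P h f = subst (Accept (headCheck c) fin) (sym (iter-rot-embed k P))
  (accept-embed (headCheck c) fin (iter rotP k P) (HOk⇒AllN c k P h) (trans (cong fin (view-iter c k P)) f))

-- The static check as a conjunction of conditions

private
  sumA : Str ALab → ASum
  sumA = strFold (bA startCheck) (sA startCheck)

  sumD : Str DLab → DSum
  sumD = strFold (bD startCheck) (sD startCheck)

  allOk : Sy → Bool → Bool → Bool × Bool → Bool → Bool × Bool → Sy × Bool → Sy → NSum → NSum → Bool
  allOk a hl hb fA mA fD iD v⁺ rt rj =
    (proj₁ fA ∧ proj₂ fA ∧ mA) ∧ (proj₁ fD ∧ proj₂ fD ∧ proj₂ iD) ∧ (v⁺ == a) ∧ numOk hb rt ∧ numOk hl rj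

  allOk-cong : ∀ {a hl hb fA fA' mA mA' fD fD' iD iD' v⁺ w⁺ rt rt' rj rj'} → fA ≡ fA' → mA ≡ mA' → fD ≡ fD' →
    iD ≡ iD' → v⁺ ≡ w⁺ → rt ≡ rt' → rj ≡ rj' →
    allOk a hl hb fA mA fD iD v⁺ rt rj ≡ allOk a hl hb fA' mA' fD' iD' w⁺ rt' rj'
  allOk-cong refl refl refl refl refl refl refl = refl

startSum : ∀ {X : Set} → Sy → Str ALab → Str DLab → Maybe X → Maybe X → Bool
startSum a A D l b = allOk a (isNode l) (isNode b) (firstSum afirst A) (anyMark A)
  (firstSum dfirst D) (inputSum D) (vn (headS D)) (numSum tb tp D) (numSum jb jp D)

-- The summaries of the static check are tuples. Their components, or small groups of them, evolve
-- independently of the others and are thus folds in their own right.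
startOk-sum : ∀ p a A D l b → startOk p a (sumA A) (sumD D) l b ≡ startSum a A D l b
startOk-sum p a A D l b = allOk-cong {a} {isNode l} {isNode b}
  (strFold-hom (λ (q : ASum) → proj₁ q , proj₁ (proj₂ q)) (λ _ → refl) (λ _ _ → refl) A)
  (strFold-hom (λ (q : ASum) → proj₂ (proj₂ q)) (λ _ → ∨-identityʳ _) (λ _ _ → refl) A)
  (strFold-hom (λ (q : DSum) → proj₁ q) (λ _ → refl) (λ _ _ → refl) D)
  (strFold-hom (λ (q : DSum) → proj₁ (proj₂ (proj₂ q)) , proj₂ (proj₂ (proj₂ (proj₂ q)))) (λ _ → refl) (λ _ _ → refl) D)
  (next D)
  (strFold-hom (λ (q : DSum) → proj₁ (proj₁ (proj₂ q))) (λ _ → refl) (λ _ _ → refl) D)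
  (strFold-hom (λ (q : DSum) → proj₂ (proj₁ (proj₂ q))) (λ _ → refl) (λ _ _ → refl) D)
  where
  next : ∀ D → proj₁ (proj₂ (proj₂ (proj₂ (sumD D)))) ≡ vn (headS D)
  next (one _) = refl
  next (_ ⟫ _) = refl

record Static (a : Sy) (A : Str ALab) (D : Str DLab) (hl hb : Bool) : Set where
  field
    headA : afirst (headS A) ≡ true
    tailA : ∀ i → i < lenP A → afirst (nth A (suc i)) ≡ false
    markA : anyMark A ≡ true
    headD : dfirst (headS D) ≡ true
    tailD : ∀ i → i < lenP D → dfirst (nth D (suc i)) ≡ false
    input : InputOk D
    sym≡  : vn (headS D) ≡ a
    numT  : numOk hb (numSum tb tp D) ≡ true
    numJ  : numOk hl (numSum jb jp D) ≡ true

startOk⇒ : ∀ {p a A D l b} → startOk p a (sumA A) (sumD D) l b ≡ true → Static a A D (isNode l) (isNode b)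
startOk⇒ {p} {a} {A} {D} {l} {b} h
  with ∧-true {proj₁ (firstSum afirst A) ∧ proj₂ (firstSum afirst A) ∧ anyMark A} (trans (sym (startOk-sum p a A D l b)) h)
... | h₁ , h₂ with ∧-true {proj₁ (firstSum afirst A)} h₁
... | h₃ , h₄ with ∧-true {proj₂ (firstSum afirst A)} h₄
... | h₅ , h₆ with ∧-true {proj₁ (firstSum dfirst D) ∧ proj₂ (firstSum dfirst D) ∧ proj₂ (inputSum D)} h₂
... | h₇ , h₈ with ∧-true {proj₁ (firstSum dfirst D)} h₇
... | h₉ , k₁ with ∧-true {proj₂ (firstSum dfirst D)} k₁
... | k₂ , k₃ with ∧-true {vn (headS D) == a} h₈
... | k₄ , k₅ with ∧-true {numOk (isNode b) (numSum tb tp D)} k₅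
... | k₆ , k₇ = record
  { headA = trans (sym (firstSum-head afirst A)) h₃ ; tailA = firstSum-tail afirst A h₅ ; markA = h₆
  ; headD = trans (sym (firstSum-head dfirst D)) h₉ ; tailD = firstSum-tail dfirst D k₂
  ; input = inputSum-sound D k₃ ; sym≡ = ==-sound _ _ k₄ ; numT = k₆ ; numJ = k₇ }

startOk⇐ : ∀ {p a A D l b} → Static a A D (isNode l) (isNode b) → startOk p a (sumA A) (sumD D) l b ≡ true
startOk⇐ {p} {a} {A} {D} {l} {b} s = trans (startOk-sum p a A D l b)
  (∧-intro (∧-intro (trans (firstSum-head afirst A) headA) (∧-intro (firstSum-intro afirst A tailA) markA))
  (∧-intro (∧-intro (trans (firstSum-head dfirst D) headD) (∧-intro (firstSum-intro dfirst D tailD) (inputSum-complete D input)))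
  (∧-intro (==-complete sym≡) (∧-intro numT numJ))))
  where open Static s

nodeP : PT → Bool
nodeP nil = false
nodeP (node _ _ _ _ _ _) = true

isNode-view : ∀ {QA QD : Set} (κ : Check QA QD) P → isNode (view κ P) ≡ nodeP P
isNode-view κ nil = refl
isNode-view κ (node _ _ _ _ _ _) = refl

isNode-vw : ∀ k P → isNode (vw k P) ≡ nodeP P
isNode-vw k nil = refl
isNode-vw k (node _ _ _ _ _ _) = refl

-- Tilings

xs : List Bool → ℕ → Sy
xs [] _ = nothing
xs (b ∷ x) zero = just b
xs (b ∷ x) (suc i) = xs x i

xs-blank : ∀ x i → length x ≤ i → xs x i ≡ nothing
xs-blank [] i _ = refl
xs-blank (b ∷ x) (suc i) (s≤s h) = xs-blank x i h

xs-next : ∀ x i → xs x i ≡ nothing → xs x (suc i) ≡ nothing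
xs-next [] i _ = refl
xs-next (b ∷ x) (suc i) h = xs-next x i h

-- Letter i is asked for after i + 1 rotations, and the last test asks for the first blank.
wordI : List Bool → List Instr
wordI [] = stp ∷ tst (just (lab nothing)) ∷ []
wordI (b ∷ x) = stp ∷ tst (just (lab (just b))) ∷ wordI x

wordI-sound : ∀ x t → Runs (wordI x) t → ∀ i → i ≤ length x → Holds (just (lab (xs x i))) (iter rot (suc i) t)
wordI-sound [] t (_ , h , _) zero _ = h
wordI-sound (b ∷ x) t (_ , h , hs) zero _ = h
wordI-sound (b ∷ x) t (_ , h , hs) (suc i) (s≤s i≤) = wordI-sound x (rot t) hs i i≤

wordI-complete : ∀ x t → (∀ i → Good (iter rot i t)) →
  (∀ i → i ≤ length x → Holds (just (lab (xs x i))) (iter rot (suc i) t)) → Runs (wordI x) t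
wordI-complete [] t g h = g 0 , h 0 z≤n , tt
wordI-complete (b ∷ x) t g h = g 0 , h 0 z≤n , wordI-complete x (rot t) (λ i → g (suc i)) (λ i i≤ → h (suc i) (s≤s i≤))

allTests : List Test
allTests = map dec (List.allFin (Finite.size (finite-Maybe {HTest})))

∈-allTests : ∀ q → q ∈ allTests
∈-allTests q = subst (_∈ allTests) (dec-enc q) (∈-map⁺ dec (∈-allFin (enc q)))

tests-sound : ∀ f qs is t → Runs (map tst (List.filterᵇ f qs) ++ is) t →
  (∀ {q} → q ∈ qs → f q ≡ true → Holds q t) × Runs is t
tests-sound f [] is t h = (λ ()) , h
tests-sound f (q ∷ qs) is t h with f q in e
tests-sound f (q ∷ qs) is t (h , hs) | true with tests-sound f qs is t hs
... | hq , r = (λ { (here refl) _ → h ; (there m) e' → hq m e' }) , r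
tests-sound f (q ∷ qs) is t h | false with tests-sound f qs is t h
... | hq , r = (λ { (here refl) e' → case trans (sym e) e' of λ () ; (there m) e' → hq m e' }) , r

tests-complete : ∀ f qs is t → (∀ q → f q ≡ true → Holds q t) → Runs is t → Runs (map tst (List.filterᵇ f qs) ++ is) t
tests-complete f [] is t h r = r
tests-complete f (q ∷ qs) is t h r with f q in e
... | true = h q e , tests-complete f qs is t h r
... | false = tests-complete f qs is t h r

must : ∀ {b} → (b ≡ false → ⊥) → b ≡ true
must {true} _ = refl
must {false} h = ⊥-elim (h refl)

not-false : ∀ {b} → b ≡ false → not b ≡ true
not-false refl = refl

-- Tiles are numbers, namely positions in the tile strings. `H` and `V` take the tile of the left or
-- lower neighbour first. `okRow` governs row 0; its Boolean tells whether there is a left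
-- neighbour, and its letter is that of the input.
module Tiling (K : ℕ) (okLeft : ℕ → Bool) (okRow : Bool → Sy → ℕ → Bool) (H V : ℕ → ℕ → Bool) (accT : ℕ → Bool) where

  len⁻ : Bool → ℕ
  len⁻ false = K
  len⁻ true = suc K

  idx : ℕ → Bool → ℕ
  idx k p = k % suc (len⁻ p)

  okT : Bool → Bool → Sy → ℕ → Bool
  okT l b a r = (l ∨ okLeft r) ∧ (b ∨ okRow l a r)

  -- The tests prescribed after k rotations, when position idx k p of the tile
  -- strings of the nodes of parity p is on top.
  need : ℕ → Test → Bool
  need k start = k ≡ᵇ 0
  need k (just endd) = false
  need k (just (lab _)) = false
  need k (just froot) = not (accT (idx k false))
  need k (just (fa p f)) = f == (idx k p ≡ᵇ 0)
  need k (just (forb l b a p)) = not (okT l b a (idx k p))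
  need k (just (fH p)) = not (H (idx k (not p)) (idx k p))
  need k (just (fV p)) = not (V (idx k (not p)) (idx k p))

  progFrom : ℕ → ℕ → List Instr
  progFrom k zero = []
  progFrom k (suc m) = map tst (List.filterᵇ (need k) allTests) ++ stp ∷ progFrom (suc k) m

  progFrom-sound : ∀ k m t → Runs (progFrom k m) t → ∀ i → i < m → ∀ q → need (i + k) q ≡ true → Holds q (iter rot i t)
  progFrom-sound k (suc m) t h i i< q e with tests-sound (need k) allTests (stp ∷ progFrom (suc k) m) t h
  progFrom-sound k (suc m) t h zero i< q e | hq , r = hq (∈-allTests q) e
  progFrom-sound k (suc m) t h (suc i) (s≤s i<) q e | hq , _ , r =
    progFrom-sound (suc k) m (rot t) r i i< q (trans (cong (λ n → need n q) (+-suc i k)) e)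

  progFrom-complete : ∀ k m t → (∀ i → Good (iter rot i t)) →
    (∀ i q → need (i + k) q ≡ true → Holds q (iter rot i t)) → Runs (progFrom k m) t
  progFrom-complete k zero t g h = tt
  progFrom-complete k (suc m) t g h = tests-complete (need k) allTests _ t (h 0)
    (g 0 , progFrom-complete (suc k) m (rot t) (λ i → g (suc i))
      (λ i q e → h (suc i) q (trans (cong (λ n → need n q) (sym (+-suc i k))) e)))

  -- A bound for the k of `meet`: a remainder below K + 2, plus at most (K + 1) + (K + 1) multiples
  -- of K + 2. It depends on the tile set only, so the tests form a fixed text for each machine.
  kMax : ℕ
  kMax = suc (suc K) + (suc K + suc K) * suc (suc K)

  prog : List Instr
  prog = progFrom 0 kMax

  -- The lengths suc K and suc (suc K) of the strings are coprime, so any two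
  -- positions come to the top simultaneously.
  meet : ∀ r r' → r ≤ K → r' ≤ suc K → Σ ℕ λ k → k < kMax × idx k false ≡ r × idx k true ≡ r'
  meet r r' r≤ r'≤ = r' + m * suc (suc K) , bound ,
    trans (cong (_% suc K) arith) (trans ([m+kn]%n≡m%n r (suc m) (suc K)) (m<n⇒m%n≡m (s≤s r≤))) ,
    trans ([m+kn]%n≡m%n r' m (suc (suc K))) (m<n⇒m%n≡m (s≤s r'≤))
    where
    m : ℕ
    -- As K + 2 is 1 modulo K + 1, adding m multiples of it to r' gives r' + m = r + (K + 1) there,
    -- while modulo K + 2 nothing changes.
    m = r + (suc K ∸ r')
    shuffle : ∀ r r' d k m → r' + d ≡ k → r + d ≡ m → r' + m * suc k ≡ r + suc m * k
    shuffle r r' d k m refl refl = identity r r' d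
      where
      identity : ∀ r r' d → r' + (r + d) * suc (r' + d) ≡ r + suc (r + d) * (r' + d)
      identity = solve-∀
    arith : r' + m * suc (suc K) ≡ r + suc m * suc K
    arith = shuffle r r' (suc K ∸ r') (suc K) m (m+[n∸m]≡n r'≤) refl
    bound : r' + m * suc (suc K) < kMax
    bound = +-mono-≤ (s≤s r'≤) (*-monoˡ-≤ (suc (suc K)) (+-mono-≤ (m≤n⇒m≤1+n r≤) (m∸n≤m (suc K) r')))

  meet' : ∀ p r r' → r ≤ len⁻ p → r' ≤ len⁻ (not p) → Σ ℕ λ k → k < kMax × idx k p ≡ r × idx k (not p) ≡ r'
  meet' false r r' h h' = meet r r' h h'
  meet' true r r' h h' with meet r' r h' h
  ... | k , k< , e , e' = k , k< , e' , e

  len⁻≤ : ∀ p → len⁻ p ≤ suc K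
  len⁻≤ false = n≤1+n K
  len⁻≤ true = ≤-refl

  small : ∀ {k} → k ≤ suc (suc K) → k < kMax
  small {k} h = ≤-<-trans h (≤-<-trans (≤-reflexive (sym (+-identityʳ (suc (suc K))))) (+-monoʳ-< (suc (suc K)) (s≤s z≤n)))

  -- B is K + 1 for soundness, as strings of parity `true` have one position more, but K for
  -- completeness, where a tile must fit into the strings of both parities.
  data Der (x : List Bool) (B : ℕ) : ℕ → ℕ → ℕ → Set where
    inner : ∀ {t j r r₁ r₂} → r ≤ B → Der x B (suc t) j r₁ → Der x B t (suc j) r₂ → H r₁ r ≡ true → V r₂ r ≡ true →
      Der x B (suc t) (suc j) r
    edge  : ∀ {t r r₂} → r ≤ B → Der x B t 0 r₂ → V r₂ r ≡ true → okLeft r ≡ true → Der x B (suc t) 0 r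
    row   : ∀ {j r r₁} → r ≤ B → Der x B 0 j r₁ → H r₁ r ≡ true → okRow true (xs x (suc j)) r ≡ true →
      Der x B 0 (suc j) r
    base  : ∀ {r} → r ≤ B → okLeft r ≡ true → okRow false (xs x 0) r ≡ true → Der x B 0 0 r

  at-cell : ∀ {x B t t' j j' r} → t ≡ t' → j ≡ j' → Der x B t j r → Der x B t' j' r
  at-cell refl refl d = d

  -- Soundness

  record Facts (x : List Bool) (N : ℕ) (P : PT) : Set where
    field
      stat  : AllN startCheck P
      good  : ∀ k → k < N → HOk goodOk k P
      ended : HOk (testOk endd) N P
      tests : ∀ k → k < kMax → ∀ q → need k (just q) ≡ true → HOk (testOk q) k P
      labs  : ∀ i → i ≤ length x → HOk (testOk (lab (xs x i))) (suc i) P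

  facts-left : ∀ {x N p a A D l b} → Facts x N (node p a A D l b) → Facts x N l
  facts-left f = record
    { stat = proj₁ (proj₂ stat) ; good = λ k h → proj₁ (proj₂ (good k h)) ; ended = proj₁ (proj₂ ended)
    ; tests = λ k h q e → proj₁ (proj₂ (tests k h q e)) ; labs = λ i h → proj₁ (proj₂ (labs i h)) }
    where open Facts f

  facts-below : ∀ {x N p a A D l b} → Facts x N (node p a A D l b) → Facts x N b
  facts-below f = record
    { stat = proj₂ (proj₂ stat) ; good = λ k h → proj₂ (proj₂ (good k h)) ; ended = proj₂ (proj₂ ended)
    ; tests = λ k h q e → proj₂ (proj₂ (tests k h q e)) ; labs = λ i h → proj₂ (proj₂ (labs i h)) }
    where open Facts f

  module Node {x : List Bool} {N⁻ : ℕ} {p a A D l b} (f : Facts x (suc N⁻) (node p a A D l b)) where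
    open Facts f

    static : Static a A D (nodeP l) (nodeP b)
    static = subst₂ (Static a A D) (isNode-view startCheck l) (isNode-view startCheck b) (startOk⇒ {p = p} (proj₁ stat))
    open Static static public

    zeroD : dfirst (nth D 0) ≡ true
    zeroD = trans (cong dfirst (nth-zero D)) headD

    -- In a longer string the letter on top after suc N⁻ rotations would be a later one than the
    -- first, against `endd`.
    lenD : lenP D ≤ N⁻
    lenD = ≮⇒≥ λ N⁻< → case trans (sym (trans (cong dfirst (at-nth-< D (suc N⁻) N⁻<)) (tailD N⁻ N⁻<))) (proj₁ ended) of λ ()

    firstA : ∀ k → k < kMax → afirst (at A k) ≡ (idx k p ≡ᵇ 0)
    firstA k k< with tests k k< (fa p (idx k p ≡ᵇ 0)) (==-refl (idx k p ≡ᵇ 0))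
    ... | h , _ rewrite ==-refl p = ==-sound _ _ h

    -- The flag of the first letter comes back after exactly one turn of the string. In a string of
    -- the wrong length it does so too early or too late for the prescribed `fa` tests.
    lenA : lenP A ≡ len⁻ p
    lenA with <-cmp (lenP A) (len⁻ p)
    ... | tri≈ _ e _ = e
    ... | tri< h _ _ = ⊥-elim (case trans (sym (trans (cong afirst (trans (at-lenP A) (nth-zero A))) headA))
            (trans (firstA (suc (lenP A)) (small (≤-trans h (m≤n⇒m≤1+n (len⁻≤ p)))))
              (cong (_≡ᵇ 0) (m<n⇒m%n≡m (s≤s h)))) of λ ())
    ... | tri> _ _ h = ⊥-elim (case trans (sym (trans (cong afirst (at-nth-< A (suc (len⁻ p)) h)) (tailA (len⁻ p) h)))
            (trans (firstA (suc (len⁻ p)) (small (s≤s (len⁻≤ p)))) (cong (_≡ᵇ 0) (n%n≡0 (suc (len⁻ p))))) of λ ())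

    at-A : ∀ k → at A k ≡ nth A (idx k p)
    at-A k = trans (at-nth A k) (cong (λ m → nth A (k % suc m)) lenA)

    tile-ok : ∀ r → r ≤ lenP A → mark (nth A r) ≡ true → okT (nodeP l) (nodeP b) a r ≡ true
    tile-ok r r≤ m = must λ e →
      let i = m<n⇒m%n≡m (s≤s (subst (r ≤_) lenA r≤))
          h = proj₁ (tests r (small (≤-trans (subst (r ≤_) lenA r≤) (m≤n⇒m≤1+n (len⁻≤ p)))) (forb (nodeP l) (nodeP b) a p)
                (not-false (trans (cong (okT (nodeP l) (nodeP b) a) i) e)))
          c = ∧-intro (==-refl p) (∧-intro (==-refl a) (∧-intro (==-complete (isNode-vw r l)) (∧-intro (==-complete (isNode-vw r b))
                (trans (cong mark (trans (at-A r) (cong (nth A) i))) m))))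
      in case trans (sym h) (cong not c) of λ ()

    rowOf : NumVal (nodeP b) (val tb D) (val tp D)
    rowOf = numVal (nodeP b) (numSum-spec tb tp D) numT

    colOf : NumVal (nodeP l) (val jb D) (val jp D)
    colOf = numVal (nodeP l) (numSum-spec jb jp D) numJ

  -- If the lengths differed, the shorter string would complete its turn within the m rotations
  -- under observation and show its flag when the longer one does not.
  same-length : ∀ {m} (D D' : Str DLab) → dfirst (nth D 0) ≡ true → dfirst (nth D' 0) ≡ true →
    (∀ i → i < lenP D → dfirst (nth D (suc i)) ≡ false) → (∀ i → i < lenP D' → dfirst (nth D' (suc i)) ≡ false) →
    lenP D ≤ m → lenP D' ≤ m → (∀ k → k ≤ m → dfirst (at D' k) ≡ dfirst (at D k)) → lenP D' ≡ lenP D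
  same-length D D' z z' t t' h h' e with <-cmp (lenP D') (lenP D)
  ... | tri≈ _ q _ = q
  ... | tri< q _ _ = ⊥-elim (case trans (sym (trans (cong dfirst (at-lenP D')) z'))
          (trans (e (suc (lenP D')) (≤-trans q h)) (trans (cong dfirst (at-nth-< D (suc (lenP D')) q)) (t (lenP D') q))) of λ ())
  ... | tri> _ _ q = ⊥-elim (case trans (sym (trans (cong dfirst (at-lenP D)) z))
          (trans (sym (e (suc (lenP D)) (≤-trans q h'))) (trans (cong dfirst (at-nth-< D' (suc (lenP D)) q)) (t' (lenP D) q))) of λ ())

  -- The second part carries the input along row 0: the static check ties the letter a of a node to
  -- its own string, and here this string is tied to x.
  Claim : List Bool → PT → Set
  Claim x nil = ⊤
  Claim x (node p a A D l b) =
    (∀ r → r ≤ lenP A → mark (nth A r) ≡ true → Der x (suc K) (val tb D) (val jb D) r) ×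
    (val tb D ≡ 0 → length x < lenP D × (∀ i → i < lenP D → vs (nth D (suc i)) ≡ xs x (val jb D + i)))

  module Kid {x : List Bool} {N⁻ : ℕ} {p a A D l b p' a' A' D' l' b'}
    (f : Facts x (suc N⁻) (node p a A D l b)) (f' : Facts x (suc N⁻) (node p' a' A' D' l' b'))
    (parity : p' ≡ not p) (first : ∀ k → k ≤ N⁻ → dfirst (at D' k) ≡ dfirst (at D k)) where
    private
      module P = Node f
      module Q = Node f'

    length≡ : lenP D' ≡ lenP D
    length≡ = same-length D D' P.zeroD Q.zeroD P.tailD Q.tailD P.lenD Q.lenD first

    pos : ∀ {B : Set} (g h : DLab → B) → (∀ k → k ≤ N⁻ → g (at D' k) ≡ h (at D k)) →
      ∀ i → i ≤ lenP D' → g (nth D' i) ≡ h (nth D i)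
    pos g h e i i≤ = trans (cong g (sym (at-nth-< D' i i≤)))
      (trans (e i (≤-trans i≤ Q.lenD)) (cong h (at-nth-< D i (subst (i ≤_) length≡ i≤))))

    val≡ : ∀ g h → (∀ k → k ≤ N⁻ → g (at D' k) ≡ h (at D k)) → val g D' ≡ val h D
    val≡ g h e = val-cong g h D' D length≡ (pos g h e)

    -- At the rotation given by `meet'`, r and r' are on top together. Were they incompatible, a
    -- test forbidding both marks would have been prescribed just then.
    tiles : (R : ℕ → ℕ → Bool) →
      (∀ k → k < kMax → not (R (idx k (not p)) (idx k p)) ≡ true → not ((p == p) ∧ mark (at A k) ∧ mark (at A' k)) ≡ true) →
      ∀ r r' → r ≤ lenP A → r' ≤ lenP A' → mark (nth A r) ≡ true → mark (nth A' r') ≡ true → R r' r ≡ true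
    tiles R test r r' h h' m m' with meet' p r r' (subst (r ≤_) P.lenA h) (subst (r' ≤_) (trans Q.lenA (cong len⁻ parity)) h')
    ... | k , k< , i , i' = must λ e →
      let c = ∧-intro (==-refl p) (∧-intro (trans (cong mark (trans (P.at-A k) (cong (nth A) i))) m)
                (trans (cong mark (trans (Q.at-A k) (cong (nth A') (trans (cong (idx k) parity) i')))) m'))
      in case trans (sym (test k k< (not-false (trans (cong₂ R i' i) e)))) (cong not c) of λ ()

  module Left {x : List Bool} {N⁻ : ℕ} {p a A D p' a' A' D' l' b' b}
    (f : Facts x (suc N⁻) (node p a A D (node p' a' A' D' l' b') b)) where
    open Facts f

    eqs : ∀ k → k ≤ N⁻ → p' ≡ not p × dfirst (at D' k) ≡ dfirst (at D k) × tb (at D' k) ≡ tb (at D k) ×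
      jb (at D' k) ≡ jp (at D k) × vs (at D k) ≡ vn (at D' k)
    eqs k k≤ with ∧-true {goodLeft p (at D k) (just (p' , at A' k , at D' k))} (proj₁ (good k (s≤s k≤)))
    ... | h , _ with ∧-true {p' == not p} h
    ... | e₁ , h₁ with ∧-true {dfirst (at D' k) == dfirst (at D k)} h₁
    ... | e₂ , h₂ with ∧-true {tb (at D' k) == tb (at D k)} h₂
    ... | e₃ , h₃ with ∧-true {jb (at D' k) == jp (at D k)} h₃
    ... | e₄ , e₅ = ==-sound _ _ e₁ , ==-sound _ _ e₂ , ==-sound _ _ e₃ , ==-sound _ _ e₄ , ==-sound _ _ e₅

    open Kid f (facts-left f) (proj₁ (eqs 0 z≤n)) (λ k k≤ → proj₁ (proj₂ (eqs k k≤))) public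

    valT : val tb D' ≡ val tb D
    valT = val≡ tb tb λ k k≤ → proj₁ (proj₂ (proj₂ (eqs k k≤)))

    valJ : val jb D' ≡ val jp D
    valJ = val≡ jb jp λ k k≤ → proj₁ (proj₂ (proj₂ (proj₂ (eqs k k≤))))

    shifted : ∀ i → i ≤ lenP D' → vn (nth D' i) ≡ vs (nth D i)
    shifted = pos vn vs λ k k≤ → sym (proj₂ (proj₂ (proj₂ (proj₂ (eqs k k≤)))))

    compatible : ∀ r r' → r ≤ lenP A → r' ≤ lenP A' → mark (nth A r) ≡ true → mark (nth A' r') ≡ true → H r' r ≡ true
    compatible = tiles H λ k k< e → proj₁ (tests k k< (fH p) e)

  module Below {x : List Bool} {N⁻ : ℕ} {p a A D p' a' A' D' l' b' l}
    (f : Facts x (suc N⁻) (node p a A D l (node p' a' A' D' l' b'))) where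
    open Facts f

    eqs : ∀ k → k ≤ N⁻ → p' ≡ not p × dfirst (at D' k) ≡ dfirst (at D k) × tb (at D' k) ≡ tp (at D k) ×
      jb (at D' k) ≡ jb (at D k)
    eqs k k≤ with ∧-true {goodLeft p (at D k) (vw k l)} (proj₁ (good k (s≤s k≤)))
    ... | _ , h with ∧-true {p' == not p} h
    ... | e₁ , h₁ with ∧-true {dfirst (at D' k) == dfirst (at D k)} h₁
    ... | e₂ , h₂ with ∧-true {tb (at D' k) == tp (at D k)} h₂
    ... | e₃ , e₄ = ==-sound _ _ e₁ , ==-sound _ _ e₂ , ==-sound _ _ e₃ , ==-sound _ _ e₄

    open Kid f (facts-below f) (proj₁ (eqs 0 z≤n)) (λ k k≤ → proj₁ (proj₂ (eqs k k≤))) public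

    valT : val tb D' ≡ val tp D
    valT = val≡ tb tp λ k k≤ → proj₁ (proj₂ (proj₂ (eqs k k≤)))

    valJ : val jb D' ≡ val jb D
    valJ = val≡ jb jb λ k k≤ → proj₂ (proj₂ (proj₂ (eqs k k≤)))

    compatible : ∀ r r' → r ≤ lenP A → r' ≤ lenP A' → mark (nth A r) ≡ true → mark (nth A' r') ≡ true → V r' r ≡ true
    compatible = tiles V λ k k< e → proj₁ (tests k k< (fV p) e)

  sound : ∀ {x N⁻} P → Facts x (suc N⁻) P → Claim x P
  sound nil f = tt
  sound {x} {N⁻} (node p a A D nil nil) f = derivation , λ _ → long , λ i i< →
    trans (letter i i<) (cong (λ j → xs x (j + i)) (sym P.colOf))
    where
    module P = Node f
    open Facts f
    labelled : ∀ i → i ≤ length x → vs (at D (suc i)) ≡ xs x i × dfirst (at D (suc i)) ≡ false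
    labelled i i≤ with ∧-true {vs (at D (suc i)) == xs x i} (proj₁ (labs i i≤))
    ... | e , e' = ==-sound _ _ e , not-true e'
    -- The `lab` tests also demand that the letters they read are not the first of the string, so no
    -- wrap-around occurs while x is read.
    long : length x < lenP D
    long = ≰⇒> λ h → case trans (sym (proj₂ (labelled (lenP D) h))) (trans (cong dfirst (at-lenP D)) P.zeroD) of λ ()
    letter : ∀ i → i < lenP D → vs (nth D (suc i)) ≡ xs x i
    letter i i< with i ≤? length x
    ... | yes i≤ = trans (cong vs (sym (at-nth-< D (suc i) i<))) (proj₁ (labelled i i≤))
    letter zero i< | no i≰ = ⊥-elim (i≰ z≤n)
    -- Beyond the tested letters the blank propagates.
    letter (suc i) i< | no i≰ = trans (sym (proj₁ P.input (suc i) i<))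
      (trans (proj₂ (proj₂ P.input) (suc i) (<⇒≤ i<) (trans (letter i (<⇒≤ i<)) (xs-blank x i (s≤s⁻¹ (≰⇒> i≰)))))
        (sym (xs-blank x (suc i) (<⇒≤ (≰⇒> i≰)))))
    a≡ : a ≡ xs x 0
    a≡ = trans (sym P.sym≡) (trans (cong vn (sym (nth-zero D)))
      (trans (proj₁ P.input 0 (≤-trans (s≤s z≤n) long)) (letter 0 (≤-trans (s≤s z≤n) long))))
    derivation : ∀ r → r ≤ lenP A → mark (nth A r) ≡ true → Der x (suc K) (val tb D) (val jb D) r
    derivation r r≤ m with ∧-true {okLeft r} (P.tile-ok r r≤ m)
    ... | o , o' = at-cell (sym P.rowOf) (sym P.colOf)
      (base (≤-trans (subst (r ≤_) P.lenA r≤) (len⁻≤ p)) o (subst (λ a → okRow false a r ≡ true) a≡ o'))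
  sound {x} {N⁻} (node p a A D l@(node p' a' A' D' _ _) nil) f with sound l (facts-left f)
  ... | der , inp = derivation , λ _ → long , letter
    where
    module P = Node f
    module Q = Node (facts-left f)
    module L = Left f
    t≡0 : val tb D' ≡ 0
    t≡0 = trans L.valT P.rowOf
    long : length x < lenP D
    long = subst (length x <_) L.length≡ (proj₁ (inp t≡0))
    letter : ∀ i → i < lenP D → vs (nth D (suc i)) ≡ xs x (val jb D + i)
    letter i i< with m≤n⇒m<n∨m≡n (subst (i <_) (sym L.length≡) i<)
    ... | inj₁ i<' = trans (sym (L.shifted (suc i) (<⇒≤ i<'))) (trans (proj₁ Q.input (suc i) i<')
      (trans (proj₂ (inp t≡0) (suc i) i<') (cong (xs x) (trans (+-suc (val jb D') i)
        (cong (_+ i) (trans (cong suc L.valJ) (sym P.colOf)))))))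
    -- The last letter is the one after the end of the child's string, which is blank. So is x
    -- there, because the string is longer than x.
    ... | inj₂ e = trans (sym (L.shifted (suc i) (≤-reflexive e))) (trans (cong (λ k → vn (nth D' k)) e)
      (trans (proj₁ (proj₂ Q.input)) (sym (xs-blank x (val jb D + i)
        (≤-trans (s≤s⁻¹ (subst (length x <_) (trans (sym L.length≡) (sym e)) long)) (m≤n+m i (val jb D)))))))
    a≡ : a ≡ xs x (suc (val jp D))
    a≡ = trans (sym P.sym≡) (trans (cong vn (sym (nth-zero D)))
      (trans (proj₁ P.input 0 (≤-trans (s≤s z≤n) long)) (trans (letter 0 (≤-trans (s≤s z≤n) long))
        (cong (xs x) (trans (+-identityʳ _) P.colOf)))))
    derivation : ∀ r → r ≤ lenP A → mark (nth A r) ≡ true → Der x (suc K) (val tb D) (val jb D) r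
    derivation r r≤ m with anyMark-sound A' Q.markA
    ... | r₁ , r₁≤ , m₁ = at-cell (sym P.rowOf) (sym P.colOf)
      (row (≤-trans (subst (r ≤_) P.lenA r≤) (len⁻≤ p)) (at-cell t≡0 L.valJ (der r₁ r₁≤ m₁))
        (L.compatible r r₁ r≤ r₁≤ m m₁) (subst (λ a → okRow true a r ≡ true) a≡ (P.tile-ok r r≤ m)))
  sound {x} {N⁻} (node p a A D nil b@(node p' a' A' D' _ _)) f with sound b (facts-below f)
  ... | der , _ = derivation , λ e → case trans (sym e) P.rowOf of λ ()
    where
    module P = Node f
    module Q = Node (facts-below f)
    module L = Below f
    derivation : ∀ r → r ≤ lenP A → mark (nth A r) ≡ true → Der x (suc K) (val tb D) (val jb D) r
    derivation r r≤ m with anyMark-sound A' Q.markA | ∧-true {okLeft r} (P.tile-ok r r≤ m)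
    ... | r₁ , r₁≤ , m₁ | o , _ = at-cell (sym P.rowOf) (sym P.colOf)
      (edge (≤-trans (subst (r ≤_) P.lenA r≤) (len⁻≤ p))
        (at-cell L.valT (trans L.valJ P.colOf) (der r₁ r₁≤ m₁))
        (L.compatible r r₁ r≤ r₁≤ m m₁) o)
  sound {x} {N⁻} (node p a A D l@(node p' a' A' D' _ _) b@(node p'' a'' A'' D'' _ _)) f
    with sound l (facts-left f) | sound b (facts-below f)
  ... | der , _ | der' , _ = derivation , λ e → case trans (sym e) P.rowOf of λ ()
    where
    module P = Node f
    module Q = Node (facts-left f)
    module Q' = Node (facts-below f)
    module L = Left f
    module L' = Below f
    derivation : ∀ r → r ≤ lenP A → mark (nth A r) ≡ true → Der x (suc K) (val tb D) (val jb D) r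
    derivation r r≤ m with anyMark-sound A' Q.markA | anyMark-sound A'' Q'.markA
    ... | r₁ , r₁≤ , m₁ | r₂ , r₂≤ , m₂ =
      at-cell (sym P.rowOf) (sym P.colOf)
        (inner (≤-trans (subst (r ≤_) P.lenA r≤) (len⁻≤ p))
          (at-cell (trans L.valT P.rowOf) L.valJ (der r₁ r₁≤ m₁))
          (at-cell L'.valT (trans L'.valJ P.colOf) (der' r₂ r₂≤ m₂))
          (L.compatible r r₁ r≤ r₁≤ m m₁) (L'.compatible r r₂ r≤ r₂≤ m m₂))

  Accepted : List Bool → Set
  Accepted x = Σ ℕ λ t → Σ ℕ λ j → Σ ℕ λ r → accT r ≡ true × Der x (suc K) t j r

  private
    kMax>0 : 0 < kMax
    kMax>0 = s≤s z≤n

    fromWitness : ∀ {x k N⁻ t} → 2 ^ k ≡ suc N⁻ → Witness prog (wordI x) k t → Accepted x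
    fromWitness {x} {k} {N⁻} {t} e w with accept-parse startCheck startFin t (progFrom-sound 0 kMax t (Witness.runs₁ w) 0 kMax>0 start refl)
    -- `startFin` excludes `nil` and fixes the parity of the root, on which `need` relies for
    -- `froot`.
    ... | P@(node false a A D l b) , refl , stat , refl = val tb D , val jb D , r , accepting , proj₁ (sound P f) r r≤ m
      where
      holds : ∀ k → k < kMax → ∀ q → need k (just q) ≡ true → Holds (just q) (iter rot k (embed P))
      holds k k< q e = progFrom-sound 0 kMax (embed P) (Witness.runs₁ w) k k< (just q) (trans (cong (λ n → need n (just q)) (+-identityʳ k)) e)
      f : Facts x (suc N⁻) P
      f = record
        { stat = stat
        ; good = λ i i< → proj₁ (accept⇒ goodOk (λ _ → true) i P (Witness.good w i (subst (i <_) (sym e) i<)))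
        ; ended = subst (λ n → HOk (testOk endd) n P) e (proj₁ (accept⇒ (testOk endd) (testFin endd) (2 ^ k) P (Witness.ended w)))
        ; tests = λ k k< q e → proj₁ (accept⇒ (testOk q) (testFin q) k P (holds k k< q e))
        ; labs = λ i i≤ → proj₁ (accept⇒ (testOk (lab (xs x i))) (testFin (lab (xs x i))) (suc i) P
            (wordI-sound x (embed P) (Witness.runs₂ w) i i≤)) }
      module P = Node f
      marks : Σ ℕ λ i → i ≤ lenP A × mark (nth A i) ≡ true
      marks = anyMark-sound A P.markA
      r : ℕ
      r = proj₁ marks
      r≤ : r ≤ lenP A
      r≤ = proj₁ (proj₂ marks)
      m : mark (nth A r) ≡ true
      m = proj₂ (proj₂ marks)
      accepting : accT r ≡ true
      accepting = must λ e →
        let i = m<n⇒m%n≡m (s≤s (subst (r ≤_) P.lenA r≤))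
            h = proj₂ (accept⇒ (testOk froot) (testFin froot) r P
                  (holds r (small (≤-trans (subst (r ≤_) P.lenA r≤) (≤-trans (n≤1+n K) (n≤1+n (suc K))))) froot
                    (not-false (trans (cong accT i) e))))
        in case trans (sym h) (cong not (trans (cong mark (trans (P.at-A r) (cong (nth A) i))) m)) of λ ()

  witness⇒accepted : ∀ x k t → Witness prog (wordI x) k t → Accepted x
  witness⇒accepted x k t w with 2 ^ k in e | m^n>0 2 k
  ... | suc N⁻ | _ = fromWitness e w

  -- Completeness

  module Build (x : List Bool) (N⁻ : ℕ) (long : length x < N⁻) where

    strA : Bool → ℕ → Str ALab
    strA p r = mkS (λ i → alab (i ≡ᵇ 0) (i ≡ᵇ r)) (len⁻ p)

    -- Position 0 of the input is a dummy, so that the input word is read off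
    -- after at least one rotation.
    inp : ℕ → Sy
    inp zero = just true
    inp (suc i) = xs x i

    letter : ℕ → ℕ → ℕ → Sy
    letter zero j i = inp (j + i)
    letter (suc _) j i = nothing

    digits : ℕ → ℕ → ℕ → DLab
    digits t j i = dlab (i ≡ᵇ 0) (bitAt i t) (bitAt i (pred t)) (bitAt i j) (bitAt i (pred j))
      (letter t j i) (letter t j (suc i))

    strD : ℕ → ℕ → Str DLab
    strD t j = mkS (digits t j) N⁻

    build : ∀ {t j r} → Bool → Der x K t j r → PT
    build p (inner {t} {j} {r} _ d₁ d₂ _ _) =
      node p (letter (suc t) (suc j) 1) (strA p r) (strD (suc t) (suc j)) (build (not p) d₁) (build (not p) d₂)
    build p (edge {t} {r} _ d₂ _ _) = node p (letter (suc t) 0 1) (strA p r) (strD (suc t) 0) nil (build (not p) d₂)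
    build p (row {j} {r} _ d₁ _ _) = node p (letter 0 (suc j) 1) (strA p r) (strD 0 (suc j)) (build (not p) d₁) nil
    build p (base {r} _ _ _) = node p (letter 0 0 1) (strA p r) (strD 0 0) nil nil

    -- This and `BelowOk` split the constructors of `Der` by direction and keep only the tile of a
    -- child, so that the local conditions can be verified apart from the recursion.
    data LeftOk : ℕ → ℕ → Maybe ℕ → Set where
      none : ∀ {r} → okLeft r ≡ true → LeftOk 0 r nothing
      some : ∀ {j r r₁} → H r₁ r ≡ true → LeftOk (suc j) r (just r₁)

    data BelowOk (m : Bool) : ℕ → ℕ → ℕ → Maybe ℕ → Set where
      none : ∀ {j r} → okRow m (xs x j) r ≡ true → BelowOk m 0 j r nothing
      some : ∀ {t j r r₂} → V r₂ r ≡ true → BelowOk m (suc t) j r (just r₂)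

    aAt : Bool → ℕ → ℕ → ALab
    aAt p r k = alab (idx k p ≡ᵇ 0) (idx k p ≡ᵇ r)

    dAt : ℕ → ℕ → ℕ → DLab
    dAt t j k = digits t j (k % suc N⁻)

    kidView : ℕ → Bool → ℕ → ℕ → Maybe ℕ → HView
    kidView k p t j (just r) = just (not p , aAt (not p) r k , dAt t j k)
    kidView k p t j nothing = nothing

    -- `build` computes the strings of a node from its parity, coordinates and tile alone, so a
    -- check after k rotations becomes a statement about these numbers. `HOk-build` does the
    -- recursion once for all checks.
    Local : HeadOk → ℕ → Set
    Local c k = ∀ p {t j r l b} → LeftOk j r l → BelowOk (isNode l) t j r b →
      c p (letter t j 1) (aAt p r k) (dAt t j k) (kidView k p t (pred j) l) (kidView k p (pred t) j b) ≡ true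

    at-strA : ∀ p r k → at (strA p r) k ≡ aAt p r k
    at-strA p r k = at-mkS _ (len⁻ p) k

    at-strD : ∀ t j k → at (strD t j) k ≡ dAt t j k
    at-strD t j k = at-mkS (digits t j) N⁻ k

    vw-build : ∀ k p {t j r} (d : Der x K t j r) → vw k (build p d) ≡ just (p , aAt p r k , dAt t j k)
    vw-build k p (inner _ _ _ _ _) = cong₂ (λ a d → just (p , a , d)) (at-strA p _ k) (at-strD _ _ k)
    vw-build k p (edge _ _ _ _) = cong₂ (λ a d → just (p , a , d)) (at-strA p _ k) (at-strD _ _ k)
    vw-build k p (row _ _ _ _) = cong₂ (λ a d → just (p , a , d)) (at-strA p _ k) (at-strD _ _ k)
    vw-build k p (base _ _ _) = cong₂ (λ a d → just (p , a , d)) (at-strA p _ k) (at-strD _ _ k)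

    HOk-build : ∀ c k → Local c k → ∀ p {t j r} (d : Der x K t j r) → HOk c k (build p d)
    HOk-build c k h p (inner {t} {j} {r} _ d₁ d₂ e e')
      rewrite at-strA p r k | at-strD (suc t) (suc j) k | vw-build k (not p) d₁ | vw-build k (not p) d₂ =
      h p (some e) (some e') , HOk-build c k h (not p) d₁ , HOk-build c k h (not p) d₂
    HOk-build c k h p (edge {t} {r} _ d₂ e o)
      rewrite at-strA p r k | at-strD (suc t) 0 k | vw-build k (not p) d₂ =
      h p (none o) (some e) , tt , HOk-build c k h (not p) d₂
    HOk-build c k h p (row {j} {r} _ d₁ e o)
      rewrite at-strA p r k | at-strD 0 (suc j) k | vw-build k (not p) d₁ =
      h p (some e) (none o) , HOk-build c k h (not p) d₁ , tt
    HOk-build c k h p (base {r} _ o o')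
      rewrite at-strA p r k | at-strD 0 0 k =
      h p (none o) (none o') , tt , tt

    letter-row : ∀ j → letter 0 j 1 ≡ xs x j
    letter-row j = cong inp (+-comm j 1)

    letter-shift : ∀ t j i → letter t (suc j) i ≡ letter t j (suc i)
    letter-shift zero j i = cong inp (sym (+-suc j i))
    letter-shift (suc t) j i = refl

    good-local : ∀ k → Local goodOk k
    good-local k p {t} {j} l b = ∧-intro (left-ok l) (below-ok b)
      where
      left-ok : ∀ {j r l} → LeftOk j r l → goodLeft p (dAt t j k) (kidView k p t (pred j) l) ≡ true
      left-ok (none _) = refl
      left-ok {suc j} (some _) = ∧-intro (==-refl (not p)) (∧-intro (==-refl (k % suc N⁻ ≡ᵇ 0))
        (∧-intro (==-refl (bitAt (k % suc N⁻) t)) (∧-intro (==-refl (bitAt (k % suc N⁻) j))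
          (==-complete (letter-shift t j (k % suc N⁻))))))
      below-ok : ∀ {m t r b} → BelowOk m t j r b → goodBelow p (dAt t j k) (kidView k p (pred t) j b) ≡ true
      below-ok (none _) = refl
      below-ok {t = suc t} (some _) = ∧-intro (==-refl (not p)) (∧-intro (==-refl (k % suc N⁻ ≡ᵇ 0))
        (∧-intro (==-refl (bitAt (k % suc N⁻) t)) (==-refl (bitAt (k % suc N⁻) j))))

    ended-local : Local (testOk endd) (suc N⁻)
    ended-local p _ _ = cong (_≡ᵇ 0) (n%n≡0 (suc N⁻))

    lab-local : ∀ i → i ≤ length x → Local (testOk (lab (xs x i))) (suc i)
    lab-local i i≤ p (some _) _ = refl
    lab-local i i≤ p (none _) (some _) = refl
    -- By `long` there is room for the dummy, the word and a blank.
    lab-local i i≤ p (none _) (none _) rewrite m<n⇒m%n≡m {suc N⁻} (s≤s (<-≤-trans (s≤s i≤) long)) =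
      ∧-intro (==-refl (xs x i)) refl

    ≡ᵇ-true : ∀ {m n} → (m ≡ᵇ n) ≡ true → m ≡ n
    ≡ᵇ-true {m} {n} e = ≡ᵇ⇒≡ m n (subst T (sym e) tt)

    nand : ∀ b → (b ≡ true → ⊥) → not b ≡ true
    nand false _ = refl
    nand true h = ⊥-elim (h refl)

    isNode-kid : ∀ {k p t j} l → isNode (kidView k p t j l) ≡ isNode l
    isNode-kid (just _) = refl
    isNode-kid nothing = refl

    tile-ok : ∀ {t j r l b} → LeftOk j r l → BelowOk (isNode l) t j r b → okT (isNode l) (isNode b) (letter t j 1) r ≡ true
    tile-ok (none o) (none o') = ∧-intro o (trans (cong (λ a → okRow false a _) (letter-row 0)) o')
    tile-ok (none o) (some _) = ∧-intro o refl
    tile-ok {j = j} (some _) (none o') = trans (cong (λ a → okRow true a _) (letter-row j)) o'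
    tile-ok (some _) (some _) = refl

    true≢false : ∀ {b} → b ≡ true → not b ≡ true → ⊥
    true≢false refl ()

    test-local : ∀ k q → need k (just q) ≡ true → Local (testOk q) k
    test-local k froot e p l b = refl
    test-local k (fa p' f) e p l b with p == p' in eq
    ... | false = refl
    ... | true with ==-sound p p' eq
    ... | refl = ==-complete (sym (==-sound f _ e))
    test-local k (forb l' b' a' p') e p {t} {j} {r} {l} {b} hl hb = nand _ λ h →
      let h₁ , i₁ = ∧-true {p == p'} h
          h₂ , i₂ = ∧-true {letter t j 1 == a'} i₁
          h₃ , i₃ = ∧-true {isNode (kidView k p t (pred j) l) == l'} i₂
          h₄ , i₄ = ∧-true {isNode (kidView k p (pred t) j b) == b'} i₃
      in contradict (==-sound _ _ h₁) (==-sound _ _ h₂) (trans (sym (isNode-kid l)) (==-sound _ _ h₃))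
           (trans (sym (isNode-kid b)) (==-sound _ _ h₄)) (≡ᵇ-true i₄)
      where
      contradict : p ≡ p' → letter t j 1 ≡ a' → isNode l ≡ l' → isNode b ≡ b' → idx k p ≡ r → ⊥
      contradict refl refl refl refl refl = true≢false (tile-ok hl hb) e
    test-local k (fH p') e p {l = nothing} hl hb = nand _ λ h →
      case proj₂ (∧-true {idx k p ≡ᵇ _} (proj₂ (∧-true {p == p'} h))) of λ ()
    test-local k (fH p') e p {r = r} {l = just r₁} (some o) hb = nand _ λ h →
      let h₁ , i₁ = ∧-true {p == p'} h
          h₂ , i₂ = ∧-true {idx k p ≡ᵇ r} i₁
      in contradict (==-sound _ _ h₁) (≡ᵇ-true h₂) (≡ᵇ-true i₂)
      where
      contradict : p ≡ p' → idx k p ≡ r → idx k (not p) ≡ r₁ → ⊥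
      contradict refl refl refl = true≢false o e
    test-local k (fV p') e p {b = nothing} hl hb = nand _ λ h →
      case proj₂ (∧-true {idx k p ≡ᵇ _} (proj₂ (∧-true {p == p'} h))) of λ ()
    test-local k (fV p') e p {r = r} {b = just r₂} hl (some o) = nand _ λ h →
      let h₁ , i₁ = ∧-true {p == p'} h
          h₂ , i₂ = ∧-true {idx k p ≡ᵇ r} i₁
      in contradict (==-sound _ _ h₁) (≡ᵇ-true h₂) (≡ᵇ-true i₂)
      where
      contradict : p ≡ p' → idx k p ≡ r → idx k (not p) ≡ r₂ → ⊥
      contradict refl refl refl = true≢false o e

    private
      Bound : ℕ
      Bound = 2 ^ suc N⁻

      ≡ᵇ-refl : ∀ n → (n ≡ᵇ n) ≡ true
      ≡ᵇ-refl zero = refl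
      ≡ᵇ-refl (suc n) = ≡ᵇ-refl n

      headS-mkS : ∀ {A : Set} (f : ℕ → A) m → headS (mkS f m) ≡ f 0
      headS-mkS f zero = refl
      headS-mkS f (suc m) = refl

    input-ok : ∀ t j → InputOk (strD t j)
    input-ok t j rewrite lenP-mkS (digits t j) N⁻ =
      (λ i i< → trans (cong vn (nth-mkS (digits t j) N⁻ i (<⇒≤ i<))) (sym (cong vs (nth-mkS (digits t j) N⁻ (suc i) i<)))) ,
      trans (cong vn (nth-mkS (digits t j) N⁻ N⁻ ≤-refl)) (last t) ,
      λ i i≤ e → trans (cong vn (nth-mkS (digits t j) N⁻ i i≤)) (next t i (trans (sym (cong vs (nth-mkS (digits t j) N⁻ i i≤))) e))
      where
      last : ∀ t → letter t j (suc N⁻) ≡ nothing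
      last zero = trans (cong inp (+-suc j N⁻)) (xs-blank x (j + N⁻) (≤-trans (<⇒≤ long) (m≤n+m N⁻ j)))
      last (suc t) = refl
      next-inp : ∀ i → inp i ≡ nothing → inp (suc i) ≡ nothing
      next-inp (suc i) e = xs-next x i e
      next : ∀ t i → letter t j i ≡ nothing → letter t j (suc i) ≡ nothing
      next zero i e = trans (cong inp (+-suc j i)) (next-inp (j + i) e)
      next (suc t) i e = refl

    static-build : ∀ p {t j r l b} → r ≤ K → t < Bound → j < Bound → LeftOk j r l → BelowOk (isNode l) t j r b →
      Static (letter t j 1) (strA p r) (strD t j) (isNode l) (isNode b)
    static-build p {t} {j} {r} {l} {b} r≤ t< j< hl hb = record
      { headA = cong afirst (headS-mkS _ (len⁻ p))
      ; tailA = λ i i< → cong afirst (nth-mkS fA (len⁻ p) (suc i) (subst (i <_) (lenP-mkS fA (len⁻ p)) i<))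
      ; markA = anyMark-complete (strA p r) r (≤-trans r≤' (≤-reflexive (sym (lenP-mkS fA (len⁻ p)))))
          (trans (cong mark (nth-mkS fA (len⁻ p) r r≤')) (≡ᵇ-refl r))
      ; headD = cong dfirst (headS-mkS (digits t j) N⁻)
      ; tailD = λ i i< → cong dfirst (nth-mkS (digits t j) N⁻ (suc i) (subst (i <_) (lenP-mkS (digits t j) N⁻) i<))
      ; input = input-ok t j
      ; sym≡ = cong vn (headS-mkS (digits t j) N⁻)
      ; numT = numT hb
      ; numJ = numJ hl }
      where
      fA : ℕ → ALab
      fA i = alab (i ≡ᵇ 0) (i ≡ᵇ r)
      r≤' : r ≤ len⁻ p
      r≤' = ≤-trans r≤ (K≤ p)
        where
        K≤ : ∀ p → K ≤ len⁻ p
        K≤ false = ≤-refl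
        K≤ true = n≤1+n K
      valT : val tb (strD t j) ≡ t
      valT = val-bits tb (digits t j) N⁻ t (λ _ → refl) t<
      valJ : val jb (strD t j) ≡ j
      valJ = val-bits jb (digits t j) N⁻ j (λ _ → refl) j<
      valT' : val tp (strD t j) ≡ pred t
      valT' = val-bits tp (digits t j) N⁻ (pred t) (λ _ → refl) (≤-<-trans pred[n]≤n t<)
      valJ' : val jp (strD t j) ≡ pred j
      valJ' = val-bits jp (digits t j) N⁻ (pred j) (λ _ → refl) (≤-<-trans pred[n]≤n j<)
      specT : NSpec t (pred t) (numSum tb tp (strD t j))
      specT = subst₂ (λ u v → NSpec u v (numSum tb tp (strD t j))) valT valT' (numSum-spec tb tp (strD t j))
      specJ : NSpec j (pred j) (numSum jb jp (strD t j))
      specJ = subst₂ (λ u v → NSpec u v (numSum jb jp (strD t j))) valJ valJ' (numSum-spec jb jp (strD t j))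
      numT : ∀ {b} → BelowOk (isNode l) t j r b → numOk (isNode b) (numSum tb tp (strD t j)) ≡ true
      numT (none _) = NSpec.zero⇐ specT refl
      numT (some _) = NSpec.succ⇐ specT refl
      numJ : ∀ {l} → LeftOk j r l → numOk (isNode l) (numSum jb jp (strD t j)) ≡ true
      numJ (none _) = NSpec.zero⇐ specJ refl
      numJ (some _) = NSpec.succ⇐ specJ refl

    view-node : ∀ p {t j r} (d : Der x K t j r) → isNode (view startCheck (build p d)) ≡ true
    view-node p (inner _ _ _ _ _) = refl
    view-node p (edge _ _ _ _) = refl
    view-node p (row _ _ _ _) = refl
    view-node p (base _ _ _) = refl

    stat-build : ∀ p {t j r} → t < Bound → j < Bound → (d : Der x K t j r) → AllN startCheck (build p d)
    stat-build p {suc t} {suc j} {r} t< j< (inner r≤ d₁ d₂ e e') =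
      startOk⇐ {p = p} (subst₂ (Static _ (strA p r) (strD (suc t) (suc j))) (sym (view-node (not p) d₁)) (sym (view-node (not p) d₂))
        (static-build p r≤ t< j< (some e) (some e'))) ,
      stat-build (not p) t< (<-trans (n<1+n j) j<) d₁ , stat-build (not p) (<-trans (n<1+n t) t<) j< d₂
    stat-build p {suc t} {_} {r} t< j< (edge r≤ d₂ e o) =
      startOk⇐ {p = p} (subst (Static _ (strA p r) (strD (suc t) 0) false) (sym (view-node (not p) d₂))
        (static-build p r≤ t< j< (none o) (some e))) , tt , stat-build (not p) (<-trans (n<1+n t) t<) j< d₂
    stat-build p {_} {suc j} {r} t< j< (row r≤ d₁ e o) =
      startOk⇐ {p = p} (subst (λ h → Static _ (strA p r) (strD 0 (suc j)) h false) (sym (view-node (not p) d₁))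
        (static-build p r≤ t< j< (some e) (none o))) , stat-build (not p) t< (<-trans (n<1+n j) j<) d₁ , tt
    stat-build p t< j< (base r≤ o o') = startOk⇐ {p = p} (static-build p r≤ t< j< (none o) (none o')) , tt , tt

    startFin-build : ∀ {t j r} (d : Der x K t j r) → startFin (view startCheck (build false d)) ≡ true
    startFin-build (inner _ _ _ _ _) = refl
    startFin-build (edge _ _ _ _) = refl
    startFin-build (row _ _ _ _) = refl
    startFin-build (base _ _ _) = refl

    witness : ∀ {k t j r} → 2 ^ k ≡ suc N⁻ → t < Bound → j < Bound → accT r ≡ true → (d : Der x K t j r) →
      Witness prog (wordI x) k (embed (build false d))
    witness {k} {t} {j} {r} e t< j< ac d = record
      { runs₁ = progFrom-complete 0 kMax (embed P) goods
          (λ i q e → holds i q (trans (cong (λ n → need n q) (sym (+-identityʳ i))) e))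
      ; runs₂ = wordI-complete x (embed P) goods λ i i≤ →
          accept⇐ _ _ (suc i) P (HOk-build _ (suc i) (lab-local i i≤) false d) refl
      ; good = λ i _ → goods i
      ; ended = accept⇐ (testOk endd) (testFin endd) (2 ^ k) P
          (HOk-build _ (2 ^ k) (subst (Local (testOk endd)) (sym e) ended-local) false d) refl }
      where
      P : PT
      P = build false d
      goods : ∀ i → Good (iter rot i (embed P))
      goods i = accept⇐ goodOk (λ _ → true) i P (HOk-build goodOk i (good-local i) false d) refl
      finOk : ∀ k q → need k (just q) ≡ true → testFin q (vw k P) ≡ true
      finOk k froot e = nand _ λ h → true≢false
        (subst (λ r → accT r ≡ true) (sym (≡ᵇ-true (trans (sym (cong marked (vw-build k false d))) h))) ac) e
      finOk k (fa _ _) e = refl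
      finOk k (forb _ _ _ _) e = refl
      finOk k (fH _) e = refl
      finOk k (fV _) e = refl
      holds : ∀ i q → need i q ≡ true → Holds q (iter rot i (embed P))
      holds zero start e = accept-embed startCheck startFin P (stat-build false t< j< d) (startFin-build d)
      holds i (just q) e = accept⇐ (testOk q) (testFin q) i P (HOk-build (testOk q) i (test-local i q e) false d) (finOk i q e)

  accepted⇒witness : ∀ x k {t j r} → suc (length x) < 2 ^ k → t < 2 ^ (2 ^ k) → j < 2 ^ (2 ^ k) → accT r ≡ true →
    Der x K t j r → Σ (BTree Lab) (Witness prog (wordI x) k)
  accepted⇒witness x k l t< j< ac d with 2 ^ k in e
  accepted⇒witness x k (s≤s l) t< j< ac d | suc N⁻ = _ , Build.witness x N⁻ l e t< j< ac d

-- Turing machines as tilings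

nthL : ∀ {n} → List (Fin (suc n)) → ℕ → Fin (suc n)
nthL [] _ = zero
nthL (a ∷ l) zero = a
nthL (a ∷ l) (suc k) = nthL l k

nthL-blank : ∀ {n} (l : List (Fin (suc n))) k → length l ≤ k → nthL l k ≡ zero
nthL-blank [] k _ = refl
nthL-blank (a ∷ l) (suc k) (s≤s h) = nthL-blank l k h

runC-suc : ∀ M t c → runC M (suc t) c ≡ stepC M (runC M t c)
runC-suc M zero c = refl
runC-suc M (suc t) c = runC-suc M t (stepC M c)

runC-+ : ∀ M s t c → runC M (s + t) c ≡ runC M t (runC M s c)
runC-+ M zero t c = refl
runC-+ M (suc s) t c = runC-+ M s t (stepC M c)

runC-halted : ∀ M t c → TM.halting M (Config.state c) ≡ true → runC M t c ≡ c
runC-halted M zero c h = refl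
runC-halted M (suc t) c h = trans (cong (runC M t) (fixed c h)) (runC-halted M t c h)
  where
  fixed : ∀ c → TM.halting M (Config.state c) ≡ true → stepC M c ≡ c
  fixed (cfg q l a r) h rewrite h = refl

runC-≤ : ∀ M {s t} c → s ≤ t → TM.halting M (Config.state (runC M s c)) ≡ true → runC M t c ≡ runC M s c
runC-≤ M {s} {t} c s≤t h = trans (cong (λ n → runC M n c) (sym (m+[n∸m]≡n s≤t)))
  (trans (runC-+ M s (t ∸ s) c) (runC-halted M (t ∸ s) (runC M s c) h))

module Simulation (M : TM) where
  open TM M using (nQ; g; halting; accepting; δ)

  Cell : Set
  Cell = Maybe (Fin nQ) × Sym M

  Tile : Set
  Tile = Cell × Cell × Cell

  blankC : Cell
  blankC = nothing , zero

  symOf : Sy → Sym M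
  symOf nothing = zero
  symOf (just b) = bit M b

  isMove : Move → Move → Bool
  isMove left left = true
  isMove right right = true
  isMove stay stay = true
  isMove _ _ = false

  -- The state entering a neighbouring cell in direction m (or staying).
  enter : Move → Cell → Maybe (Fin nQ)
  enter m (nothing , _) = nothing
  enter m (just q , a) = if halting q then (if isMove m stay then just q else nothing)
    else (if isMove m (proj₂ (proj₂ (δ q a))) then just (proj₁ (δ q a)) else nothing)

  written : Fin nQ → Sym M → Sym M
  written q a = if halting q then a else proj₁ (proj₂ (δ q a))

  -- A row of a computation holds one state, so at most one neighbour hands a state over. A halted
  -- head re-enters its own cell and keeps its symbol, which makes halting configurations
  -- stationary.
  rule : Cell → Cell → Cell → Cell
  rule l (just q , a) r = enter stay (just q , a) , written q a
  rule l (nothing , a) r = (enter right l Maybe.<∣> enter left r) , a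

  -- Cell j + 2 of the row at time t is the tape cell j - t; the two cells in
  -- front of it can never be visited.
  next : (ℕ → Cell) → ℕ → Cell
  next ρ (suc (suc j)) = rule (ρ j) (ρ (suc j)) (ρ (suc (suc j)))
  next ρ _ = blankC

  tileFin : Finite Tile
  tileFin = finite-×

  K : ℕ
  K = Finite.size tileFin

  code : Tile → ℕ
  code τ = toℕ (Finite.enc tileFin τ)

  -- The tile strings have positions beyond the last code. They are read as the blank triple, which
  -- is safe because soundness speaks of `tile r` and not of r.
  tile : ℕ → Tile
  tile r with r <? K
  ... | yes r< = Finite.dec tileFin (fromℕ< r<)
  ... | no _ = blankC , blankC , blankC

  tile-code : ∀ τ → tile (code τ) ≡ τ
  tile-code τ with code τ <? K
  ... | yes r< = trans (cong (Finite.dec tileFin) (Finₚ.fromℕ<-toℕ _ r<)) (Finite.dec-enc tileFin τ)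
  ... | no r≮ = ⊥-elim (r≮ (Finₚ.toℕ<n _))

  okLeft : ℕ → Bool
  okLeft r = (proj₁ (tile r) == blankC) ∧ (proj₁ (proj₂ (tile r)) == blankC)

  okRow : Bool → Sy → ℕ → Bool
  okRow l a r = proj₂ (proj₂ (tile r)) == ((if l then nothing else just (TM.start M)) , symOf a)

  -- Neighbouring triples overlap in two cells. Thanks to the shear, the three cells that determine
  -- the last cell of a triple are exactly the triple below it.
  H V : ℕ → ℕ → Bool
  H r' r = (proj₁ (proj₂ (tile r')) == proj₁ (tile r)) ∧ (proj₂ (proj₂ (tile r')) == proj₁ (proj₂ (tile r)))
  V r' r = rule (proj₁ (tile r')) (proj₁ (proj₂ (tile r'))) (proj₂ (proj₂ (tile r'))) == proj₂ (proj₂ (tile r))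

  accC : Cell → Bool
  accC (nothing , _) = false
  accC (just q , _) = halting q ∧ accepting q

  accT : ℕ → Bool
  accT r = accC (proj₂ (proj₂ (tile r)))

  open Tiling K okLeft okRow H V accT public

  -- The space-time diagram as the only tiling

  module _ (x : List Bool) where

    row₀ : ℕ → Cell
    row₀ zero = blankC
    row₀ (suc zero) = blankC
    row₀ (suc (suc zero)) = just (TM.start M) , symOf (xs x 0)
    row₀ (suc (suc (suc j))) = nothing , symOf (xs x (suc j))

    rows : ℕ → ℕ → Cell
    rows zero = row₀
    rows (suc t) = next (rows t)

    trueTile : ℕ → ℕ → Tile
    trueTile t j = rows t j , rows t (suc j) , rows t (suc (suc j))

    private
      tile≡ : ∀ {r c₁ c₂ c₃} → proj₁ (tile r) ≡ c₁ → proj₁ (proj₂ (tile r)) ≡ c₂ → proj₂ (proj₂ (tile r)) ≡ c₃ →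
        tile r ≡ (c₁ , c₂ , c₃)
      tile≡ refl refl refl = refl

      H⇒ : ∀ {r r' τ} → tile r' ≡ τ → H r' r ≡ true → proj₁ (tile r) ≡ proj₁ (proj₂ τ) × proj₁ (proj₂ (tile r)) ≡ proj₂ (proj₂ τ)
      H⇒ {r} {r'} refl h with ∧-true {proj₁ (proj₂ (tile r')) == proj₁ (tile r)} h
      ... | e , e' = sym (==-sound _ _ e) , sym (==-sound _ _ e')

      V⇒ : ∀ {r r' τ} → tile r' ≡ τ → V r' r ≡ true → proj₂ (proj₂ (tile r)) ≡ rule (proj₁ τ) (proj₁ (proj₂ τ)) (proj₂ (proj₂ τ))
      V⇒ refl h = sym (==-sound _ _ h)

      okLeft⇒ : ∀ {r} → okLeft r ≡ true → proj₁ (tile r) ≡ blankC × proj₁ (proj₂ (tile r)) ≡ blankC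
      okLeft⇒ {r} h with ∧-true {proj₁ (tile r) == blankC} h
      ... | e , e' = ==-sound _ _ e , ==-sound _ _ e'

    -- There is no freedom: the left neighbour or the border fixes the first two cells, the triple
    -- below or the input fixes the third.
    der-sound : ∀ {B t j r} → Der x B t j r → tile r ≡ trueTile t j
    der-sound (inner _ d₁ d₂ h v) =
      let e = H⇒ (der-sound d₁) h in tile≡ (proj₁ e) (proj₂ e) (V⇒ (der-sound d₂) v)
    der-sound (edge {r = r} _ d v o) =
      let e = okLeft⇒ {r} o in tile≡ (proj₁ e) (proj₂ e) (V⇒ (der-sound d) v)
    der-sound (row _ d h o) =
      let e = H⇒ (der-sound d) h in tile≡ (proj₁ e) (proj₂ e) (==-sound _ _ o)
    der-sound (base {r = r} _ o o') =
      let e = okLeft⇒ {r} o in tile≡ (proj₁ e) (proj₂ e) (==-sound _ _ o')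

    code≤ : ∀ τ → code τ ≤ K
    code≤ τ = <⇒≤ (Finₚ.toℕ<n _)

    der-complete : ∀ t j → Der x K t j (code (trueTile t j))
    der-complete zero zero = base (code≤ _) left-ok bottom-ok
      where
      left-ok : okLeft (code (trueTile 0 0)) ≡ true
      left-ok rewrite tile-code (trueTile 0 0) = ∧-intro (==-refl blankC) (==-refl blankC)
      bottom-ok : okRow false (xs x 0) (code (trueTile 0 0)) ≡ true
      bottom-ok rewrite tile-code (trueTile 0 0) = ==-refl (row₀ 2)
    der-complete zero (suc j) = row (code≤ _) (der-complete zero j) h-ok bottom-ok
      where
      h-ok : H (code (trueTile 0 j)) (code (trueTile 0 (suc j))) ≡ true
      h-ok rewrite tile-code (trueTile 0 j) | tile-code (trueTile 0 (suc j)) = ∧-intro (==-refl (row₀ (1 + j))) (==-refl (row₀ (2 + j)))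
      bottom-ok : okRow true (xs x (suc j)) (code (trueTile 0 (suc j))) ≡ true
      bottom-ok rewrite tile-code (trueTile 0 (suc j)) = ==-refl (row₀ (3 + j))
    der-complete (suc t) zero = edge (code≤ _) (der-complete t zero) v-ok left-ok
      where
      left-ok : okLeft (code (trueTile (suc t) 0)) ≡ true
      left-ok rewrite tile-code (trueTile (suc t) 0) = ∧-intro (==-refl blankC) (==-refl blankC)
      v-ok : V (code (trueTile t 0)) (code (trueTile (suc t) 0)) ≡ true
      v-ok rewrite tile-code (trueTile t 0) | tile-code (trueTile (suc t) 0) = ==-refl (rows (suc t) 2)
    der-complete (suc t) (suc j) = inner (code≤ _) (der-complete (suc t) j) (der-complete t (suc j)) h-ok v-ok
      where
      h-ok : H (code (trueTile (suc t) j)) (code (trueTile (suc t) (suc j))) ≡ true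
      h-ok rewrite tile-code (trueTile (suc t) j) | tile-code (trueTile (suc t) (suc j)) =
        ∧-intro (==-refl (rows (suc t) (1 + j))) (==-refl (rows (suc t) (2 + j)))
      v-ok : V (code (trueTile t (suc j))) (code (trueTile (suc t) (suc j))) ≡ true
      v-ok rewrite tile-code (trueTile t (suc j)) | tile-code (trueTile (suc t) (suc j)) = ==-refl (rows (suc t) (3 + j))

  -- The head index h grows by 0, 1 or 2 when the machine moves left, stays or moves right. By
  -- `margin` the cells recorded to the left of the head never reach the two blank ones in front.
  record Rep (ρ : ℕ → Cell) (c : Config M) (h : ℕ) : Set where
    field
      onHead  : ρ h ≡ (just (Config.state c) , Config.hd c)
      onRight : ∀ k → ρ (suc (k + h)) ≡ (nothing , nthL (Config.rgt c) k)
      onLeft  : ∀ k m → suc (k + m) ≡ h → ρ m ≡ (nothing , nthL (Config.lft c) k)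
      margin  : length (Config.lft c) + 2 ≤ h

  module Next {ρ q l a r h} (rep : Rep ρ (cfg q l a r) h) where
    open Rep rep

    private
      rule-cong : ∀ {l l' c c' r r'} → l ≡ l' → c ≡ c' → r ≡ r' → rule l c r ≡ rule l' c' r'
      rule-cong refl refl refl = refl

      far : ∀ {k} → h ≤ suc k → nthL l k ≡ zero
      far {k} h≤ = nthL-blank l k (s≤s⁻¹ (≤-trans (≤-trans (≤-reflexive (+-comm 1 (length l))) (+-monoʳ-≤ (length l) (s≤s z≤n))) (≤-trans margin h≤)))

      h≥2 : 2 ≤ h
      h≥2 = ≤-trans (m≤n+m 2 (length l)) margin

    center : next ρ (suc h) ≡ (enter stay (just q , a) , written q a)
    center = go h refl h≥2
      where
      go : ∀ h' → h' ≡ h → 2 ≤ h' → next ρ (suc h') ≡ (enter stay (just q , a) , written q a)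
      go (suc i) e _ = cong (λ c → rule (ρ i) c (ρ (suc (suc i)))) (trans (cong ρ e) onHead)

    right-zero : next ρ (suc (suc h)) ≡ (enter right (just q , a) , nthL r 0)
    right-zero = trans (rule-cong onHead (onRight 0) (onRight 1)) (cong (_, nthL r 0) (alternative _))
      where
      alternative : ∀ (m : Maybe (Fin nQ)) → (m Maybe.<∣> nothing) ≡ m
      alternative (just _) = refl
      alternative nothing = refl

    right-suc : ∀ k → next ρ (suc (suc (suc k + h))) ≡ (nothing , nthL r (suc k))
    right-suc k = rule-cong (onRight k) (onRight (suc k)) (onRight (suc (suc k)))

    left-zero : ∀ m → suc m ≡ h → next ρ (suc m) ≡ (enter left (just q , a) , nthL l 0)
    left-zero zero refl = case h≥2 of λ { (s≤s ()) }
    left-zero (suc m) refl = rule-cong (onLeft 1 m refl) (onLeft 0 (suc m) refl) onHead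

    left-suc : ∀ k m → suc (suc k + m) ≡ h → next ρ (suc m) ≡ (nothing , nthL l (suc k))
    left-suc k zero refl = cong (nothing ,_) (sym (far (s≤s (s≤s (≤-reflexive (+-identityʳ k))))))
    left-suc k (suc m) refl = rule-cong (onLeft (suc (suc k)) m (cong (λ n → suc (suc n)) (sym (+-suc k m))))
      (onLeft (suc k) (suc m) refl) (onLeft k (suc (suc m)) (cong suc (+-suc k (suc m))))

    right-all : enter right (just q , a) ≡ nothing → ∀ k → next ρ (suc (suc (k + h))) ≡ (nothing , nthL r k)
    right-all e zero = trans right-zero (cong (_, nthL r 0) e)
    right-all e (suc k) = right-suc k

    left-all : enter left (just q , a) ≡ nothing → ∀ k m → k + m ≡ h → next ρ m ≡ (nothing , nthL l k)
    left-all e k zero e' = cong (nothing ,_) (sym (far (≤-trans (≤-reflexive (trans (sym e') (+-identityʳ k))) (n≤1+n k))))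
    left-all e zero (suc m) e' = trans (left-zero m e') (cong (_, nthL l 0) e)
    left-all e (suc k) (suc m) e' = left-suc k m (trans (cong suc (sym (+-suc k m))) e')

    stays : ∀ {q' a'} → enter stay (just q , a) ≡ just q' → enter left (just q , a) ≡ nothing →
      enter right (just q , a) ≡ nothing → written q a ≡ a' → Rep (next ρ) (cfg q' l a' r) (suc h)
    stays e e' e'' w = record
      { onHead = trans center (cong₂ _,_ e w)
      ; onRight = λ k → trans (cong (λ n → next ρ (suc n)) (+-suc k h)) (right-all e'' k)
      ; onLeft = λ k m eq → left-all e' k m (suc-injective eq)
      ; margin = m≤n⇒m≤1+n margin }

    lefts : ∀ {q' a' l' c} → enter stay (just q , a) ≡ nothing → enter left (just q , a) ≡ just q' →
      enter right (just q , a) ≡ nothing → written q a ≡ a' → nthL l 0 ≡ c → (∀ k → nthL l (suc k) ≡ nthL l' k) →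
      length l' ≤ length l → Rep (next ρ) (cfg q' l' c (a' ∷ r)) h
    lefts {l' = l'} e e' e'' w c≡ l≡ len = record
      { onHead = head h refl h≥2
      ; onRight = λ { zero → trans center (cong₂ _,_ e w) ; (suc k) → right-all e'' k }
      ; onLeft = onL
      ; margin = ≤-trans (+-monoˡ-≤ 2 len) margin }
      where
      head : ∀ h' → h' ≡ h → 2 ≤ h' → next ρ h ≡ _
      head (suc m) eq _ = trans (cong (next ρ) (sym eq)) (trans (left-zero m eq) (cong₂ _,_ e' c≡))
      onL : ∀ k m → suc (k + m) ≡ h → next ρ m ≡ (nothing , nthL l' k)
      onL k zero eq = cong (nothing ,_) (trans (sym (far (≤-trans (≤-reflexive (trans (sym eq) (cong suc (+-identityʳ k)))) (n≤1+n _)))) (l≡ k))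
      onL k (suc m) eq = trans (left-suc k m (trans (cong suc (sym (+-suc k m))) eq)) (cong (nothing ,_) (l≡ k))

    rights : ∀ {q' a' r' c} → enter stay (just q , a) ≡ nothing → enter left (just q , a) ≡ nothing →
      enter right (just q , a) ≡ just q' → written q a ≡ a' → nthL r 0 ≡ c → (∀ k → nthL r (suc k) ≡ nthL r' k) →
      Rep (next ρ) (cfg q' (a' ∷ l) c r') (suc (suc h))
    rights e e' e'' w c≡ r≡ = record
      { onHead = trans right-zero (cong₂ _,_ e'' c≡)
      ; onRight = λ k → trans (cong (λ n → next ρ (suc n)) (trans (+-suc k (suc h)) (cong suc (+-suc k h))))
          (trans (right-suc k) (cong (nothing ,_) (r≡ k)))
      ; onLeft = λ { zero m refl → trans center (cong₂ _,_ e w) ; (suc k) m eq → left-all e' k m (suc-injective (suc-injective eq)) }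
      ; margin = s≤s (m≤n⇒m≤1+n margin) }

  rep-step : ∀ {ρ c h} → Rep ρ c h → Σ ℕ λ h' → h' ≤ 2 + h × Rep (next ρ) (stepC M c) h'
  rep-step {c = cfg q l a r} {h} rep with halting q in hq
  ... | true = suc h , n≤1+n _ , Next.stays rep (eq stay) (eq left) (eq right) w
    where
    eq : ∀ m → enter m (just q , a) ≡ (if isMove m stay then just q else nothing)
    eq m rewrite hq = refl
    w : written q a ≡ a
    w rewrite hq = refl
  ... | false = go (proj₂ (proj₂ (δ q a))) refl l r rep
    where
    eq : ∀ m → enter m (just q , a) ≡ (if isMove m (proj₂ (proj₂ (δ q a))) then just (proj₁ (δ q a)) else nothing)
    eq m rewrite hq = refl
    w : written q a ≡ proj₁ (proj₂ (δ q a))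
    w rewrite hq = refl
    moved : ∀ m {m'} → proj₂ (proj₂ (δ q a)) ≡ m' → enter m (just q , a) ≡ (if isMove m m' then just (proj₁ (δ q a)) else nothing)
    moved m e = trans (eq m) (cong (λ m' → if isMove m m' then just (proj₁ (δ q a)) else nothing) e)
    go : ∀ {ρ} m → proj₂ (proj₂ (δ q a)) ≡ m → ∀ l r → Rep ρ (cfg q l a r) h → Σ ℕ λ h' → h' ≤ 2 + h ×
      Rep (next ρ) (moveC M (proj₁ (δ q a)) l (proj₁ (proj₂ (δ q a))) r m) h'
    go stay e l r rep = suc h , n≤1+n _ , Next.stays rep (moved stay e) (moved left e) (moved right e) w
    go left e [] r rep = h , ≤-trans (n≤1+n h) (n≤1+n _) , Next.lefts rep (moved stay e) (moved left e) (moved right e)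
      w refl (λ _ → refl) z≤n
    go left e (c ∷ l) r rep = h , ≤-trans (n≤1+n h) (n≤1+n _) , Next.lefts rep (moved stay e) (moved left e) (moved right e)
      w refl (λ _ → refl) (n≤1+n _)
    go right e l [] rep = suc (suc h) , ≤-refl , Next.rights rep (moved stay e) (moved left e) (moved right e)
      w refl (λ _ → refl)
    go right e l (c ∷ r) rep = suc (suc h) , ≤-refl , Next.rights rep (moved stay e) (moved left e) (moved right e)
      w refl (λ _ → refl)

  rep-init : ∀ x → Rep (row₀ x) (initC M x) 2
  rep-init [] = record
    { onHead = refl
    ; onRight = λ k → cong (λ n → row₀ [] (suc n)) (+-comm k 2)
    ; onLeft = λ { zero m refl → refl ; (suc zero) zero refl → refl ; (suc zero) (suc m) () ; (suc (suc k)) m () }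
    ; margin = ≤-refl }
  rep-init (b ∷ x) = record
    { onHead = refl
    ; onRight = λ k → trans (cong (λ n → row₀ (b ∷ x) (suc n)) (+-comm k 2)) (cong (nothing ,_) (letters x k))
    ; onLeft = λ { zero m refl → refl ; (suc zero) zero refl → refl ; (suc zero) (suc m) () ; (suc (suc k)) m () }
    ; margin = ≤-refl }
    where
    letters : ∀ x k → symOf (xs x k) ≡ nthL (map (bit M) x) k
    letters [] k = refl
    letters (b ∷ x) zero = refl
    letters (b ∷ x) (suc k) = letters x k

  rep-run : ∀ x t → Σ ℕ λ h → h ≤ 2 + (t + t) × Rep (rows x t) (runC M t (initC M x)) h
  rep-run x zero = 2 , ≤-refl , rep-init x
  rep-run x (suc t) with rep-run x t
  ... | h , h≤ , rep with rep-step rep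
  ... | h' , h'≤ , rep' = h' , ≤-trans h'≤ (≤-trans (+-monoʳ-≤ 2 h≤) (≤-reflexive (cong (3 +_) (sym (+-suc t t))))) ,
    subst (λ c → Rep (rows x (suc t)) c h') (sym (runC-suc M t (initC M x))) rep'

  rep-state : ∀ {ρ c h} → Rep ρ c h → ∀ {i q a} → ρ i ≡ (just q , a) → Config.state c ≡ q
  rep-state {ρ} {c} {h} rep {i} e with <-cmp i h
  ... | tri≈ _ refl _ = just-injective (cong proj₁ (trans (sym (Rep.onHead rep)) e))
  ... | tri< i<h _ _ = case trans (sym (Rep.onLeft rep (h ∸ suc i) i (trans (sym (+-suc _ i)) (m∸n+n≡m i<h)))) e of λ ()
  ... | tri> _ _ h<i = case trans (sym (trans (cong ρ (sym (trans (sym (+-suc (i ∸ suc h) h)) (m∸n+n≡m h<i)))) (Rep.onRight rep (i ∸ suc h)))) e of λ ()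

  -- The accepting cell may belong to any row. Its state is halting, hence permanent, so it agrees
  -- with the state at the given time, be that later or earlier.
  accepted⇒ : ∀ x t → HaltsWithin M t x → Accepted x → AcceptsIn M t x
  accepted⇒ x T halts (t , j , r , ac , d) with rows x t (2 + j) in e | trans (cong (λ τ → accC (proj₂ (proj₂ τ))) (sym (der-sound x d))) ac
  ... | just q , a | h with ∧-true {halting q} h
  ... | hq , aq with rep-state (proj₂ (proj₂ (rep-run x t))) e | ≤-total t T
  ... | s | inj₁ t≤T = trans (cong (accepting ∘ Config.state) (runC-≤ M (initC M x) t≤T (trans (cong halting s) hq))) (trans (cong accepting s) aq)
  ... | s | inj₂ T≤t = trans (cong (accepting ∘ Config.state) (sym (runC-≤ M (initC M x) T≤t halts))) (trans (cong accepting s) aq)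

  accepted⇐ : ∀ x t → HaltsWithin M t x → AcceptsIn M t x → Σ ℕ λ j → j ≤ t + t × Σ ℕ λ r → accT r ≡ true × Der x K t j r
  accepted⇐ x t halts accepts = derive (rep-run x t)
    where
    derive : (Σ ℕ λ h → h ≤ 2 + (t + t) × Rep (rows x t) (runC M t (initC M x)) h) →
      Σ ℕ λ j → j ≤ t + t × Σ ℕ λ r → accT r ≡ true × Der x K t j r
    derive (zero , h≤ , rep) = case ≤-trans (m≤n+m 2 _) (Rep.margin rep) of λ ()
    derive (suc zero , h≤ , rep) = case ≤-trans (m≤n+m 2 _) (Rep.margin rep) of λ { (s≤s ()) }
    derive (suc (suc j) , h≤ , rep) = j , s≤s⁻¹ (s≤s⁻¹ h≤) , code (trueTile x t j) ,
      trans (cong (accC ∘ proj₂ ∘ proj₂) (tile-code (trueTile x t j)))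
        (trans (cong accC (Rep.onHead rep)) (∧-intro halts accepts)) , der-complete x t j

-- A small programming language for Turing machines

module Programs (X : Set) {{FX : Finite X}} where

  data Γ : Set where
    □   : Γ
    bt  : Bool → Γ
    ext : X → Γ

  Tape : Set
  Tape = List Γ × Γ × List Γ

  move : Move → List Γ → Γ → List Γ → Tape
  move stay l a r = l , a , r
  move left [] a r = [] , □ , a ∷ r
  move left (x ∷ l) a r = l , x , a ∷ r
  move right l a [] = a ∷ l , □ , []
  move right l a (x ∷ r) = a ∷ l , x , r

  put : Tape → Γ → Move → Tape
  put (l , _ , r) a m = move m l a r

  cur : Tape → Γ
  cur (_ , a , _) = a

  -- Every program ends with a Boolean, by which `bind` selects its continuation and `loop` decides
  -- whether to stop.
  data Prog : Set where
    act  : (Γ → Γ × Move × Bool) → Prog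
    bind : Prog → (Bool → Prog) → Prog
    loop : Prog → Prog

  data Big : Prog → Tape → ℕ → Bool → Tape → Set where
    b-act  : ∀ {f τ a m b} → f (cur τ) ≡ (a , m , b) → Big (act f) τ 1 b (put τ a m)
    b-bind : ∀ {p k τ n b τ₁ n' b' τ₂} → Big p τ n b τ₁ → Big (k b) τ₁ n' b' τ₂ → Big (bind p k) τ (n + n') b' τ₂
    b-stop : ∀ {p τ n τ₁} → Big p τ n true τ₁ → Big (loop p) τ n true τ₁
    b-more : ∀ {p τ n τ₁ n' b τ₂} → Big p τ n false τ₁ → Big (loop p) τ₁ n' b τ₂ → Big (loop p) τ (n + n') b τ₂

  St : Prog → Set
  St (act _) = ⊤
  St (bind p k) = St p ⊎ (St (k true) ⊎ St (k false))
  St (loop p) = St p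

  finite-St : ∀ p → Finite (St p)
  finite-St (act _) = finite-⊤
  finite-St (bind p k) = finite-⊎ {{finite-St p}} {{finite-⊎ {{finite-St (k true)}} {{finite-St (k false)}}}}
  finite-St (loop p) = finite-St p

  entry : ∀ p → St p
  entry (act _) = tt
  entry (bind p k) = inj₁ (entry p)
  entry (loop p) = entry p

  enterK : ∀ p k b → St (k b) → St (bind p k)
  enterK p k true s = inj₂ (inj₁ s)
  enterK p k false s = inj₂ (inj₂ s)

  afterBind : ∀ p k → St p ⊎ Bool → St (bind p k) ⊎ Bool
  afterBind p k (inj₁ s) = inj₁ (inj₁ s)
  afterBind p k (inj₂ b) = inj₁ (enterK p k b (entry (k b)))

  inK : ∀ p k b → St (k b) ⊎ Bool → St (bind p k) ⊎ Bool
  inK p k b (inj₁ s) = inj₁ (enterK p k b s)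
  inK p k b (inj₂ b') = inj₂ b'

  afterLoop : ∀ p → St p ⊎ Bool → St p ⊎ Bool
  afterLoop p (inj₁ s) = inj₁ s
  afterLoop p (inj₂ true) = inj₂ true
  afterLoop p (inj₂ false) = inj₁ (entry p)

  -- The last transition of a subprogram already enters its successor, so running times add up
  -- without overhead.
  δp : ∀ p → St p → Γ → (St p ⊎ Bool) × Γ × Move
  δp (act f) _ a = inj₂ (proj₂ (proj₂ (f a))) , proj₁ (f a) , proj₁ (proj₂ (f a))
  δp (bind p k) (inj₁ s) a = map₁ (afterBind p k) (δp p s a)
  δp (bind p k) (inj₂ (inj₁ s)) a = map₁ (inK p k true) (δp (k true) s a)
  δp (bind p k) (inj₂ (inj₂ s)) a = map₁ (inK p k false) (δp (k false) s a)
  δp (loop p) s a = map₁ (afterLoop p) (δp p s a)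

  data Steps (p : Prog) : St p → Tape → ℕ → Bool → Tape → Set where
    exit : ∀ {s τ b a m} → δp p s (cur τ) ≡ (inj₂ b , a , m) → Steps p s τ 1 b (put τ a m)
    go   : ∀ {s τ s' a m n b τ'} → δp p s (cur τ) ≡ (inj₁ s' , a , m) → Steps p s' (put τ a m) n b τ' →
      Steps p s τ (suc n) b τ'

  in-K : ∀ p k b {s τ n b' τ'} → Steps (k b) s τ n b' τ' → Steps (bind p k) (enterK p k b s) τ n b' τ'
  in-K p k true (exit e) = exit (cong (map₁ (inK p k true)) e)
  in-K p k false (exit e) = exit (cong (map₁ (inK p k false)) e)
  in-K p k true (go e r) = go (cong (map₁ (inK p k true)) e) (in-K p k true r)
  in-K p k false (go e r) = go (cong (map₁ (inK p k false)) e) (in-K p k false r)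

  then-K : ∀ p k {s τ n b τ₁ n' b' τ₂} → Steps p s τ n b τ₁ → Steps (k b) (entry (k b)) τ₁ n' b' τ₂ →
    Steps (bind p k) (inj₁ s) τ (n + n') b' τ₂
  then-K p k {b = b} (exit e) r = go (cong (map₁ (afterBind p k)) e) (in-K p k b r)
  then-K p k (go e r') r = go (cong (map₁ (afterBind p k)) e) (then-K p k r' r)

  loop-stop : ∀ p {s τ n τ₁} → Steps p s τ n true τ₁ → Steps (loop p) s τ n true τ₁
  loop-stop p (exit e) = exit (cong (map₁ (afterLoop p)) e)
  loop-stop p (go e r) = go (cong (map₁ (afterLoop p)) e) (loop-stop p r)

  loop-more : ∀ p {s τ n τ₁ n' b τ₂} → Steps p s τ n false τ₁ → Steps (loop p) (entry p) τ₁ n' b τ₂ →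
    Steps (loop p) s τ (n + n') b τ₂
  loop-more p (exit e) r = go (cong (map₁ (afterLoop p)) e) r
  loop-more p (go e r') r = go (cong (map₁ (afterLoop p)) e) (loop-more p r' r)

  big⇒steps : ∀ {p τ n b τ'} → Big p τ n b τ' → Steps p (entry p) τ n b τ'
  big⇒steps (b-act {f} {τ} e) = exit (cong (λ { (a , m , b) → inj₂ b , a , m }) e)
  big⇒steps (b-bind {p} {k} h h') = then-K p k (big⇒steps h) (big⇒steps h')
  big⇒steps (b-stop {p} h) = loop-stop p (big⇒steps h)
  big⇒steps (b-more {p} h h') = loop-more p (big⇒steps h) (big⇒steps h')

  -- Compilation into a Turing machine

  module Machine (p : Prog) where
    FS : Finite (Maybe (St p))
    FS = finite-Maybe {{finite-St p}}

    encΓ : Γ → Fin (3 + Finite.size FX)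
    encΓ □ = zero
    encΓ (bt false) = suc zero
    encΓ (bt true) = suc (suc zero)
    encΓ (ext x) = suc (suc (suc (enc x)))

    decΓ : Fin (3 + Finite.size FX) → Γ
    decΓ zero = □
    decΓ (suc zero) = bt false
    decΓ (suc (suc zero)) = bt true
    decΓ (suc (suc (suc i))) = ext (dec i)

    decΓ-encΓ : ∀ a → decΓ (encΓ a) ≡ a
    decΓ-encΓ □ = refl
    decΓ-encΓ (bt false) = refl
    decΓ-encΓ (bt true) = refl
    decΓ-encΓ (ext x) = cong ext (dec-enc x)

    toState : St p ⊎ Bool → Maybe (St p)
    toState (inj₁ s) = just s
    toState (inj₂ _) = nothing

    δM : Maybe (St p) → Γ → Maybe (St p) × Γ × Move
    δM nothing a = nothing , a , stay
    δM (just s) a = map₁ toState (δp p s a)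

    machine : TM
    machine = record
      { nQ = Finite.size FS
      ; g = Finite.size FX
      ; start = Finite.enc FS (just (entry p))
      ; halting = λ q → not (isNode (Finite.dec FS q))
      ; accepting = λ _ → false
      ; δ = λ q a → let (s , b , m) = δM (Finite.dec FS q) (decΓ a) in Finite.enc FS s , encΓ b , m }

    config : Maybe (St p) → Tape → Config machine
    config s (l , a , r) = cfg (Finite.enc FS s) (map encΓ l) (encΓ a) (map encΓ r)

    config-move : ∀ s m l a r → moveC machine (Finite.enc FS s) (map encΓ l) (encΓ a) (map encΓ r) m ≡ config s (move m l a r)
    config-move s stay l a r = refl
    config-move s left [] a r = refl
    config-move s left (x ∷ l) a r = refl
    config-move s right l a [] = refl
    config-move s right l a (x ∷ r) = refl

    step-config : ∀ s τ {s' a m} → δp p s (cur τ) ≡ (s' , a , m) →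
      stepC machine (config (just s) τ) ≡ config (toState s') (put τ a m)
    step-config s (l , c , r) {s'} {a} {m} e = trans
      (unhalted (Finite.enc FS (just s)) (map encΓ l) (encΓ c) (map encΓ r) (cong (not ∘ isNode) (Finite.dec-enc FS (just s))))
      (trans (cong (λ d → moveC machine (Finite.enc FS (proj₁ d)) (map encΓ l) (encΓ (proj₁ (proj₂ d))) (map encΓ r) (proj₂ (proj₂ d)))
          (trans (cong₂ δM (Finite.dec-enc FS (just s)) (decΓ-encΓ c)) (cong (map₁ toState) e)))
        (config-move (toState s') m l a r))
      where
      unhalted : ∀ q l a r → TM.halting machine q ≡ false → stepC machine (cfg q l a r) ≡
        moveC machine (proj₁ (TM.δ machine q a)) l (proj₁ (proj₂ (TM.δ machine q a))) r (proj₂ (proj₂ (TM.δ machine q a)))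
      unhalted q l a r h rewrite h = refl

    run-config : ∀ {s τ n b τ'} → Steps p s τ n b τ' → runC machine n (config (just s) τ) ≡ config nothing τ'
    run-config {s} {τ} (exit e) = step-config s τ e
    run-config {s} {τ} (go {n = n} e r) = trans (cong (runC machine n) (step-config s τ e)) (run-config r)

    halted : ∀ τ → TM.halting machine (Config.state (config nothing τ)) ≡ true
    halted τ = cong (not ∘ isNode) (Finite.dec-enc FS nothing)

    initTape : List Bool → Tape
    initTape [] = [] , □ , []
    initTape (b ∷ x) = [] , bt b , map bt x

    encΓ-bt : ∀ b → encΓ (bt b) ≡ bit machine b
    encΓ-bt true = refl
    encΓ-bt false = refl

    init-config : ∀ x → initC machine x ≡ config (just (entry p)) (initTape x)
    init-config [] = refl
    init-config (b ∷ x) = cong₂ (cfg (Finite.enc FS (just (entry p))) []) (sym (encΓ-bt b))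
      (trans (map-cong (λ b → sym (encΓ-bt b)) x) (map-∘ x))

    read-output : ∀ w → readBits machine (map encΓ (map bt w ++ □ ∷ [])) ≡ w
    read-output [] = refl
    read-output (true ∷ w) = cong (true ∷_) (read-output w)
    read-output (false ∷ w) = cong (false ∷_) (read-output w)

    polytime : (f : List Bool → List Bool) (c : ℕ) → (∀ x → Σ ℕ λ n → n ≤ (length x + 2) ^ c × Σ Bool λ b → Σ Tape λ τ →
      Big p (initTape x) n b τ × cur τ ∷ proj₂ (proj₂ τ) ≡ map bt (f x) ++ □ ∷ []) → PolyTimeComputable f
    polytime f c h = machine , c , λ x → result x (h x)
      where
      result : ∀ x → _ → HaltsWithin machine ((length x + 2) ^ c) x ×
        output machine (runC machine ((length x + 2) ^ c) (initC machine x)) ≡ f x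
      result x (n , n≤ , b , τ , big , out) =
        subst (λ d → TM.halting machine (Config.state d) ≡ true) (sym final) (halted τ) ,
        trans (cong (output machine) final) (trans (cong (readBits machine ∘ map encΓ) out) (read-output (f x)))
        where
        final' : runC machine n (initC machine x) ≡ config nothing τ
        final' = trans (cong (runC machine n) (init-config x)) (run-config (big⇒steps big))
        final : runC machine ((length x + 2) ^ c) (initC machine x) ≡ config nothing τ
        final = trans (runC-≤ machine (initC machine x) n≤
          (subst (λ d → TM.halting machine (Config.state d) ≡ true) (sym final') (halted τ))) final'

-- The reduction as a program

module Writer (c : ℕ) where

  -- The tape holds `home`, a work area, `sep` and the output so far. The work area is the input,
  -- whose letters become cells as they are translated; a cell has c marks, one for each nested
  -- loop.
  data Ext : Set where
    home sep : Ext
    cell     : Vec Bool c → Ext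

  finite-Ext : Finite Ext
  finite-Ext = retract {B = Bool ⊎ Vec Bool c}
    (λ { home → inj₁ true ; sep → inj₁ false ; (cell v) → inj₂ v })
    (λ { (inj₁ true) → home ; (inj₁ false) → sep ; (inj₂ v) → cell v })
    (λ { home → refl ; sep → refl ; (cell v) → refl })

  open Programs Ext {{finite-Ext}} public

  Does : Prog → Tape → ℕ → Bool → Tape → Set
  Does p τ N b τ' = Σ ℕ λ n → n ≤ N × Big p τ n b τ'

  does-bind : ∀ {p k τ N b τ₁ N' b' τ₂} → Does p τ N b τ₁ → Does (k b) τ₁ N' b' τ₂ → Does (bind p k) τ (N + N') b' τ₂
  does-bind (n , n≤ , h) (n' , n'≤ , h') = n + n' , +-mono-≤ n≤ n'≤ , b-bind h h'

  does-more : ∀ {p τ N τ₁ N' b τ₂} → Does p τ N false τ₁ → Does (loop p) τ₁ N' b τ₂ → Does (loop p) τ (N + N') b τ₂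
  does-more (n , n≤ , h) (n' , n'≤ , h') = n + n' , +-mono-≤ n≤ n'≤ , b-more h h'

  does-stop : ∀ {p τ N τ₁} → Does p τ N true τ₁ → Does (loop p) τ N true τ₁
  does-stop (n , n≤ , h) = n , n≤ , b-stop h

  weaken : ∀ {p τ N N' b τ'} → N ≤ N' → Does p τ N b τ' → Does p τ N' b τ'
  weaken N≤ (n , n≤ , h) = n , ≤-trans n≤ N≤ , h

  exactly : ∀ {p τ n b τ'} → Big p τ n b τ' → Does p τ n b τ'
  exactly {n = n} h = n , ≤-refl , h

  from : ∀ {p τ τ₀ n b τ'} → τ ≡ τ₀ → Big p τ n b τ' → Big p τ₀ n b τ'
  from refl h = h

  to : ∀ {p τ n b τ' τ''} → τ' ≡ τ'' → Big p τ n b τ' → Big p τ n b τ''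
  to refl h = h

  does-from : ∀ {p τ τ₀ N b τ'} → τ ≡ τ₀ → Does p τ N b τ' → Does p τ₀ N b τ'
  does-from refl d = d

  does-to : ∀ {p τ N b τ' τ''} → τ' ≡ τ'' → Does p τ N b τ' → Does p τ N b τ''
  does-to refl d = d

  infixr 4 _⨟_

  _⨟_ : Prog → Prog → Prog
  p ⨟ q = bind p λ _ → q

  ret : Bool → Prog
  ret b = act λ a → a , stay , b

  does-ret : ∀ b τ → Does (ret b) τ 1 b τ
  does-ret b (l , a , r) = exactly (b-act {a = a} {m = stay} refl)

  mk : List Γ → List Γ → Tape
  mk l [] = l , □ , []
  mk l (a ∷ r) = l , a , r

  move-right : ∀ l a r → move right l a r ≡ mk (a ∷ l) r
  move-right l a [] = refl
  move-right l a (x ∷ r) = refl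

  scanR : (Γ → Bool) → Prog
  scanR stop = loop (act λ a → if stop a then a , stay , true else a , right , false)

  scanL : (Γ → Γ) → (Γ → Bool) → Prog
  scanL f stop = loop (act λ a → if stop a then a , stay , true else f a , left , false)

  Passes : (Γ → Bool) → Γ → Set
  Passes stop a = stop a ≡ false

  private
    choose : ∀ {A : Set} {b b' : Bool} {x y : A} → b ≡ b' → (if b then x else y) ≡ (if b' then x else y)
    choose refl = refl

  scanR-big : ∀ stop u {l s r} → All (Passes stop) u → stop s ≡ true →
    Big (scanR stop) (mk l (u ++ s ∷ r)) (suc (length u)) true (mk (u ʳ++ l) (s ∷ r))
  scanR-big stop [] [] e = b-stop (b-act (choose e))
  scanR-big stop (a ∷ u) {l} {s} {r} (p ∷ ps) e = b-more (b-act (choose p))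
    (from (sym (move-right l a (u ++ s ∷ r))) (scanR-big stop u ps e))

  scanR-end : ∀ stop u {l} → All (Passes stop) u → stop □ ≡ true →
    Big (scanR stop) (mk l u) (suc (length u)) true (u ʳ++ l , □ , [])
  scanR-end stop [] [] e = b-stop (b-act (choose e))
  scanR-end stop (a ∷ u) {l} (p ∷ ps) e = b-more (b-act (choose p))
    (from (sym (move-right l a u)) (scanR-end stop u ps e))

  scanL-big : ∀ f stop v {l s a r} → All (Passes stop) v → Passes stop a → stop s ≡ true →
    Big (scanL f stop) (v ++ s ∷ l , a , r) (2 + length v) true (l , s , map f v ʳ++ (f a ∷ r))
  scanL-big f stop [] [] pa e = b-more (b-act (choose pa)) (b-stop (b-act (choose e)))
  scanL-big f stop (b ∷ v) (p ∷ ps) pa e = b-more (b-act (choose pa)) (scanL-big f stop v ps p e)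

  isBlank isHome isSep : Γ → Bool
  isBlank □ = true
  isBlank _ = false
  isHome (ext home) = true
  isHome _ = false
  isSep (ext sep) = true
  isSep _ = false

  all-ʳ++ : ∀ {P : Γ → Set} {u v} → All P u → All P v → All P (u ʳ++ v)
  all-ʳ++ [] qs = qs
  all-ʳ++ (p ∷ ps) qs = all-ʳ++ ps (p ∷ qs)

  return-big : ∀ f u {a r} → All (Passes isHome) u → Passes isHome a →
    Big (scanL f isHome) ((ext home ∷ u) ʳ++ [] , a , r) (2 + length u) true ([] , ext home , map f u ++ f a ∷ r)
  return-big f u {a} {r} ps pa = subst₂ (λ l n → Big (scanL f isHome) (l , a , r) n true ([] , ext home , map f u ++ f a ∷ r))
    (sym (ʳ++-defn u)) (cong (2 +_) (length-reverse u))
    (to (cong (λ w → [] , ext home , w) collect)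
      (scanL-big f isHome (List.reverse u) (all-ʳ++ ps []) pa refl))
    where
    collect : map f (List.reverse u) ʳ++ (f a ∷ r) ≡ map f u ++ f a ∷ r
    collect = trans (cong (_ʳ++ (f a ∷ r)) (map-ʳ++ f u)) (ʳ++-ʳ++ (map f u))

  goHome : Prog
  goHome = scanL id isHome

  goHome-big : ∀ u {a r} → All (Passes isHome) u → Passes isHome a →
    Big goHome ((ext home ∷ u) ʳ++ [] , a , r) (2 + length u) true ([] , ext home , u ++ a ∷ r)
  goHome-big u {a} {r} ps pa = to (cong (λ w → [] , ext home , w ++ a ∷ r) (map-id u)) (return-big id u ps pa)

  HT : List Γ → List Bool → Tape
  HT X O = [] , ext home , X ++ ext sep ∷ map bt O ++ □ ∷ []

  writeP : List Bool → Prog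
  writeP [] = ret true
  writeP (b ∷ w) = act (λ _ → bt b , right , true) ⨟ writeP w

  writeP-big : ∀ w l → Big (writeP w) (l , □ , []) (suc (length w)) true (map bt w ʳ++ l , □ , [])
  writeP-big [] l = b-act refl
  writeP-big (b ∷ w) l = b-bind (b-act refl) (writeP-big w (bt b ∷ l))

  append : List Bool → Prog
  append w = scanR isBlank ⨟ writeP w ⨟ goHome

  Plain : Γ → Set
  Plain a = Passes isBlank a × Passes isHome a

  all-bt : ∀ {P : Γ → Set} → (∀ b → P (bt b)) → ∀ w → All P (map bt w)
  all-bt h [] = []
  all-bt h (b ∷ w) = h b ∷ all-bt h w

  all-++ : ∀ {P : Γ → Set} {u v} → All P u → All P v → All P (u ++ v)
  all-++ [] qs = qs
  all-++ (p ∷ ps) qs = p ∷ all-++ ps qs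

  length-tape : ∀ X O → length (X ++ ext sep ∷ map bt O) ≡ length X + suc (length O)
  length-tape X O = trans (length-++ X) (cong (λ n → length X + suc n) (length-map bt O))

  append-does : ∀ w X O → All Plain X →
    Does (append w) (HT X O) (2 * (length X + length O + length w) + 8) true (HT X (O ++ w))
  append-does w X O ps = weaken (≤-trans (m≤m+n _ 1) (≤-reflexive (trans (cong₂ (λ a b → suc (suc a) + (suc (length w) + (2 + b)) + 1)
      (length-tape X O) (trans (length-tape X (O ++ w)) (cong (λ n → length X + suc n) (length-++ O))))
      (arith (length X) (length O) (length w)))))
    (exactly (b-bind there' (b-bind (writeP-big w _) back)))
    where
    content : List Γ
    content = X ++ ext sep ∷ map bt O
    there' : Big (scanR isBlank) (HT X O) (suc (suc (length content))) true ((ext home ∷ content) ʳ++ [] , □ , [])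
    there' = from (cong (λ u → [] , ext home , u) (++-assoc X (ext sep ∷ map bt O) (□ ∷ [])))
      (scanR-big isBlank (ext home ∷ content) (refl ∷ all-++ (All.map proj₁ ps) (refl ∷ all-bt (λ _ → refl) O)) refl)
    content' : List Γ
    content' = X ++ ext sep ∷ map bt (O ++ w)
    back : Big goHome (map bt w ʳ++ ((ext home ∷ content) ʳ++ []) , □ , []) (2 + length content') true (HT X (O ++ w))
    back = from (cong (λ l → l , □ , []) joined) (to (cong (λ u → [] , ext home , u) (++-assoc X (ext sep ∷ map bt (O ++ w)) (□ ∷ [])))
      (goHome-big content' (all-++ (All.map proj₂ ps) (refl ∷ all-bt (λ _ → refl) (O ++ w))) refl))
      where
      joined : (ext home ∷ content') ʳ++ [] ≡ map bt w ʳ++ ((ext home ∷ content) ʳ++ [])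
      joined = trans (cong (λ u → (ext home ∷ u) ʳ++ [])
          (trans (cong (λ v → X ++ ext sep ∷ v) (map-++ bt O w)) (sym (++-assoc X (ext sep ∷ map bt O) (map bt w)))))
        (++-ʳ++ (ext home ∷ content))
    arith : ∀ x o w → suc (suc (x + suc o)) + (suc w + (2 + (x + suc (o + w)))) + 1 ≡ 2 * (x + o + w) + 8
    arith = solve-∀

  initP : Prog
  initP = act (λ a → a , left , true) ⨟ act (λ _ → ext home , right , true) ⨟ scanR isBlank ⨟
    act (λ _ → ext sep , right , true) ⨟ goHome

  initT : List Bool → Tape
  initT x = mk [] (map bt x)

  initP-does : ∀ x → Does initP (initT x) (2 * length x + 7) true (HT (map bt x) [])
  initP-does x = weaken (≤-reflexive (trans (cong₂ (λ a b → 1 + (1 + (suc a + (1 + (2 + b))))) (length-map bt x)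
      (trans (length-++ (map bt x)) (cong (_+ 1) (length-map bt x)))) (arith (length x))))
    (exactly (b-bind (b-act refl) (b-bind (b-act refl) (b-bind (start-scan x) (b-bind (b-act refl) back)))))
    where
    arith : ∀ n → 1 + (1 + (suc n + (1 + (2 + (n + 1))))) ≡ 2 * n + 7
    arith = solve-∀
    start-scan : ∀ x → Big (scanR isBlank) (put (put (initT x) (cur (initT x)) left) (ext home) right)
      (suc (length (map bt x))) true (map bt x ʳ++ (ext home ∷ []) , □ , [])
    start-scan [] = scanR-end isBlank [] [] refl
    start-scan (b ∷ x) = scanR-end isBlank (bt b ∷ map bt x) (refl ∷ all-bt (λ _ → refl) x) refl
    back : Big goHome (ext sep ∷ (map bt x ʳ++ (ext home ∷ [])) , □ , []) (2 + length (map bt x ++ ext sep ∷ [])) true (HT (map bt x) [])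
    back = from (cong (λ l → l , □ , []) (++-ʳ++ (ext home ∷ map bt x)))
      (to (cong (λ u → [] , ext home , u) (++-assoc (map bt x) (ext sep ∷ []) (□ ∷ [])))
        (goHome-big (map bt x ++ ext sep ∷ []) (all-++ (all-bt (λ _ → refl) x) (refl ∷ [])) refl))

  finishP : Prog
  finishP = scanR isSep ⨟ act (λ a → a , right , true)

  finishP-does : ∀ X O → All (Passes isSep) X → Σ Tape λ τ →
    Does finishP (HT X O) (length X + 3) true τ × cur τ ∷ proj₂ (proj₂ τ) ≡ map bt O ++ □ ∷ []
  finishP-does X O ps = _ , weaken (≤-reflexive (arith (length X)))
    (exactly (b-bind (scanR-big isSep (ext home ∷ X) (refl ∷ ps) refl) (b-act refl))) , shape O
    where
    arith : ∀ n → suc (suc n) + 1 ≡ n + 3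
    arith = solve-∀
    shape : ∀ O → let τ = move right ((ext home ∷ X) ʳ++ []) (ext sep) (map bt O ++ □ ∷ []) in
      cur τ ∷ proj₂ (proj₂ τ) ≡ map bt O ++ □ ∷ []
    shape [] = refl
    shape (b ∷ O) = refl

  clear : Vec Bool c
  clear = Vec.replicate c false

  cs : List (Vec Bool c) → List Γ
  cs = map (ext ∘ cell)

  cs-++ : ∀ us vs r → cs (us ++ vs) ++ r ≡ cs us ++ cs vs ++ r
  cs-++ us vs r = trans (cong (_++ r) (map-++ (ext ∘ cell) us vs)) (++-assoc (cs us) (cs vs) r)

  all-cs : ∀ {P : Γ → Set} → (∀ v → P (ext (cell v))) → ∀ vs → All P (cs vs)
  all-cs h [] = []
  all-cs h (v ∷ vs) = h v ∷ all-cs h vs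

  length-cs : ∀ vs → length (cs vs) ≡ length vs
  length-cs = length-map (ext ∘ cell)

  -- Covers one round of any loop on a tape of size L. The most expensive is that of `loopX`: two
  -- sweeps over the work area and an `append`, which crosses the whole tape twice.
  roundCost : ℕ → ℕ
  roundCost L = 4 * L + 20

  -- Translating the input letter by letter

  module _ (h : Bool → List Bool) where

    stopX : Γ → Bool
    stopX (ext home) = false
    stopX (ext (cell _)) = false
    stopX _ = true

    consume : Γ → Γ × Move × Bool
    consume (bt b) = ext (cell clear) , stay , b
    consume a = a , stay , true

    afterX : Bool → Prog
    afterX true = goHome ⨟ ret true
    -- The letter that is overwritten survives in the control state, as the result of `consume`.
    afterX false = bind (act consume) λ b → goHome ⨟ append (h b) ⨟ ret false

    loopX : Prog
    loopX = loop (scanR stopX ⨟ bind (act λ a → a , stay , isSep a) afterX)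

    private
      tapeTail : List Bool → List Bool → List Γ
      tapeTail x O = map bt x ++ ext sep ∷ map bt O ++ □ ∷ []

      scan : ∀ vs s r → stopX s ≡ true → Does (scanR stopX) ([] , ext home , cs vs ++ s ∷ r) (2 + length vs) true
        ((ext home ∷ cs vs) ʳ++ [] , s , r)
      scan vs s r e = weaken (≤-reflexive (cong (2 +_) (length-cs vs)))
        (exactly (scanR-big stopX (ext home ∷ cs vs) (refl ∷ all-cs (λ _ → refl) vs) e))

      back : ∀ vs a r → Passes isHome a → Does goHome ((ext home ∷ cs vs) ʳ++ [] , a , r) (2 + length vs) true
        ([] , ext home , cs vs ++ a ∷ r)
      back vs a r e = weaken (≤-reflexive (cong (2 +_) (length-cs vs))) (exactly (goHome-big (cs vs) (all-cs (λ _ → refl) vs) e))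

    -- The sum in the hypothesis is the size reached at the end. It is invariant, as letters only
    -- become cells and pending output becomes written output, so one bound serves all rounds.
    loopX-does : ∀ x vs O L → length vs + length x + (length O + length (concatMap h x)) ≤ L →
      Does loopX (HT (cs vs ++ map bt x) O) (suc (length x) * roundCost L) true
        (HT (cs (vs ++ List.replicate (length x) clear)) (O ++ concatMap h x))
    loopX-does [] vs O L size = weaken cost
      (does-from (cong (λ u → [] , ext home , u) (sym (++-assoc (cs vs) [] _)))
        (does-to (cong₂ HT (cong cs (sym (++-identityʳ vs))) (sym (++-identityʳ O)))
          (does-stop (does-bind (scan vs (ext sep) _ refl) (does-bind (exactly (b-act {a = ext sep} {m = stay} refl))
            (does-bind (back vs (ext sep) _ refl) (does-ret true _)))))))
      where
      vs≤ : length vs ≤ L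
      vs≤ = ≤-trans (≤-trans (m≤m+n (length vs) 0) (m≤m+n _ _)) size
      arith : ∀ L → (2 + L) + (1 + ((2 + L) + 1)) + (2 * L + 14) ≡ 1 * (4 * L + 20)
      arith = solve-∀
      cost : (2 + length vs) + (1 + ((2 + length vs) + 1)) ≤ 1 * roundCost L
      cost = ≤-trans (+-mono-≤ (+-monoʳ-≤ 2 vs≤) (+-monoʳ-≤ 1 (+-monoˡ-≤ 1 (+-monoʳ-≤ 2 vs≤)))) (≤-trans (m≤m+n _ (2 * L + 14)) (≤-reflexive (arith L)))
    loopX-does (b ∷ x) vs O L size =
      does-to (cong₂ HT (cong cs (++-assoc vs (clear ∷ []) _)) (++-assoc O (h b) _))
        (does-more (weaken cost
          (does-from (cong (λ u → [] , ext home , u) (sym (++-assoc (cs vs) (map bt (b ∷ x)) _)))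
            (does-bind (scan vs (bt b) _ refl) (does-bind (exactly (b-act {a = bt b} {m = stay} refl))
              (does-bind (exactly (b-act {a = ext (cell clear)} {m = stay} refl))
                (does-bind (does-to (cong (λ u → [] , ext home , u) rejoin) (back vs (ext (cell clear)) (tapeTail x O) refl))
                  (does-bind (append-does (h b) X O plain) (does-ret false _))))))))
          (loopX-does x (vs ++ clear ∷ []) (O ++ h b) L size'))
      where
      X : List Γ
      X = cs (vs ++ clear ∷ []) ++ map bt x
      plain : All Plain X
      plain = all-++ (all-cs (λ _ → refl , refl) _) (all-bt (λ _ → refl , refl) x)
      rejoin : cs vs ++ ext (cell clear) ∷ tapeTail x O ≡ X ++ ext sep ∷ map bt O ++ □ ∷ []
      rejoin = trans (sym (cs-++ vs (clear ∷ []) (tapeTail x O))) (sym (++-assoc (cs (vs ++ clear ∷ [])) (map bt x) _))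
      lenX : length X ≡ length vs + length (b ∷ x)
      lenX = trans (length-++ (cs (vs ++ clear ∷ []))) (trans (cong₂ _+_ (trans (length-cs (vs ++ clear ∷ [])) (length-++ vs)) (length-map bt x))
        (+-assoc (length vs) 1 (length x)))
      size₁ : length vs + length (b ∷ x) + (length O + (length (h b) + length (concatMap h x))) ≤ L
      size₁ = subst (λ n → length vs + length (b ∷ x) + (length O + n) ≤ L) (length-++ (h b)) size
      size' : length (vs ++ clear ∷ []) + length x + (length (O ++ h b) + length (concatMap h x)) ≤ L
      size' = subst₂ (λ p q → p + length x + (q + length (concatMap h x)) ≤ L) (sym (length-++ vs)) (sym (length-++ O))
        (≤-trans (≤-reflexive (shuffle (length vs) (length x) (length O) (length (h b)) (length (concatMap h x)))) size₁)
        where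
        shuffle : ∀ v x o k r → v + 1 + x + (o + k + r) ≡ v + suc x + (o + (k + r))
        shuffle = solve-∀
      vs≤ : length vs ≤ L
      vs≤ = ≤-trans (≤-trans (m≤m+n (length vs) _) (m≤m+n _ _)) size
      app≤ : length X + length O + length (h b) ≤ L
      app≤ = ≤-trans (≤-trans (m≤m+n _ (length (concatMap h x))) (≤-reflexive (trans (cong (λ n → n + length O + length (h b) + length (concatMap h x)) lenX)
        (shuffle (length vs + length (b ∷ x)) (length O) (length (h b)) (length (concatMap h x)))))) size₁
        where
        shuffle : ∀ v o k r → v + o + k + r ≡ v + (o + (k + r))
        shuffle = solve-∀
      arith : ∀ L → (2 + L) + (1 + (1 + ((2 + L) + ((2 * L + 8) + 1)))) + 5 ≡ 4 * L + 20
      arith = solve-∀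
      cost : (2 + length vs) + (1 + (1 + ((2 + length vs) + ((2 * (length X + length O + length (h b)) + 8) + 1)))) ≤ roundCost L
      cost = ≤-trans (+-mono-≤ (+-monoʳ-≤ 2 vs≤) (+-monoʳ-≤ 1 (+-monoʳ-≤ 1 (+-mono-≤ (+-monoʳ-≤ 2 vs≤) (+-monoˡ-≤ 1 (+-monoˡ-≤ 8 (*-monoʳ-≤ 2 app≤)))))))
        (≤-trans (m≤m+n _ 5) (≤-reflexive (arith L)))

  -- Writing a string polynomially often

  module _ (w : List Bool) where

    stopM : Fin c → Γ → Bool
    stopM i (ext home) = false
    stopM i (ext (cell v)) = not (lookup v i)
    stopM i _ = true

    setMark : Fin c → Γ → Γ × Move × Bool
    setMark i (ext (cell v)) = ext (cell (v Vec.[ i ]≔ true)) , stay , false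
    setMark i a = a , stay , true

    unmark : Fin c → Γ → Γ
    unmark i (ext (cell v)) = ext (cell (v Vec.[ i ]≔ false))
    unmark i a = a

    afterM : Fin c → Bool → Prog
    afterM i true = scanL (unmark i) isHome ⨟ ret true
    afterM i false = goHome ⨟ ret false

    -- Appends w (suc n) ^ k times if there are n cells; the counter of the
    -- k-th loop is the number of cells whose k-th mark is set.
    nest : ∀ k → k ≤ c → Prog
    nest zero _ = append w
    nest (suc k) k<c = loop (nest k (<⇒≤ k<c) ⨟ scanR (stopM (fromℕ< k<c)) ⨟ bind (act (setMark (fromℕ< k<c))) (afterM (fromℕ< k<c)))

    nestCost : ℕ → ℕ → ℕ → ℕ
    nestCost L m zero = roundCost L
    nestCost L m (suc k) = suc m * (nestCost L m k + roundCost L)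

    Clear : ℕ → Vec Bool c → Set
    Clear k v = ∀ i → toℕ i < k → lookup v i ≡ false

    -- A loop runs its body before it looks for an unmarked cell, so once per cell and once more,
    -- whence the base of the power. The final round erases the marks of this loop, so that the
    -- enclosing loop can start it again; inner loops touch lower marks only.
    nest-does : ∀ k k≤c vs → All (Clear k) vs → ∀ O L → length vs + (length O + suc (length vs) ^ k * length w) ≤ L →
      Does (nest k k≤c) (HT (cs vs) O) (nestCost L (length vs) k) true (HT (cs vs) (O ++ power w (suc (length vs) ^ k)))
    nest-does zero k≤c vs _ O L size = weaken cost
      (does-to (cong (λ u → HT (cs vs) (O ++ u)) (sym (++-identityʳ w))) (append-does w (cs vs) O (all-cs (λ _ → refl , refl) vs)))
      where
      arith : ∀ L → 2 * L + 8 + (2 * L + 12) ≡ 4 * L + 20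
      arith = solve-∀
      size' : length (cs vs) + length O + length w ≤ L
      size' = ≤-trans (≤-reflexive (trans (cong (λ n → n + length O + length w) (length-cs vs))
        (trans (+-assoc (length vs) (length O) (length w)) (cong (λ n → length vs + (length O + n)) (sym (+-identityʳ (length w))))))) size
      cost : 2 * (length (cs vs) + length O + length w) + 8 ≤ roundCost L
      cost = ≤-trans (+-monoˡ-≤ 8 (*-monoʳ-≤ 2 size')) (≤-trans (m≤m+n _ (2 * L + 12)) (≤-reflexive (arith L)))
    nest-does (suc k) k<c vs clears O L size =
      iterate [] vs O clears refl size
      where
      i : Fin c
      i = fromℕ< k<c
      m : ℕ
      m = length vs
      E : ℕ
      E = suc m ^ k
      set : Vec Bool c → Vec Bool c
      set v = v Vec.[ i ]≔ true
      i≡k : toℕ i ≡ k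
      i≡k = Finₚ.toℕ-fromℕ< k<c
      clear-i : ∀ v → Clear (suc k) v → lookup v i ≡ false
      clear-i v cl = cl i (s≤s (≤-reflexive i≡k))
      clear-set : ∀ v → Clear (suc k) v → Clear k (set v)
      clear-set v cl j j<k = trans (Vecₚ.lookup∘updateAt′ j i (λ e → <-irrefl (trans (cong toℕ e) i≡k) j<k) v) (cl j (m≤n⇒m≤1+n j<k))
      unset : ∀ v → Clear (suc k) v → set v Vec.[ i ]≔ false ≡ v
      unset v cl = trans (Vecₚ.[]≔-idempotent v i) (trans (cong (v Vec.[ i ]≔_) (sym (clear-i v cl))) (Vecₚ.[]≔-lookup v i))
      rest : List Bool → List Γ
      rest O = ext sep ∷ map bt O ++ □ ∷ []
      all-set : ∀ {us} → All (Clear (suc k)) us → All (Clear k) (map set us)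
      all-set [] = []
      all-set {v ∷ _} (p ∷ ps) = clear-set v p ∷ all-set ps
      all-append : ∀ {us us'} → All (Clear k) us → All (Clear (suc k)) us' → All (Clear k) (us ++ us')
      all-append [] qs = All.map (λ cl j j< → cl j (m≤n⇒m≤1+n j<)) qs
      all-append (p ∷ ps) qs = p ∷ all-append ps qs
      split : ∀ done {todo} → All (Clear (suc k)) (done ++ todo) → All (Clear (suc k)) done × All (Clear (suc k)) todo
      split [] ps = [] , ps
      split (_ ∷ done) (p ∷ ps) = map₁ (p ∷_) (split done ps)
      passes : ∀ done → All (Passes (stopM i)) (cs (map set done))
      passes [] = []
      passes (v ∷ done) = cong not (Vecₚ.lookup∘updateAt i v) ∷ passes done
      restore : ∀ {done} → All (Clear (suc k)) done → map (unmark i) (cs (map set done)) ≡ cs done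
      restore [] = refl
      restore {v ∷ _} (p ∷ ps) = cong₂ _∷_ (cong (ext ∘ cell) (unset v p)) (restore ps)
      lenset : ∀ done → length (cs (map set done)) ≡ length done
      lenset done = trans (length-cs (map set done)) (length-map set done)
      scan : ∀ done s r → stopM i s ≡ true → length done ≤ L →
        Does (scanR (stopM i)) ([] , ext home , cs (map set done) ++ s ∷ r) (2 + L) true ((ext home ∷ cs (map set done)) ʳ++ [] , s , r)
      scan done s r e d≤ = weaken (+-monoʳ-≤ 2 (≤-trans (≤-reflexive (lenset done)) d≤))
        (exactly (scanR-big (stopM i) (ext home ∷ cs (map set done)) (refl ∷ passes done) e))
      back : ∀ f done a r → Passes isHome a → length done ≤ L → Does (scanL f isHome) ((ext home ∷ cs (map set done)) ʳ++ [] , a , r)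
        (2 + L) true ([] , ext home , map f (cs (map set done)) ++ f a ∷ r)
      back f done a r e d≤ = weaken (+-monoʳ-≤ 2 (≤-trans (≤-reflexive (lenset done)) d≤))
        (exactly (return-big f (cs (map set done)) (all-cs (λ _ → refl) (map set done)) e))
      arith : ∀ t L → t + ((2 + L) + (1 + ((2 + L) + 1))) + (2 * L + 14) ≡ t + (4 * L + 20)
      arith = solve-∀
      cost : nestCost L m k + ((2 + L) + (1 + ((2 + L) + 1))) ≤ nestCost L m k + roundCost L
      cost = ≤-trans (m≤m+n _ (2 * L + 14)) (≤-reflexive (arith (nestCost L m k) L))
      inside : ∀ us → length us ≡ m → All (Clear k) us → ∀ O → m + (length O + E * length w) ≤ L →
        Does (nest k (<⇒≤ k<c)) (HT (cs us) O) (nestCost L m k) true (HT (cs us) (O ++ power w E))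
      inside us e cl O size = subst (λ n → Does (nest k (<⇒≤ k<c)) (HT (cs us) O) (nestCost L n k) true (HT (cs us) (O ++ power w (suc n ^ k)))) e
        (nest-does k (<⇒≤ k<c) us cl O L (subst (λ n → n + (length O + suc n ^ k * length w) ≤ L) (sym e) size))
      iterate : ∀ done todo O → All (Clear (suc k)) (done ++ todo) → done ++ todo ≡ vs →
        m + (length O + suc (length todo) * E * length w) ≤ L →
        Does (nest (suc k) k<c) (HT (cs (map set done ++ todo)) O) (suc (length todo) * (nestCost L m k + roundCost L)) true
          (HT (cs vs) (O ++ power w (suc (length todo) * E)))
      iterate done [] O cl refl size = weaken (≤-trans cost (≤-reflexive (sym (+-identityʳ _))))
        (does-stop (does-bind (inside (map set done ++ []) lenu (all-append (all-set (proj₁ (split done cl))) []) O size₁)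
          (does-from (cong (λ u → [] , ext home , u) (sym (cs-++ (map set done) [] _)))
            (does-bind (scan done (ext sep) _ refl done≤) (does-bind (exactly (b-act {a = ext sep} {m = stay} refl))
              (does-bind (back (unmark i) done (ext sep) _ refl done≤)
                (does-from (sym final) (does-ret true _))))))))
        where
        lenu : length (map set done ++ []) ≡ length (done ++ [])
        lenu = trans (length-++ (map set done)) (trans (cong (_+ 0) (length-map set done)) (sym (length-++ done)))
        size₁ : m + (length O + E * length w) ≤ L
        size₁ = subst (λ n → m + (length O + n * length w) ≤ L) (+-identityʳ E) size
        done≤ : length done ≤ L
        done≤ = ≤-trans (≤-trans (≤-reflexive (cong length (sym (++-identityʳ done)))) (m≤m+n m _)) size
        final : _≡_ {A = Tape} ([] , ext home , map (unmark i) (cs (map set done)) ++ rest (O ++ power w E)) (HT (cs (done ++ [])) (O ++ power w (1 * E)))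
        final = cong₂ (λ u e → [] , ext home , u ++ rest (O ++ power w e))
          (trans (restore (proj₁ (split done cl))) (cong cs (sym (++-identityʳ done)))) (sym (+-identityʳ E))
      iterate done (v ∷ todo) O cl refl size =
        does-to (cong (HT (cs (done ++ v ∷ todo))) (trans (++-assoc O _ _) (cong (O ++_) (sym (power-+ w E _)))))
        (does-more (weaken cost (does-bind (inside (map set done ++ v ∷ todo) lenu (all-append (all-set (proj₁ (split done cl))) (proj₂ (split done cl))) O size₁)
          (does-from (cong (λ u → [] , ext home , u) (sym (cs-++ (map set done) (v ∷ todo) _)))
            (does-bind (scan done (ext (cell v)) _ (cong not (clear-i v (All.head (proj₂ (split done cl))))) done≤)
              (does-bind (exactly (b-act {a = ext (cell (set v))} {m = stay} refl))
                (does-bind (back id done (ext (cell (set v))) _ refl done≤) (does-ret false _)))))))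
          (does-from (sym again) (iterate (done ++ v ∷ []) todo (O ++ power w E)
            (subst (All (Clear (suc k))) (sym (++-assoc done _ _)) cl) (++-assoc done _ _) size₂)))
        where
        lenu : length (map set done ++ v ∷ todo) ≡ length (done ++ v ∷ todo)
        lenu = trans (length-++ (map set done)) (trans (cong (_+ _) (length-map set done)) (sym (length-++ done)))
        done≤ : length done ≤ L
        done≤ = ≤-trans (≤-trans (≤-trans (m≤m+n (length done) _) (≤-reflexive (sym (length-++ done)))) (m≤m+n m _)) size
        size₂ : m + (length (O ++ power w E) + suc (length todo) * E * length w) ≤ L
        size₂ = ≤-trans (≤-reflexive (cong (m +_) (trans (cong (_+ _) (trans (length-++ O) (cong (length O +_) (length-power w E))))
          (trans (+-assoc (length O) _ _) (cong (length O +_) (sym (*-distribʳ-+ (length w) E (suc (length todo) * E)))))))) size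
        size₁ : m + (length O + E * length w) ≤ L
        size₁ = ≤-trans (+-monoʳ-≤ m (≤-trans (≤-reflexive (sym (trans (length-++ O) (cong (length O +_) (length-power w E))))) (m≤m+n _ _))) size₂
        again : _≡_ {A = Tape} ([] , ext home , map id (cs (map set done)) ++ ext (cell (set v)) ∷ cs todo ++ rest (O ++ power w E))
          (HT (cs (map set (done ++ v ∷ []) ++ todo)) (O ++ power w E))
        again = cong (λ u → [] , ext home , u) (trans (cong (_++ ext (cell (set v)) ∷ cs todo ++ rest (O ++ power w E)) (map-id (cs (map set done))))
          (trans (sym (cs-++ (map set done) (set v ∷ todo) _)) (cong (λ us → cs us ++ rest (O ++ power w E))
            (trans (sym (++-assoc (map set done) (set v ∷ []) todo)) (cong (_++ todo) (sym (map-++ set done (v ∷ []))))))))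

-- Polynomial bounds

-- As the base is at least 2, a larger exponent absorbs constants and sums, and no coefficients are
-- needed.
PolyBounded : (ℕ → ℕ) → Set
PolyBounded f = Σ ℕ λ e → ∀ n → f n ≤ (n + 2) ^ e

n<2^n : ∀ n → n < 2 ^ n
n<2^n zero = s≤s z≤n
n<2^n (suc n) = ≤-trans (+-mono-≤ (m^n>0 2 n) (n<2^n n)) (≤-reflexive (sym (double n)))

base-mono : ∀ n {a b} → a ≤ b → (n + 2) ^ a ≤ (n + 2) ^ b
base-mono n {a} {b} h = subst (λ m → m ^ a ≤ m ^ b) (+-comm 2 n) (^-monoʳ-≤ (2 + n) h)

poly-const : ∀ a → PolyBounded (λ _ → a)
poly-const a = a , λ n → ≤-trans (<⇒≤ (n<2^n a)) (^-monoˡ-≤ a (m≤n+m 2 n))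

poly-id : PolyBounded id
poly-id = 1 , λ n → ≤-trans (m≤m+n n 2) (≤-reflexive (sym (*-identityʳ (n + 2))))

poly-+ : ∀ {f g} → PolyBounded f → PolyBounded g → PolyBounded (λ n → f n + g n)
poly-+ (a , h) (b , h') = suc (a + b) , λ n → ≤-trans
  (+-mono-≤ (≤-trans (h n) (base-mono n (m≤m+n a b))) (≤-trans (h' n) (base-mono n (m≤n+m b a))))
  (≤-trans (≤-reflexive (cong ((n + 2) ^ (a + b) +_) (sym (+-identityʳ _)))) (*-monoˡ-≤ ((n + 2) ^ (a + b)) (m≤n+m 2 n)))

poly-* : ∀ {f g} → PolyBounded f → PolyBounded g → PolyBounded (λ n → f n * g n)
poly-* (a , h) (b , h') = a + b , λ n → ≤-trans (*-mono-≤ (h n) (h' n)) (≤-reflexive (sym (^-distribˡ-+-* (n + 2) a b)))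

poly-^ : ∀ {f} → PolyBounded f → ∀ c → PolyBounded (λ n → f n ^ c)
poly-^ p zero = poly-const 1
poly-^ p (suc c) = poly-* p (poly-^ p c)

does-polytime : ∀ c → let open Writer c in (p : Prog) (f : List Bool → List Bool) (time : ℕ → ℕ) → PolyBounded time →
  (∀ x → Σ Tape λ τ → Does p (initT x) (time (length x)) true τ × cur τ ∷ proj₂ (proj₂ τ) ≡ map bt (f x) ++ □ ∷ []) →
  PolyTimeComputable f
does-polytime c p f time (e , bound) does = Machine.polytime p f e result
  where
  open Writer c
  same-init : ∀ x → initT x ≡ Machine.initTape p x
  same-init [] = refl
  same-init (b ∷ x) = refl
  result : ∀ x → Σ ℕ λ n → n ≤ (length x + 2) ^ e × Σ Bool λ b → Σ Tape λ τ →
    Big p (Machine.initTape p x) n b τ × cur τ ∷ proj₂ (proj₂ τ) ≡ map bt (f x) ++ □ ∷ []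
  result x with does x
  ... | τ , (n , n≤ , big) , shape = n , ≤-trans n≤ (bound (length x)) , true , τ , from (same-init x) big , shape

-- The transducer and its running time

module Reducer (c : ℕ) (pre mid post w : List Bool) (h : Bool → List Bool) where
  open Writer c

  mainP : Prog
  mainP = initP ⨟ append pre ⨟ loopX h ⨟ append mid ⨟ nest w c ≤-refl ⨟ append post ⨟ finishP

  out : List Bool → List Bool
  out x = (((pre ++ concatMap h x) ++ mid) ++ power w (suc (length x) ^ c)) ++ post

  hSize : ℕ
  hSize = length (h true) + length (h false)

  tapeSize : ℕ → ℕ
  tapeSize n = n + ((((length pre + n * hSize) + length mid) + suc n ^ c * length w) + length post)

  time : ℕ → ℕ
  time n = (2 * n + 7) + (roundCost (tapeSize n) + (suc n * roundCost (tapeSize n) + (roundCost (tapeSize n) +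
    (nestCost w (tapeSize n) n c + (roundCost (tapeSize n) + (n + 3))))))

  time-poly : PolyBounded time
  time-poly = poly-+ (poly-+ (poly-* (poly-const 2) poly-id) (poly-const 7))
    (poly-+ round (poly-+ (poly-* suc-poly round) (poly-+ round (poly-+ (nested c) (poly-+ round (poly-+ poly-id (poly-const 3)))))))
    where
    suc-poly : PolyBounded suc
    suc-poly = poly-+ (poly-const 1) poly-id
    tape : PolyBounded tapeSize
    tape = poly-+ poly-id (poly-+ (poly-+ (poly-+ (poly-+ (poly-const (length pre)) (poly-* poly-id (poly-const hSize))) (poly-const (length mid)))
      (poly-* (poly-^ suc-poly c) (poly-const (length w)))) (poly-const (length post)))
    round : PolyBounded (λ n → roundCost (tapeSize n))
    round = poly-+ (poly-* (poly-const 4) tape) (poly-const 20)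
    nested : ∀ k → PolyBounded (λ n → nestCost w (tapeSize n) n k)
    nested zero = round
    nested (suc k) = poly-* suc-poly (poly-+ (nested k) round)

  private
    length-h : ∀ x → length (concatMap h x) ≤ length x * hSize
    length-h [] = z≤n
    length-h (b ∷ x) = ≤-trans (≤-reflexive (length-++ (h b))) (+-mono-≤ (one-h b) (length-h x))
      where
      one-h : ∀ b → length (h b) ≤ hSize
      one-h true = m≤m+n _ _
      one-h false = m≤n+m _ _

    append-round : ∀ u X O n → All Plain X → length X ≡ n → ∀ L → n + (length O + length u) ≤ L →
      Does (append u) (HT X O) (roundCost L) true (HT X (O ++ u))
    append-round u X O n ps refl L size = weaken (≤-trans (+-monoˡ-≤ 8 (*-monoʳ-≤ 2 (≤-trans (≤-reflexive (+-assoc (length X) (length O) (length u))) size)))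
      (≤-trans (m≤m+n _ (2 * L + 12)) (≤-reflexive (arith L)))) (append-does u X O ps)
      where
      arith : ∀ L → 2 * L + 8 + (2 * L + 12) ≡ 4 * L + 20
      arith = solve-∀

  mainP-does : ∀ x → Σ Tape λ τ → Does mainP (initT x) (time (length x)) true τ × cur τ ∷ proj₂ (proj₂ τ) ≡ map bt (out x) ++ □ ∷ []
  mainP-does x with finishP-does (cs (List.replicate (length x) (clear))) (out x) (all-cs (λ _ → refl) _)
  ... | τ , finish , shape = τ , does-bind (initP-does x)
    (does-bind (append-round pre (map bt x) [] n (all-bt (λ _ → refl , refl) x) (length-map bt x) L (fits (≤-trans (≤-trans (m≤m+n (length pre) _) (≤-reflexive (sym (length-++ pre)))) s₁)))
    (does-bind (loopX-does h x [] pre L (fits (≤-trans (≤-reflexive (sym (length-++ pre))) s₁)))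
    (does-bind (append-round mid cells O₁ n plain cells-length L (fits (≤-trans (≤-reflexive (sym (length-++ O₁))) s₂)))
    (does-bind (subst (λ m → Does (nest w c ≤-refl) (HT cells O₂) (nestCost w L m c) true (HT cells (O₂ ++ power w (suc m ^ c)))) length-rep
        (nest-does w c ≤-refl (List.replicate n clear) (all-clear n) O₂ L
          (subst (λ m → m + (length O₂ + suc m ^ c * length w) ≤ L) (sym length-rep)
            (fits (≤-trans (≤-reflexive (trans (cong (length O₂ +_) (sym (length-power w (suc n ^ c)))) (sym (length-++ O₂)))) s₃)))))
    (does-bind (append-round post cells O₃ n plain cells-length L (fits (≤-trans (≤-reflexive (sym (length-++ O₃))) s₄)))
      (weaken (≤-reflexive (cong (_+ 3) cells-length)) finish)))))) , shape
    where
    n L : ℕ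
    n = length x
    L = tapeSize n
    cells : List Γ
    cells = cs (List.replicate n clear)
    O₁ O₂ O₃ : List Bool
    O₁ = pre ++ concatMap h x
    O₂ = O₁ ++ mid
    O₃ = O₂ ++ power w (suc n ^ c)
    length-rep : length (List.replicate n clear) ≡ n
    length-rep = length-replicate n
    cells-length : length cells ≡ n
    cells-length = trans (length-cs (List.replicate n clear)) length-rep
    plain : All Plain cells
    plain = all-cs (λ _ → refl , refl) _
    all-clear : ∀ n → All (Clear w c) (List.replicate n clear)
    all-clear zero = []
    all-clear (suc n) = (λ i _ → Vecₚ.lookup-replicate i false) ∷ all-clear n
    total : ℕ
    total = (((length pre + n * hSize) + length mid) + suc n ^ c * length w) + length post
    fits : ∀ {m} → m ≤ total → n + m ≤ L
    fits = +-monoʳ-≤ n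
    l₁ : length O₁ ≤ length pre + n * hSize
    l₁ = ≤-trans (≤-reflexive (length-++ pre)) (+-monoʳ-≤ (length pre) (length-h x))
    l₂ : length O₂ ≤ (length pre + n * hSize) + length mid
    l₂ = ≤-trans (≤-reflexive (length-++ O₁)) (+-monoˡ-≤ (length mid) l₁)
    l₃ : length O₃ ≤ ((length pre + n * hSize) + length mid) + suc n ^ c * length w
    l₃ = ≤-trans (≤-reflexive (trans (length-++ O₂) (cong (length O₂ +_) (length-power w (suc n ^ c))))) (+-monoˡ-≤ _ l₂)
    s₄ : length (O₃ ++ post) ≤ total
    s₄ = ≤-trans (≤-reflexive (length-++ O₃)) (+-monoˡ-≤ (length post) l₃)
    s₃ : length O₃ ≤ total
    s₃ = ≤-trans l₃ (m≤m+n _ _)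
    s₂ : length O₂ ≤ total
    s₂ = ≤-trans l₂ (≤-trans (m≤m+n _ _) (m≤m+n _ _))
    s₁ : length O₁ ≤ total
    s₁ = ≤-trans l₁ (≤-trans (m≤m+n _ _) (≤-trans (m≤m+n _ _) (m≤m+n _ _)))

  out-polytime : PolyTimeComputable out
  out-polytime = does-polytime c mainP out time time-poly mainP-does

-- The reduction

power-power : ∀ w a b → power (power w a) b ≡ power w (b * a)
power-power w a zero = refl
power-power w a (suc b) = trans (cong (power w a ++_) (power-power w a b)) (sym (power-+ w a (b * a)))

module Text (prog : List Instr) (c : ℕ) where

  -- The nested loops count to (n + 1) ^ c. The factor 2 ^ c lifts this to (n + 2) ^ c, and the
  -- summand 2 leaves room for doubling the running time and for strict inequalities.
  levels : ℕ → ℕ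
  levels n = suc n ^ c * (2 ^ c + 2)

  φ : List Bool → Formula 0
  φ x = mainF prog (wordI x) (levels (length x))

  letterStr : Bool → List Bool
  letterStr b = instrStr stp ++ instrStr (tst (just (lab (just b))))

  lastStr preStr midStr : List Bool
  lastStr = instrStr stp ++ instrStr (tst (just (lab nothing)))
  preStr = exConjStr ++ (concatMap instrStr prog ++ truthStr) ++ conjStr
  midStr = (lastStr ++ truthStr) ++ exConjStr ++ endStr

  open Reducer c preStr midStr baseStr (power levelStr (2 ^ c + 2)) letterStr using (out; out-polytime) public

  private
    wordStr : ∀ x → concatMap instrStr (wordI x) ≡ concatMap letterStr x ++ lastStr
    wordStr [] = cong (instrStr stp ++_) (++-identityʳ _)
    wordStr (b ∷ x) = trans (cong (λ s → instrStr stp ++ instrStr (tst (just (lab (just b)))) ++ s) (wordStr x))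
      (trans (sym (++-assoc (instrStr stp) (instrStr (tst (just (lab (just b))))) _)) (sym (++-assoc (letterStr b) (concatMap letterStr x) lastStr)))

    regroup : ∀ {A : Set} (a b d x l t e g p z : List A) →
      ((((a ++ b ++ d) ++ x) ++ ((l ++ t) ++ e ++ g)) ++ p) ++ z ≡ a ++ b ++ d ++ ((x ++ l) ++ t) ++ e ++ g ++ p ++ z
    regroup {A} a b d x l t e g p z = solve 10 (λ a b d x l t e g p z →
      ((((a ⊕ (b ⊕ d)) ⊕ x) ⊕ ((l ⊕ t) ⊕ (e ⊕ g))) ⊕ p) ⊕ z ⊜ a ⊕ (b ⊕ (d ⊕ (((x ⊕ l) ⊕ t) ⊕ (e ⊕ (g ⊕ (p ⊕ z)))))))
      refl a b d x l t e g p z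
      where open import Algebra.Solver.Monoid (++-monoid A)

  out≡ : ∀ x → out x ≡ encF (φ x)
  out≡ x = trans (cong (λ p → (((preStr ++ concatMap letterStr x) ++ midStr) ++ p) ++ baseStr) (power-power levelStr (2 ^ c + 2) (suc (length x) ^ c)))
    (trans (regroup exConjStr (concatMap instrStr prog ++ truthStr) conjStr (concatMap letterStr x) lastStr truthStr
        exConjStr (endStr) (power levelStr (levels (length x))) baseStr)
      (trans (cong (λ s → exConjStr ++ (concatMap instrStr prog ++ truthStr) ++ conjStr ++
          (s ++ truthStr) ++ exConjStr ++ endStr ++
          power levelStr (levels (length x)) ++ baseStr) (sym (wordStr x)))
        (sym (encF-mainF prog (wordI x) (levels (length x))))))

  private
    ^-distribʳ-* : ∀ c a b → (a * b) ^ c ≡ a ^ c * b ^ c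
    ^-distribʳ-* zero a b = refl
    ^-distribʳ-* (suc c) a b = trans (cong (a * b *_) (^-distribʳ-* c a b)) (arith a b (a ^ c) (b ^ c))
      where
      arith : ∀ a b p q → a * b * (p * q) ≡ a * p * (b * q)
      arith = solve-∀

  levels≥ : ∀ n → (n + 2) ^ c + 2 ≤ levels n
  levels≥ n = ≤-trans (+-mono-≤ (≤-trans (^-monoˡ-≤ c two) (≤-reflexive (^-distribʳ-* c (suc n) 2))) (*-monoˡ-≤ 2 (m^n>0 (suc n) c)))
    (≤-reflexive (sym (*-distribˡ-+ (suc n ^ c) (2 ^ c) 2)))
    where
    two : n + 2 ≤ suc n * 2
    two = ≤-trans (m≤m+n (n + 2) n) (≤-reflexive (arith n))
      where
      arith : ∀ n → n + 2 + n ≡ suc n * 2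
      arith = solve-∀

module Reduction (M : TM) (c₀ : ℕ) where
  open Simulation M using (prog; accepted⇒; accepted⇐; witness⇒accepted; accepted⇒witness)
  -- The exponent is one larger than that of the time bound, so that even for c₀ = 0 the number of
  -- levels exceeds n + 1 and the input fits into the strings.
  open Text prog (suc c₀) public

  module _ (x : List Bool) where
    private
      n q k : ℕ
      n = length x
      q = (n + 2) ^ c₀
      k = levels n

    T₀ : ℕ
    T₀ = 2 ^ (2 ^ q)

    private
      n+2>0 : 0 < n + 2
      n+2>0 = ≤-trans (s≤s z≤n) (m≤n+m 2 n)

      q>0 : 0 < q
      q>0 = subst (λ m → 0 < m ^ c₀) (+-comm 2 n) (m^n>0 (2 + n) c₀)

      q+2≤k : q + 2 ≤ k
      q+2≤k = ≤-trans (+-monoˡ-≤ 2 (≤-trans (≤-reflexive (sym (*-identityˡ q))) (*-monoˡ-≤ q n+2>0))) (levels≥ n)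

      n<k : suc n < k
      n<k = ≤-trans (≤-trans (≤-reflexive (+-comm 2 n)) (≤-trans (≤-reflexive (sym (*-identityʳ (n + 2)))) (*-monoʳ-≤ (n + 2) q>0)))
        (≤-trans (m≤m+n _ 2) (levels≥ n))

      long : suc n < 2 ^ k
      long = <-trans n<k (n<2^n k)

      exponent : suc (2 ^ q) < 2 ^ k
      exponent = ≤-trans (≤-trans (+-mono-≤ (*-monoʳ-≤ 2 (m^n>0 2 q)) (m≤m+n (2 ^ q) (2 ^ q)))
        (≤-reflexive (arith (2 ^ q)))) (≤-trans (≤-reflexive (sym (^-distribˡ-+-* 2 q 2))) (^-monoʳ-≤ 2 q+2≤k))
        where
        arith : ∀ m → 2 * m + (m + m) ≡ m * 4
        arith = solve-∀

      -- In the sheared diagram the head may advance two columns per step, so column numbers up to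
      -- twice the time have to be written with 2 ^ k digits.
      T+T< : T₀ + T₀ < 2 ^ (2 ^ k)
      T+T< = ≤-<-trans (≤-reflexive (sym (double (2 ^ q)))) (^-monoʳ-< 2 (s≤s (s≤s z≤n)) exponent)

    reduction⇒ : HaltsWithin M T₀ x → AcceptsIn M T₀ x → FOTh (out x)
    reduction⇒ halts accepts = φ x , sym (out≡ x) , mainF-complete prog (wordI x) k (proj₁ witness) (proj₂ witness)
      where
      derivation = accepted⇐ x T₀ halts accepts
      witness : Σ (BTree Lab) (Witness prog (wordI x) k)
      witness = accepted⇒witness x k long (≤-<-trans (m≤m+n T₀ T₀) T+T<) (≤-<-trans (proj₁ (proj₂ derivation)) T+T<)
        (proj₁ (proj₂ (proj₂ (proj₂ derivation)))) (proj₂ (proj₂ (proj₂ (proj₂ derivation))))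

    reduction⇐ : HaltsWithin M T₀ x → FOTh (out x) → AcceptsIn M T₀ x
    -- From the double negation of a witness it is enough to refute rejection.
    reduction⇐ halts (ψ , e , sat) = must λ rejected →
      mainF-sound prog (wordI x) k (subst (λ ψ → Sat ψ noVar) (encF-injective ψ (φ x) (trans e (out≡ x))) sat) λ { (t , w) →
        case trans (sym rejected) (accepted⇒ x T₀ halts (witness⇒accepted x k t w)) of λ () }

hard : TwoEXPTIMEHard FOTh
hard L (M , c₀ , decides) = out , out-polytime , λ x → mk⇔
  (λ l → reduction⇒ x (proj₁ (decides x)) (Equivalence.to (proj₂ (decides x)) l))
  (λ s → Equivalence.from (proj₂ (decides x)) (reduction⇐ x (proj₁ (decides x)) s))
  where open Reduction M c₀

theorem7 : Σ ℕ λ s → Σ (Fin s → ℕ) λ ar → Σ (TAPres s ar) λ P →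
    Pres.BoundedDegree (proj₁ P) × Pres.LinearGrowth (proj₁ P) ×
    TwoEXPTIMEHard (Pres.FOTh (proj₁ P))
theorem7 = nRel , arity , (D₀ , congruence) , boundedDegree , linearGrowth , hard
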